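{- Satisfiability of $\mathrm{MITL}[\mathsf F_I]$ (and hence of $\mathrm{MITL}[\mathsf F_I,\mathsf P_I]$) is EXPSPACE-hard.
   Context: Timed words: let $\Sigma$ be a finite alphabet. A timed word over $\Sigma$ is a finite nonempty sequence $\rho=(\sigma_1,\tau_1)\cdots(\sigma_n,\tau_n)$ with $\sigma_i\in\Sigma$ and real time stamps $0=\tau_1<\tau_2<\cdots<\tau_n$ (strictly monotonic time). Logic $\mathrm{MITL}[\mathsf F_I,\mathsf P_I]$: formulas are $\phi::= a\mid \phi\lor\phi\mid\neg\phi\mid \mathsf F_I\phi\mid \mathsf P_I\phi$ with $a\in\Sigma$ and $I$ a non-singular interval (not of the form $[c,c]$) with non-negative integer endpoints, open or closed at each end, whose right endpoint may be $\infty$. Semantics: $\rho,i\models a$ iff $\sigma_i=a$; Boolean connectives as usual; $\rho,i\models\mathsf F_I\phi$ iff there is $j>i$ with $\tau_j-\tau_i\in I$ and $\rho,j\models\phi$; $\rho,i\models\mathsf P_I\phi$ iff there is $j<i$ with $\tau_i-\tau_j\in I$ and $\rho,j\models\phi$. $\mathrm{MITL}[\mathsf F_I]$ is the fragment without $\mathsf P_I$. A formula $\phi$ is satisfiable if $\rho,1\models\phi$ for some timed word $\rho$. The satisfiability problem takes as input a formula (over a finite alphabet that is part of the input) with time constants written in binary. -}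

module Defs where

open import Data.Bool using (Bool; true; false; if_then_else_)
open import Data.Empty using (⊥)
open import Data.Fin as Fin using (Fin; toℕ)
open import Data.Integer using (+_)
import Data.Integer.Tactic.RingSolver as ℤ-Solver
open import Data.List using (List; []; _∷_; _++_; [_]; length; map; replicate; reverse)
open import Data.Maybe using (Maybe; just; nothing)
open import Data.Nat as ℕ using (ℕ; zero; suc; _^_)
open import Data.Product using (Σ; ∃-syntax; _×_; _,_)
open import Data.Rational as ℚ using (ℚ; _/_; ∣_∣)
import Data.Rational.Properties as ℚ
import Data.Rational.Unnormalised as ℚᵘ
import Data.Rational.Unnormalised.Properties as ℚᵘ
open import Data.Rational.Solver using (module +-*-Solver)
open import Data.Sum using (_⊎_; inj₁; inj₂)
open import Data.Unit using (⊤)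
open import Data.Vec as Vec using (Vec)
open import Function.Bundles using (_⇔_)
open import Relation.Binary.PropositionalEquality
  using (_≡_; refl; sym; trans; cong; cong₂; subst)
open import Relation.Nullary using (¬_)

ε : ℕ → ℚ
ε n = + 1 / suc n

-- Bishop's regular sequences: the n-th term is within ε n of the limit.
record ℝ : Set where
  constructor mkℝ
  field
    seq     : ℕ → ℚ
    regular : ∀ m n → ∣ seq m ℚ.- seq n ∣ ℚ.≤ ε m ℚ.+ ε n
open ℝ public

infix 4 _<ℝ_ _≤ℝ_ _≃ℝ_
infixl 6 _-ℝ_

_<ℝ_ : ℝ → ℝ → Set
x <ℝ y = ∃[ n ] seq x n ℚ.+ (ε n ℚ.+ ε n) ℚ.< seq y n

_≤ℝ_ : ℝ → ℝ → Set
x ≤ℝ y = ¬ (y <ℝ x)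

_≃ℝ_ : ℝ → ℝ → Set
x ≃ℝ y = x ≤ℝ y × y ≤ℝ x

0≤ε : ∀ n → ℚ.0ℚ ℚ.≤ ε n
0≤ε n = ℚ.nonNegative⁻¹ (ε n) ⦃ ℚ.normalize-nonNeg 1 (suc n) ⦄

fromℚ : ℚ → ℝ
fromℚ p = mkℝ (λ _ → p) λ m n →
  subst (ℚ._≤ ε m ℚ.+ ε n) (sym (cong ∣_∣ (ℚ.+-inverseʳ p)))
        (ℚ.+-mono-≤ (0≤ε m) (0≤ε n))

fromℕ : ℕ → ℝ
fromℕ n = fromℚ (+ n / 1)

-- suc (twice n) is 2 (n + 1), so that ε (twice n) is half of ε n.
twice : ℕ → ℕ
twice n = suc (n ℕ.+ n)

ε-half : ∀ n → ε (twice n) ℚ.+ ε (twice n) ≡ ε n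
ε-half n = ℚ.toℚᵘ-injective (begin
  ℚ.toℚᵘ (ε t ℚ.+ ε t)               ≈⟨ ℚ.toℚᵘ-homo-+ (ε t) (ε t) ⟩
  ℚ.toℚᵘ (ε t) ℚᵘ.+ ℚ.toℚᵘ (ε t)     ≈⟨ ℚᵘ.+-cong (unnorm t) (unnorm t) ⟩
  ℚᵘ.mkℚᵘ (+ 1) t ℚᵘ.+ ℚᵘ.mkℚᵘ (+ 1) t   ≈⟨ ℚᵘ.*≡* (halves (+ n)) ⟩
  ℚᵘ.mkℚᵘ (+ 1) n                    ≈⟨ ℚᵘ.≃-sym (unnorm n) ⟩
  ℚ.toℚᵘ (ε n)                       ∎)
  where
  open import Relation.Binary.Reasoning.Setoid ℚᵘ.≃-setoid
  open import Data.Integer using (_+_; _*_)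
  t = twice n
  unnorm : ∀ k → ℚ.toℚᵘ (ε k) ℚᵘ.≃ ℚᵘ.mkℚᵘ (+ 1) k
  unnorm k = ℚ.toℚᵘ-fromℚᵘ (ℚᵘ.mkℚᵘ (+ 1) k)
  halves : ∀ k → (+ 1 * (+ 2 + (k + k)) + + 1 * (+ 2 + (k + k))) * (+ 1 + k)
               ≡ + 1 * ((+ 2 + (k + k)) * (+ 2 + (k + k)))
  halves = ℤ-Solver.solve-∀

rearrange : ∀ a b c d → (a ℚ.- b) ℚ.- (c ℚ.- d) ≡ (a ℚ.- c) ℚ.- (b ℚ.- d)
rearrange = solve 4 (λ a b c d → (a :- b) :- (c :- d) := (a :- c) :- (b :- d)) refl
  where open +-*-Solver

pair : ∀ a b → (a ℚ.+ b) ℚ.+ (a ℚ.+ b) ≡ (a ℚ.+ a) ℚ.+ (b ℚ.+ b)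
pair = solve 2 (λ a b → (a :+ b) :+ (a :+ b) := (a :+ a) :+ (b :+ b)) refl
  where open +-*-Solver

_-ℝ_ : ℝ → ℝ → ℝ
x -ℝ y = mkℝ (λ n → seq x (twice n) ℚ.- seq y (twice n)) λ m n →
  let u = twice m ; v = twice n in begin
  ∣ (seq x u ℚ.- seq y u) ℚ.- (seq x v ℚ.- seq y v) ∣
    ≡⟨ cong ∣_∣ (rearrange (seq x u) (seq y u) (seq x v) (seq y v)) ⟩
  ∣ (seq x u ℚ.- seq x v) ℚ.- (seq y u ℚ.- seq y v) ∣
    ≤⟨ ℚ.∣p-q∣≤∣p∣+∣q∣ (seq x u ℚ.- seq x v) (seq y u ℚ.- seq y v) ⟩
  ∣ seq x u ℚ.- seq x v ∣ ℚ.+ ∣ seq y u ℚ.- seq y v ∣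
    ≤⟨ ℚ.+-mono-≤ (regular x u v) (regular y u v) ⟩
  (ε u ℚ.+ ε v) ℚ.+ (ε u ℚ.+ ε v)
    ≡⟨ pair (ε u) (ε v) ⟩
  (ε u ℚ.+ ε u) ℚ.+ (ε v ℚ.+ ε v)
    ≡⟨ cong₂ ℚ._+_ (ε-half m) (ε-half n) ⟩
  ε m ℚ.+ ε n ∎
  where open ℚ.≤-Reasoning

record TimedWord (A : Set) : Set where
  field
    size-1  : ℕ
  Position : Set
  Position = Fin (suc size-1)
  field
    letter  : Position → A
    time    : Position → ℝ
    starts  : time Fin.zero ≃ℝ fromℕ 0
    strict  : ∀ {i j} → i Fin.< j → time i <ℝ time j

data Bracket : Set where
  closed open′ : Bracket

-- Requiring l < u for a bounded interval rules out the singular intervals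
-- [c,c] and the degenerate (empty) ones.
data Interval : Set where
  bounded   : Bracket → (l u : ℕ) → Bracket → .(l ℕ.< u) → Interval
  unbounded : Bracket → ℕ → Interval

_above_ : ℝ → Bracket × ℕ → Set
x above (closed , l) = fromℕ l ≤ℝ x
x above (open′  , l) = fromℕ l <ℝ x

_below_ : ℝ → Bracket × ℕ → Set
x below (closed , u) = x ≤ℝ fromℕ u
x below (open′  , u) = x <ℝ fromℕ u

infix 4 _∈ᴵ_

_∈ᴵ_ : ℝ → Interval → Set
x ∈ᴵ bounded lb l u ub _ = x above (lb , l) × x below (ub , u)
x ∈ᴵ unbounded lb l      = x above (lb , l)

data Formula (A : Set) : Set where
  atom : A → Formula A
  _or_ : Formula A → Formula A → Formula A
  neg  : Formula A → Formula A
  F P  : Interval → Formula A → Formula A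

PastFree : ∀ {A} → Formula A → Set
PastFree (atom a) = ⊤
PastFree (φ or ψ) = PastFree φ × PastFree ψ
PastFree (neg φ)  = PastFree φ
PastFree (F I φ)  = PastFree φ
PastFree (P I φ)  = ⊥

module _ {A : Set} (ρ : TimedWord A) where
  open TimedWord ρ

  Models : Position → Formula A → Set
  Models i (atom a) = letter i ≡ a
  Models i (φ or ψ) = Models i φ ⊎ Models i ψ
  Models i (neg φ)  = ¬ Models i φ
  Models i (F I φ)  = ∃[ j ] i Fin.< j × (time j -ℝ time i) ∈ᴵ I × Models j φ
  Models i (P I φ)  = ∃[ j ] j Fin.< i × (time i -ℝ time j) ∈ᴵ I × Models j φ

Satisfiable : ∀ {A} → Formula A → Set
Satisfiable {A} φ = Σ (TimedWord A) λ ρ → Models ρ Fin.zero φ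

data Token : Set where
  mark sep bit0 bit1 inf               : Token
  [-tok ⟨-tok ]-tok ⟩-tok              : Token
  atom-tok or-tok neg-tok F-tok P-tok  : Token

increment : List Bool → List Bool
increment []           = [ true ]
increment (false ∷ bs) = true ∷ bs
increment (true ∷ bs)  = false ∷ increment bs

-- Least significant bit first, no superfluous zeros; zero is the empty string.
bits : ℕ → List Bool
bits zero    = []
bits (suc n) = increment (bits n)

binary : ℕ → List Token
binary n = map (λ b → if b then bit1 else bit0) (bits n)

leftBracket rightBracket : Bracket → Token
leftBracket closed  = [-tok
leftBracket open′   = ⟨-tok
rightBracket closed = ]-tok
rightBracket open′  = ⟩-tok

encodeInterval : Interval → List Token
encodeInterval (bounded lb l u ub _) =
  leftBracket lb ∷ binary l ++ sep ∷ binary u ++ [ rightBracket ub ]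
encodeInterval (unbounded lb l) =
  leftBracket lb ∷ binary l ++ sep ∷ inf ∷ [ ⟩-tok ]

-- Polish notation.  Letters are given by their (unary) position in the
-- alphabet; only time constants are written in binary.
encodeFormula : ∀ {m} → Formula (Fin m) → List Token
encodeFormula (atom a) = atom-tok ∷ replicate (toℕ a) mark ++ [ sep ]
encodeFormula (φ or ψ) = or-tok ∷ encodeFormula φ ++ encodeFormula ψ
encodeFormula (neg φ)  = neg-tok ∷ encodeFormula φ
encodeFormula (F I φ)  = F-tok ∷ encodeInterval I ++ encodeFormula φ
encodeFormula (P I φ)  = P-tok ∷ encodeInterval I ++ encodeFormula φ

-- The alphabet Fin m is part of the instance, listed with one mark per letter.
encode : ∀ {m} → Formula (Fin m) → List Token
encode {m} φ = replicate m mark ++ sep ∷ encodeFormula φ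

Language : Set → Set₁
Language A = List A → Set

SAT-MITL[F,P] : Language Token
SAT-MITL[F,P] w =
  ∃[ m ] Σ (Formula (Fin m)) λ φ → encode φ ≡ w × Satisfiable φ

SAT-MITL[F] : Language Token
SAT-MITL[F] w =
  ∃[ m ] Σ (Formula (Fin m)) λ φ → PastFree φ × encode φ ≡ w × Satisfiable φ

data Symbol (A : Set) (g : ℕ) : Set where
  blank : Symbol A g
  input : A → Symbol A g
  work  : Fin g → Symbol A g

data Move : Set where
  left right stay : Move

-- Deterministic machines with k two-way infinite tapes.  A is meant to be
-- finite, which makes the tape alphabet finite.  The machine halts exactly when δ yields nothing.
record TM (k : ℕ) (A : Set) : Set where
  field
    states works : ℕ
    start        : Fin states
    accepting    : Fin states → Bool
    δ            : Fin states → Vec (Symbol A works) k →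
                   Maybe (Fin states × Vec (Symbol A works × Move) k)

-- The cells visited so far: those to the left of the head (nearest first),
-- the scanned one, those to the right.  All other cells are blank.
record Tape (A : Set) (g : ℕ) : Set where
  constructor tape
  field
    before : List (Symbol A g)
    head   : Symbol A g
    after  : List (Symbol A g)

module _ {A : Set} {g : ℕ} where

  loadTape : List A → Tape A g
  loadTape []       = tape [] blank []
  loadTape (x ∷ xs) = tape [] (input x) (map input xs)

  cells : Tape A g → List (Symbol A g)
  cells (tape ls h rs) = reverse ls ++ h ∷ rs

  updateTape : Tape A g → Symbol A g × Move → Tape A g
  updateTape (tape []       _ rs)       (s , left)  = tape []       blank (s ∷ rs)
  updateTape (tape (l ∷ ls) _ rs)       (s , left)  = tape ls       l     (s ∷ rs)
  updateTape (tape ls       _ [])       (s , right) = tape (s ∷ ls) blank []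
  updateTape (tape ls       _ (r ∷ rs)) (s , right) = tape (s ∷ ls) r     rs
  updateTape (tape ls       _ rs)       (s , stay)  = tape ls       s     rs

  Shows : Tape A g → List A → Set
  Shows t w = ∃[ i ] ∃[ j ]
    cells t ≡ replicate i blank ++ map input w ++ replicate j blank

module Run {k : ℕ} {A : Set} (M : TM (suc k) A) where
  open TM M

  record Config : Set where
    constructor config
    field
      state : Fin states
      tapes : Vec (Tape A works) (suc k)

  init : List A → Config
  init w = config start (loadTape w Vec.∷ Vec.replicate k (loadTape []))

  step : Config → Maybe Config
  step (config q ts) with δ q (Vec.map Tape.head ts)
  ... | nothing       = nothing
  ... | just (q′ , a) = just (config q′ (Vec.zipWith updateTape ts a))

  run : ℕ → Config → Config
  run zero    c = c
  run (suc t) c with step c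
  ... | nothing = c
  ... | just c′ = run t c′

  Halted : Config → Set
  Halted c = step c ≡ nothing

  Accepting : Config → Set
  Accepting c = accepting (Config.state c) ≡ true

  space : Config → ℕ
  space c = Vec.sum (Vec.map (λ t → length (cells t)) (Config.tapes c))

-- Every polynomial is dominated by some n ^ c + c.
poly : ℕ → ℕ → ℕ
poly c n = n ^ c ℕ.+ c

-- Single-tape machines suffice: passing from several tapes to one costs only
-- a constant factor in space.
EXPSPACE : ∀ {A} → Language A → Set
EXPSPACE {A} L =
  Σ (TM 1 A) λ M → let open Run M in
    (∀ w → ∃[ t ] Halted (run t (init w)) × (Accepting (run t (init w)) ⇔ L w))
    × (∃[ c ] ∀ w t → space (run t (init w)) ℕ.≤ 2 ^ poly c (length w))

-- The input is on the first tape and the output on the last.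
PolyTime : ∀ {A B} → (List A → List B) → Set
PolyTime {A} {B} f =
  ∃[ k ] Σ (TM (suc k) (A ⊎ B)) λ M → let open Run M in
    ∃[ c ] ∀ w → ∃[ t ]
      let final = run t (init (map inj₁ w)) in
      t ℕ.≤ poly c (length w)
      × Halted final
      × Shows (Vec.last (Config.tapes final)) (map inj₂ (f w))

infix 4 _≤ₚ_

_≤ₚ_ : ∀ {A B} → Language A → Language B → Set
_≤ₚ_ {A} {B} L K =
  Σ (List A → List B) λ f → PolyTime f × (∀ w → L w ⇔ K (f w))

EXPSPACE-hard : ∀ {B} → Language B → Set₁
EXPSPACE-hard K = ∀ m (L : Language (Fin m)) → EXPSPACE L → L ≤ₚ K

{-# OPTIONS --safe #-}
-- A computation in bounded space is written as a timed word in which consecutive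
-- events are 16 to 17 time units apart and every event has an image at a distance
-- in [span, span + 1], where span is an exponential written in binary. Although
-- these windows are not singular, the images of neighbours are less than two gaps
-- apart, so no event fits between them, and the image of the k-th event is the
-- (k + W)-th for a fixed W. Hence a formula can prescribe the letter at place
-- k + W from those at k - 1, k and k + 1: the word is a space-time diagram of the
-- machine, wound on a helix of circumference W. Only the constants and a chain of
-- subformulas spelling the input depend on the input, and nested loops over the
-- input print them.
--
-- Comparing reals is undecidable, so a model of the formula is analysed through
-- rational approximations of its time stamps, whose error the windows absorb, and
-- under a double negation, which decidability of acceptance removes.

module Submission where

open import Data.Bool using (Bool; true; false; if_then_else_; _∧_; T)
import Data.Bool.Properties as Bool
open import Data.Bool.Properties using (¬-not)
open import Data.Empty using (⊥; ⊥-elim)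
open import Data.Fin as Fin using (Fin; toℕ)
import Data.Fin.Properties as Fin
import Data.Integer as ℤ
open import Data.List using (List; []; _∷_; _++_; [_]; length; map; replicate; reverse; concatMap; _ʳ++_)
import Data.List.Properties as List
open import Data.Maybe using (Maybe; just; nothing)
open import Data.Nat
open import Data.Nat.Properties
open import Data.Nat.DivMod using (m≡m%n+[m/n]*n; [m+kn]%n≡m%n; m%n<n; m<n⇒m%n≡m; m*n/n≡m; m<n⇒m/n≡0; +-distrib-/-∣ʳ)
open import Data.Nat.Divisibility using (divides)
open import Data.Nat.Induction using (<-rec)
open import Relation.Binary.Definitions using (tri<; tri≈; tri>)
open import Data.Nat.Tactic.RingSolver using (solve-∀)
open import Data.Product using (Σ; ∃; ∃-syntax; _×_; _,_; proj₁; proj₂)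
open import Data.Rational as ℚ using (ℚ)
import Data.Rational.Properties as ℚ
import Data.Rational.Unnormalised as ℚᵘ
import Data.Rational.Unnormalised.Properties as ℚᵘ
open import Data.Rational.Solver using (module +-*-Solver)
import Data.Integer.Properties as ℤ
import Data.Integer.Tactic.RingSolver as ℤ-Solver
open import Data.Sum using (_⊎_; inj₁; inj₂)
open import Data.Unit using (⊤; tt)
open import Data.Vec as Vec using (Vec)
import Data.Vec.Properties as Vec
open import Function using (_∘_; id; case_of_)
open import Function.Bundles using (_⇔_; mk⇔; Equivalence)
open import Relation.Binary.PropositionalEquality hiding ([_])
open import Relation.Nullary using (¬_; yes; no; contradiction)
open import Relation.Nullary.Decidable using (decidable-stable)
open import Defs

-- Unique readability of encodings

-- A punctual window [c,c] would pin down the copy of an event. A window of positive length leaves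
-- its time open, and without past operators nothing can be demanded at the copy about the event it
-- comes from. What is carried from row to row is therefore the index alone: each image is located
-- in the window of its own original, so gaps may drift between rows while no error adds up. The
-- circumference W is not prescribed. It is read off the model as the index of the image of the
-- first event and may differ between models. What matters is that W is at least 2 S + 2, where S
-- bounds the space: the head then never meets the place where one row passes into the next. The
-- factor 64 between S and the span guarantees this even if all gaps are as long as allowed. A
-- finite word must break off somewhere, so a copy is demanded only of an event that has some event
-- beyond its window. Any prefix of the infinite diagram that reaches past an accepting cell and
-- into the second row is then a model, at the price that nothing is known about the letter of the
-- last event.

bit : Bool → Token
bit b = if b then bit1 else bit0

bit-injective : ∀ {a b} → bit a ≡ bit b → a ≡ b
bit-injective {false} {false} _ = refl
bit-injective {true}  {true}  _ = refl

-- A numeral carries no length: it ends at the first token that is not a bit.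
Delimiter : Token → Set
Delimiter x = ∀ b → bit b ≢ x

sep-delimiter : Delimiter sep
sep-delimiter false ()
sep-delimiter true  ()

inf-delimiter : Delimiter inf
inf-delimiter false ()
inf-delimiter true  ()

rightBracket-delimiter : ∀ b → Delimiter (rightBracket b)
rightBracket-delimiter closed false ()
rightBracket-delimiter closed true  ()
rightBracket-delimiter open′  false ()
rightBracket-delimiter open′  true  ()

leftBracket-injective : ∀ {a b} → leftBracket a ≡ leftBracket b → a ≡ b
leftBracket-injective {closed} {closed} _ = refl
leftBracket-injective {open′}  {open′}  _ = refl

rightBracket-injective : ∀ {a b} → rightBracket a ≡ rightBracket b → a ≡ b
rightBracket-injective {closed} {closed} _ = refl
rightBracket-injective {open′}  {open′}  _ = refl

delimited : ∀ as bs {x y r s} → Delimiter x → Delimiter y →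
            map bit as ++ x ∷ r ≡ map bit bs ++ y ∷ s → as ≡ bs × x ≡ y × r ≡ s
delimited []       []       dx dy e = refl , List.∷-injective e
delimited []       (b ∷ bs) dx dy e = contradiction (sym (List.∷-injectiveˡ e)) (dx b)
delimited (a ∷ as) []       dx dy e = contradiction (List.∷-injectiveˡ e) (dy a)
delimited (a ∷ as) (b ∷ bs) dx dy e
  with refl , rest ← delimited as bs dx dy (List.∷-injectiveʳ e)
  = cong (_∷ as) (bit-injective (List.∷-injectiveˡ e)) , rest

fromBits : List Bool → ℕ
fromBits []           = 0
fromBits (false ∷ bs) = 2 * fromBits bs
fromBits (true ∷ bs)  = suc (2 * fromBits bs)

fromBits-increment : ∀ bs → fromBits (increment bs) ≡ suc (fromBits bs)
fromBits-increment []           = refl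
fromBits-increment (false ∷ bs) = refl
fromBits-increment (true ∷ bs)  =
  trans (cong (2 *_) (fromBits-increment bs)) (*-suc 2 (fromBits bs))

fromBits-bits : ∀ n → fromBits (bits n) ≡ n
fromBits-bits zero    = refl
fromBits-bits (suc n) = trans (fromBits-increment (bits n)) (cong suc (fromBits-bits n))

bits-injective : ∀ {m n} → bits m ≡ bits n → m ≡ n
bits-injective {m} {n} e = trans (sym (fromBits-bits m)) (trans (cong fromBits e) (fromBits-bits n))

binary-delimited : ∀ m n {x y r s} → Delimiter x → Delimiter y →
                   binary m ++ x ∷ r ≡ binary n ++ y ∷ s → m ≡ n × x ≡ y × r ≡ s
binary-delimited m n dx dy e with bs , rest ← delimited (bits m) (bits n) dx dy e =
  bits-injective bs , rest

marks-delimited : ∀ a b {r s} → replicate a mark ++ sep ∷ r ≡ replicate b mark ++ sep ∷ s →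
                  a ≡ b × r ≡ s
marks-delimited zero    zero    e = refl , List.∷-injectiveʳ e
marks-delimited (suc a) (suc b) e with refl , e′ ← marks-delimited a b (List.∷-injectiveʳ e) = refl , e′

bounded-++ : ∀ lb l u ub .(l<u : l < u) r → encodeInterval (bounded lb l u ub l<u) ++ r ≡
             leftBracket lb ∷ binary l ++ sep ∷ binary u ++ rightBracket ub ∷ r
bounded-++ lb l u ub _ r = cong (leftBracket lb ∷_) (trans
  (List.++-assoc (binary l) (sep ∷ binary u ++ [ rightBracket ub ]) r)
  (cong (λ z → binary l ++ sep ∷ z) (List.++-assoc (binary u) [ rightBracket ub ] r)))

unbounded-++ : ∀ lb l r → encodeInterval (unbounded lb l) ++ r ≡
               leftBracket lb ∷ binary l ++ sep ∷ inf ∷ ⟩-tok ∷ r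
unbounded-++ lb l r = cong (leftBracket lb ∷_) (List.++-assoc (binary l) (sep ∷ inf ∷ [ ⟩-tok ]) r)

encodeInterval-prefix : ∀ I J r s → encodeInterval I ++ r ≡ encodeInterval J ++ s → I ≡ J × r ≡ s
encodeInterval-prefix (bounded lb l u ub p) (bounded lb′ l′ u′ ub′ p′) r s e
  with e₀ ← trans (sym (bounded-++ lb l u ub p r)) (trans e (bounded-++ lb′ l′ u′ ub′ p′ s))
  with refl ← leftBracket-injective (List.∷-injectiveˡ e₀)
  with refl , _ , e₁ ← binary-delimited l l′ sep-delimiter sep-delimiter (List.∷-injectiveʳ e₀)
  with refl , ee , e₂ ← binary-delimited u u′ (rightBracket-delimiter ub) (rightBracket-delimiter ub′) e₁
  with refl ← rightBracket-injective ee
  = refl , e₂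
encodeInterval-prefix (unbounded lb l) (unbounded lb′ l′) r s e
  with e₀ ← trans (sym (unbounded-++ lb l r)) (trans e (unbounded-++ lb′ l′ s))
  with refl ← leftBracket-injective (List.∷-injectiveˡ e₀)
  with refl , _ , e₁ ← binary-delimited l l′ sep-delimiter sep-delimiter (List.∷-injectiveʳ e₀)
  = refl , List.∷-injectiveʳ (List.∷-injectiveʳ e₁)
encodeInterval-prefix (bounded lb l u ub p) (unbounded lb′ l′) r s e
  with e₀ ← trans (sym (bounded-++ lb l u ub p r)) (trans e (unbounded-++ lb′ l′ s))
  with _ , _ , e₁ ← binary-delimited l l′ sep-delimiter sep-delimiter (List.∷-injectiveʳ e₀)
  with _ , ee , _ ← binary-delimited u 0 (rightBracket-delimiter ub) inf-delimiter e₁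
  with ub | ee
... | closed | ()
... | open′  | ()
encodeInterval-prefix (unbounded lb′ l′) (bounded lb l u ub p) r s e
  with e₀ ← trans (sym (unbounded-++ lb′ l′ r)) (trans e (bounded-++ lb l u ub p s))
  with _ , _ , e₁ ← binary-delimited l′ l sep-delimiter sep-delimiter (List.∷-injectiveʳ e₀)
  with _ , ee , _ ← binary-delimited 0 u inf-delimiter (rightBracket-delimiter ub) e₁
  with ub | ee
... | closed | ()
... | open′  | ()

-- Polish notation has no closing marks, so injectivity alone would not pass through the binary
-- connective. The remainders `r` and `s` make the induction one for a prefix code.
encodeFormula-prefix : ∀ {m} (φ ψ : Formula (Fin m)) r s →
                       encodeFormula φ ++ r ≡ encodeFormula ψ ++ s → φ ≡ ψ × r ≡ s
encodeFormula-prefix (atom a) (atom b) r s e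
  with a≡b , e′ ← marks-delimited (toℕ a) (toℕ b)
         (trans (sym (List.++-assoc (replicate (toℕ a) mark) [ sep ] r))
                (trans (List.∷-injectiveʳ e) (List.++-assoc (replicate (toℕ b) mark) [ sep ] s)))
  = cong atom (Fin.toℕ-injective a≡b) , e′
encodeFormula-prefix (φ or φ′) (ψ or ψ′) r s e
  with refl , e′ ← encodeFormula-prefix φ ψ (encodeFormula φ′ ++ r) (encodeFormula ψ′ ++ s)
         (trans (sym (List.++-assoc (encodeFormula φ) _ r))
                (trans (List.∷-injectiveʳ e) (List.++-assoc (encodeFormula ψ) _ s)))
  with refl , e″ ← encodeFormula-prefix φ′ ψ′ r s e′
  = refl , e″
encodeFormula-prefix (neg φ) (neg ψ) r s e
  with refl , e′ ← encodeFormula-prefix φ ψ r s (List.∷-injectiveʳ e)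
  = refl , e′
encodeFormula-prefix (F I φ) (F J ψ) r s e
  with refl , e′ ← encodeInterval-prefix I J (encodeFormula φ ++ r) (encodeFormula ψ ++ s)
         (trans (sym (List.++-assoc (encodeInterval I) _ r))
                (trans (List.∷-injectiveʳ e) (List.++-assoc (encodeInterval J) _ s)))
  with refl , e″ ← encodeFormula-prefix φ ψ r s e′
  = refl , e″
encodeFormula-prefix (P I φ) (P J ψ) r s e
  with refl , e′ ← encodeInterval-prefix I J (encodeFormula φ ++ r) (encodeFormula ψ ++ s)
         (trans (sym (List.++-assoc (encodeInterval I) _ r))
                (trans (List.∷-injectiveʳ e) (List.++-assoc (encodeInterval J) _ s)))
  with refl , e″ ← encodeFormula-prefix φ ψ r s e′
  = refl , e″
encodeFormula-prefix (atom _) (_ or _) r s ()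
encodeFormula-prefix (atom _) (neg _)  r s ()
encodeFormula-prefix (atom _) (F _ _)  r s ()
encodeFormula-prefix (atom _) (P _ _)  r s ()
encodeFormula-prefix (_ or _) (atom _) r s ()
encodeFormula-prefix (_ or _) (neg _)  r s ()
encodeFormula-prefix (_ or _) (F _ _)  r s ()
encodeFormula-prefix (_ or _) (P _ _)  r s ()
encodeFormula-prefix (neg _)  (atom _) r s ()
encodeFormula-prefix (neg _)  (_ or _) r s ()
encodeFormula-prefix (neg _)  (F _ _)  r s ()
encodeFormula-prefix (neg _)  (P _ _)  r s ()
encodeFormula-prefix (F _ _)  (atom _) r s ()
encodeFormula-prefix (F _ _)  (_ or _) r s ()
encodeFormula-prefix (F _ _)  (neg _)  r s ()
encodeFormula-prefix (F _ _)  (P _ _)  r s ()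
encodeFormula-prefix (P _ _)  (atom _) r s ()
encodeFormula-prefix (P _ _)  (_ or _) r s ()
encodeFormula-prefix (P _ _)  (neg _)  r s ()
encodeFormula-prefix (P _ _)  (F _ _)  r s ()

-- Membership in the satisfiability languages asks for some satisfiable formula with the given
-- encoding. Uniqueness identifies it with the formula that the reduction intends.
encode-injective : ∀ {m n} (φ : Formula (Fin m)) (ψ : Formula (Fin n)) → encode φ ≡ encode ψ →
                   _≡_ {A = Σ ℕ (Formula ∘ Fin)} (m , φ) (n , ψ)
encode-injective {m} {n} φ ψ e with refl , e′ ← marks-delimited m n e =
  cong (m ,_) (proj₁ (encodeFormula-prefix φ ψ [] []
    (trans (List.++-identityʳ _) (trans e′ (sym (List.++-identityʳ _))))))

-- A while language compiled to multi-tape machines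

module _ {A : Set} {g : ℕ} (K : ℕ) where

  infixr 5 _⨾_

  Store : Set
  Store = Fin K → Tape A g

  -- In op j i f, tape j is rewritten and moved according to the symbols
  -- scanned on tape i and on tape j itself.
  data Program : Set where
    op    : (j i : Fin K) → (Symbol A g → Symbol A g → Symbol A g × Move) → Program
    _⨾_   : Program → Program → Program
    while : (i : Fin K) → (Symbol A g → Bool) → Program → Program

module _ {A : Set} {g K : ℕ} where

  data _⊢_⇒_within_ : Program {A} {g} K → Store K → Store K → ℕ → Set where
    do-op  : ∀ {j i f σ τ} →
             τ j ≡ updateTape (σ j) (f (Tape.head (σ i)) (Tape.head (σ j))) →
             (∀ k → k ≢ j → τ k ≡ σ k) → op j i f ⊢ σ ⇒ τ within 1
    _then_ : ∀ {p q σ τ υ s t} →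
             p ⊢ σ ⇒ τ within s → q ⊢ τ ⇒ υ within t → (p ⨾ q) ⊢ σ ⇒ υ within (s + t)
    stop   : ∀ {i b p σ} →
             b (Tape.head (σ i)) ≡ false → while i b p ⊢ σ ⇒ σ within 1
    again  : ∀ {i b p σ τ υ s t} → b (Tape.head (σ i)) ≡ true →
             p ⊢ σ ⇒ τ within s → while i b p ⊢ τ ⇒ υ within t →
             while i b p ⊢ σ ⇒ υ within suc (s + t)
    -- Stores are functions and usually agree only pointwise. This rule builds that agreement, and
    -- slack in the time, into the semantics.
    adjust : ∀ {p σ σ′ τ τ′ s t} → (∀ k → σ k ≡ σ′ k) → (∀ k → τ k ≡ τ′ k) → s ≤ t →
             p ⊢ σ′ ⇒ τ′ within s → p ⊢ σ ⇒ τ within t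

  -- One point for each `op` and one, `nothing`, for each loop test. Sequencing takes no step of its
  -- own.
  ControlPoint : Program {A} {g} K → Set
  ControlPoint (op j i f)    = ⊤
  ControlPoint (p ⨾ q)       = ControlPoint p ⊎ ControlPoint q
  ControlPoint (while i b p) = Maybe (ControlPoint p)

  entry : ∀ p → ControlPoint p
  entry (op j i f)    = tt
  entry (p ⨾ q)       = inj₁ (entry p)
  entry (while i b p) = nothing

  points : Program {A} {g} K → ℕ
  points (op j i f)    = 1
  points (p ⨾ q)       = points p + points q
  points (while i b p) = suc (points p)

  index : ∀ p → ControlPoint p → Fin (points p)
  index (op j i f)    tt       = Fin.zero
  index (p ⨾ q)       (inj₁ a) = index p a Fin.↑ˡ points q
  index (p ⨾ q)       (inj₂ a) = points p Fin.↑ʳ index q a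
  index (while i b p) nothing  = Fin.zero
  index (while i b p) (just a) = Fin.suc (index p a)

  point : ∀ p → Fin (points p) → ControlPoint p
  point (op j i f)    _           = tt
  point (p ⨾ q)       n           with Fin.splitAt (points p) n
  ... | inj₁ a = inj₁ (point p a)
  ... | inj₂ a = inj₂ (point q a)
  point (while i b p) Fin.zero    = nothing
  point (while i b p) (Fin.suc n) = just (point p n)

  point-index : ∀ p a → point p (index p a) ≡ a
  point-index (op j i f)    tt       = refl
  point-index (p ⨾ q)       (inj₁ a)
    rewrite Fin.splitAt-↑ˡ (points p) (index p a) (points q) = cong inj₁ (point-index p a)
  point-index (p ⨾ q)       (inj₂ a)
    rewrite Fin.splitAt-↑ʳ (points p) (points q) (index q a) = cong inj₂ (point-index q a)
  point-index (while i b p) nothing  = refl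
  point-index (while i b p) (just a) = cong just (point-index p a)

  idle : Vec (Symbol A g) K → Vec (Symbol A g × Move) K
  idle = Vec.map (_, stay)

  opAction : Fin K → Symbol A g × Move → Vec (Symbol A g) K → Vec (Symbol A g × Move) K
  opAction j a v = idle v Vec.[ j ]≔ a

  -- Continuation style: `at` embeds the control points into the final set of states and `exit` is
  -- where the program leaves. A subprogram then uses the table of the whole with `at` and `exit`
  -- specialised, and correctness is an induction without renumbering of states.
  next : ∀ p {X : Set} → (ControlPoint p → X) → X → ControlPoint p → Vec (Symbol A g) K →
         X × Vec (Symbol A g × Move) K
  next (op j i f)    at exit tt       v = exit , opAction j (f (Vec.lookup v i) (Vec.lookup v j)) v
  next (p ⨾ q)       at exit (inj₁ a) v = next p (at ∘ inj₁) (at (inj₂ (entry q))) a v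
  next (p ⨾ q)       at exit (inj₂ a) v = next q (at ∘ inj₂) exit a v
  next (while i b p) at exit nothing  v =
    (if b (Vec.lookup v i) then at (just (entry p)) else exit) , idle v
  next (while i b p) at exit (just a) v = next p (at ∘ just) (at nothing) a v

stay-put : ∀ {A g} (t : Tape A g) → updateTape t (Tape.head t , stay) ≡ t
stay-put (tape [] h [])             = refl
stay-put (tape [] h (_ ∷ _))        = refl
stay-put (tape (_ ∷ _) h [])        = refl
stay-put (tape (_ ∷ _) h (_ ∷ _))   = refl

lookup-idle : ∀ {A g K} (ts : Vec (Tape A g) K) k →
              updateTape (Vec.lookup ts k) (Vec.lookup (idle (Vec.map Tape.head ts)) k) ≡ Vec.lookup ts k
lookup-idle ts k
  rewrite Vec.lookup-map k (_, stay) (Vec.map Tape.head ts) | Vec.lookup-map k Tape.head ts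
  = stay-put (Vec.lookup ts k)

module _ {A : Set} {k : ℕ} (M : TM (suc k) A) where
  open TM M
  open Run M

  -- Quantifying over the rest of the run makes runs compose, although `run` unfolds from its first
  -- step.
  _↠[_]_ : Config → ℕ → Config → Set
  c ↠[ n ] d = ∀ t → run (n + t) c ≡ run t d

  ↠-trans : ∀ {c d e} m n → c ↠[ m ] d → d ↠[ n ] e → c ↠[ m + n ] e
  ↠-trans {c} m n f g t = trans (cong (λ x → run x c) (+-assoc m n t)) (trans (f (n + t)) (g t))

  ↠-step : ∀ {c d} → step c ≡ just d → c ↠[ 1 ] d
  ↠-step {c} e t with step c | e
  ... | just _ | refl = refl

  step-just : ∀ {q ts q′ a} → δ q (Vec.map Tape.head ts) ≡ just (q′ , a) →
              step (config q ts) ≡ just (config q′ (Vec.zipWith updateTape ts a))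
  step-just {q} {ts} e with δ q (Vec.map Tape.head ts) | e
  ... | just _ | refl = refl

  Implements : (p : Program {A} {works} (suc k)) → (ControlPoint p → Fin states) → Fin states → Set
  Implements p at exit = ∀ a v → δ (at a) v ≡ just (next p at exit a v)

  _≈_ : Vec (Tape A works) (suc k) → Store (suc k) → Set
  ts ≈ σ = ∀ i → Vec.lookup ts i ≡ σ i

  idle-≈ : ∀ ts {σ} → ts ≈ σ → Vec.zipWith updateTape ts (idle (Vec.map Tape.head ts)) ≈ σ
  idle-≈ ts ts≈σ i =
    trans (Vec.lookup-zipWith updateTape i ts (idle (Vec.map Tape.head ts)))
          (trans (lookup-idle ts i) (ts≈σ i))

  scanned : ∀ ts {σ} → ts ≈ σ → ∀ i → Vec.lookup (Vec.map Tape.head ts) i ≡ Tape.head (σ i)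
  scanned ts ts≈σ i = trans (Vec.lookup-map i Tape.head ts) (cong Tape.head (ts≈σ i))

  executes : ∀ {p σ τ B} at exit → Implements p at exit → p ⊢ σ ⇒ τ within B → ∀ ts → ts ≈ σ →
             ∃[ n ] n ≤ B × ∃[ ts′ ] ts′ ≈ τ × config (at (entry p)) ts ↠[ n ] config exit ts′
  executes {p = op j i f} {σ} {τ} at exit impl (do-op eq same) ts ts≈σ =
    1 , ≤-refl , Vec.zipWith updateTape ts acts , ok , ↠-step (step-just (impl tt _))
    where
    hs = Vec.map Tape.head ts
    acts = opAction j (f (Vec.lookup hs i) (Vec.lookup hs j)) hs
    ok : Vec.zipWith updateTape ts acts ≈ τ
    ok l with l Fin.≟ j
    ... | yes refl = begin
      Vec.lookup (Vec.zipWith updateTape ts acts) j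
        ≡⟨ Vec.lookup-zipWith updateTape j ts acts ⟩
      updateTape (Vec.lookup ts j) (Vec.lookup acts j)
        ≡⟨ cong₂ updateTape (ts≈σ j) (Vec.lookup∘updateAt j (idle hs)) ⟩
      updateTape (σ j) (f (Vec.lookup hs i) (Vec.lookup hs j))
        ≡⟨ cong (updateTape (σ j)) (cong₂ f (scanned ts ts≈σ i) (scanned ts ts≈σ j)) ⟩
      updateTape (σ j) (f (Tape.head (σ i)) (Tape.head (σ j)))
        ≡⟨ sym eq ⟩
      τ j ∎
      where open ≡-Reasoning
    ... | no l≢j = begin
      Vec.lookup (Vec.zipWith updateTape ts acts) l
        ≡⟨ Vec.lookup-zipWith updateTape l ts acts ⟩
      updateTape (Vec.lookup ts l) (Vec.lookup acts l)
        ≡⟨ cong (updateTape (Vec.lookup ts l)) (Vec.lookup∘updateAt′ l j l≢j (idle hs)) ⟩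
      updateTape (Vec.lookup ts l) (Vec.lookup (idle hs) l)
        ≡⟨ lookup-idle ts l ⟩
      Vec.lookup ts l
        ≡⟨ ts≈σ l ⟩
      σ l
        ≡⟨ sym (same l l≢j) ⟩
      τ l ∎
      where open ≡-Reasoning
  executes {p = p ⨾ q} at exit impl (_then_ {s = s} {t} x y) ts ts≈σ
    with m , m≤s , ts₁ , ≈₁ , r₁ ← executes (at ∘ inj₁) (at (inj₂ (entry q))) (λ a v → impl (inj₁ a) v) x ts ts≈σ
    with n , n≤t , ts₂ , ≈₂ , r₂ ← executes (at ∘ inj₂) exit (λ a v → impl (inj₂ a) v) y ts₁ ≈₁
    = m + n , +-mono-≤ m≤s n≤t , ts₂ , ≈₂ , ↠-trans m n r₁ r₂
  executes {p = while i b p} {σ} at exit impl (stop b≡false) ts ts≈σ =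
    1 , ≤-refl , _ , idle-≈ ts ts≈σ , ↠-step (step-just (trans (impl nothing _) (cong just (cong (_, _) exits))))
    where
    exits : (if b (Vec.lookup (Vec.map Tape.head ts) i) then at (just (entry p)) else exit) ≡ exit
    exits = cong (if_then at (just (entry p)) else exit) (trans (cong b (scanned ts ts≈σ i)) b≡false)
  executes {p = while i b p} {σ} at exit impl (again {s = s} {t} b≡true x y) ts ts≈σ
    with m , m≤s , ts₁ , ≈₁ , r₁ ← executes (at ∘ just) (at nothing) (λ a v → impl (just a) v) x (Vec.zipWith updateTape ts (idle (Vec.map Tape.head ts))) (idle-≈ ts ts≈σ)
    with n , n≤t , ts₂ , ≈₂ , r₂ ← executes at exit impl y ts₁ ≈₁
    = suc (m + n) , s≤s (+-mono-≤ m≤s n≤t) , ts₂ , ≈₂ ,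
      ↠-trans 1 (m + n) (↠-step (step-just (trans (impl nothing _) (cong just (cong (_, _) enters)))))
                        (↠-trans m n r₁ r₂)
    where
    enters : (if b (Vec.lookup (Vec.map Tape.head ts) i) then at (just (entry p)) else exit) ≡ at (just (entry p))
    enters = cong (if_then at (just (entry p)) else exit) (trans (cong b (scanned ts ts≈σ i)) b≡true)
  executes at exit impl (adjust σ≈ τ≈ s≤t x) ts ts≈σ
    with n , n≤s , ts₁ , ≈₁ , r ← executes at exit impl x ts (λ i → trans (ts≈σ i) (σ≈ i))
    = n , ≤-trans n≤s s≤t , ts₁ , (λ i → trans (≈₁ i) (sym (τ≈ i))) , r

compile : ∀ {A g k} → Program {A} {g} (suc k) → TM (suc k) A
compile {A} {g} {k} p = record
  { states    = suc (points p)
  ; works     = g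
  ; start     = Fin.suc (index p (entry p))
  ; accepting = λ _ → false
  ; δ         = δ
  }
  where
  δ : Fin (suc (points p)) → Vec (Symbol A g) (suc k) →
      Maybe (Fin (suc (points p)) × Vec (Symbol A g × Move) (suc k))
  δ Fin.zero    v = nothing
  δ (Fin.suc n) v = just (next p (Fin.suc ∘ index p) Fin.zero (point p n) v)

module _ {A : Set} {g k : ℕ} (p : Program {A} {g} (suc k)) where
  open Run (compile p)

  initialStore : List A → Store {A} {g} (suc k)
  initialStore w Fin.zero    = loadTape w
  initialStore w (Fin.suc _) = loadTape []

  init-≈ : ∀ w i → Vec.lookup (Config.tapes (init w)) i ≡ initialStore w i
  init-≈ w Fin.zero    = refl
  init-≈ w (Fin.suc i) = Vec.lookup-replicate i (loadTape [])

  compile-correct : ∀ {w τ B} → p ⊢ initialStore w ⇒ τ within B →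
                    ∃[ t ] t ≤ B × Halted (run t (init w)) ×
                    (∀ i → Vec.lookup (Config.tapes (run t (init w))) i ≡ τ i)
  compile-correct {w} {τ} x
    with t , t≤B , ts , ts≈τ , r ← executes (compile p) (Fin.suc ∘ index p) Fin.zero
      (λ a v → cong (λ z → just (next p (Fin.suc ∘ index p) Fin.zero z v)) (point-index p a)) x _ (init-≈ w)
    = t , t≤B , halted , final
    where
    reached : run t (init w) ≡ config Fin.zero ts
    reached = trans (cong (λ n → run n (init w)) (sym (+-identityʳ t))) (r 0)
    halted : Halted (run t (init w))
    halted = subst Halted (sym reached) refl
    final : ∀ i → Vec.lookup (Config.tapes (run t (init w))) i ≡ τ i
    final i = trans (cong (λ c → Vec.lookup (Config.tapes c) i) reached) (ts≈τ i)

-- Printing formulas in polynomial time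

infixl 8 _[_↦_]

_[_↦_] : ∀ {A : Set} {K} → (Fin K → A) → Fin K → A → Fin K → A
(σ [ i ↦ t ]) k with k Fin.≟ i
... | yes _ = t
... | no _  = σ k

updated : ∀ {A : Set} {K} (σ : Fin K → A) i t → (σ [ i ↦ t ]) i ≡ t
updated σ i t with i Fin.≟ i
... | yes _ = refl
... | no i≢i = contradiction refl i≢i

unchanged : ∀ {A : Set} {K} (σ : Fin K → A) i t k → k ≢ i → (σ [ i ↦ t ]) k ≡ σ k
unchanged σ i t k k≢i with k Fin.≟ i
... | yes k≡i = contradiction k≡i k≢i
... | no _ = refl

restored : ∀ {A : Set} {K} (σ : Fin K → A) i {t} → σ i ≡ t → ∀ k → (σ [ i ↦ t ]) k ≡ σ k
restored σ i e k with k Fin.≟ i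
... | yes refl = sym e
... | no _ = refl

module _ {A : Set} {g : ℕ} where

  nonblank : Symbol A g → Bool
  nonblank blank     = false
  nonblank (input _) = true
  nonblank (work _)  = true

  right-at-end : ∀ ls {h s : Symbol A g} →
                 updateTape (tape ls h []) (s , right) ≡ tape (s ∷ ls) blank []
  right-at-end []      = refl
  right-at-end (_ ∷ _) = refl

  right-inside : ∀ ls {h s r : Symbol A g} {rs} →
                 updateTape (tape ls h (r ∷ rs)) (s , right) ≡ tape (s ∷ ls) r rs
  right-inside []      = refl
  right-inside (_ ∷ _) = refl

  -- The head on the first letter of rs, with ls to its left and blanks beyond;
  -- a blank at the right end is only recorded once it has been visited.
  zipper : List (Symbol A g) → List A → List A → Tape A g
  zipper e ls []       = tape (map input ls ++ [ blank ]) blank []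
  zipper e ls (x ∷ rs) = tape (map input ls ++ [ blank ]) (input x) (map input rs ++ e)

  returning : List A → List A → Tape A g
  returning []       rs = tape [] blank (map input rs ++ [ blank ])
  returning (x ∷ ls) rs = tape (map input ls ++ [ blank ]) (input x) (map input rs ++ [ blank ])

  home : List A → Tape A g
  home = zipper [ blank ] []

  -- The first passage over a word finds nothing recorded behind its last letter. Stepping back from
  -- there leaves a blank, which every later passage finds.
  data RightEnd : List (Symbol A g) → Set where
    fresh : RightEnd []
    seen  : RightEnd [ blank ]

  zipper-right : ∀ {e} → RightEnd e → ∀ ls x rs →
                 updateTape (zipper e ls (x ∷ rs)) (input x , right) ≡ zipper e (x ∷ ls) rs
  zipper-right fresh ls x []       = right-at-end (map input ls ++ [ blank ])
  zipper-right seen  ls x []       = right-inside (map input ls ++ [ blank ])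
  zipper-right _     ls x (y ∷ rs) = right-inside (map input ls ++ [ blank ])

  zipper-left : ∀ e ls → updateTape (zipper e ls []) (blank , left) ≡ returning ls []
  zipper-left e []       = refl
  zipper-left e (x ∷ ls) = refl

  returning-left : ∀ x ls rs →
                   updateTape (returning (x ∷ ls) rs) (input x , left) ≡ returning ls (x ∷ rs)
  returning-left x []       rs = refl
  returning-left x (_ ∷ ls) rs = refl

  returning-home : ∀ rs → updateTape (returning [] rs) (blank , right) ≡ home rs
  returning-home []       = refl
  returning-home (x ∷ rs) = refl

  zipper-write : ∀ ls x → updateTape (zipper [] ls []) (input x , right) ≡ zipper [] (x ∷ ls) []
  zipper-write ls x = right-at-end (map input ls ++ [ blank ])

rewindTime : ℕ → ℕ
rewindTime n = 1 + ((n * 2 + 1) + 1)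

module _ {A : Set} {g K : ℕ} where

  move : Fin K → Move → Program {A} {g} K
  move i d = op i i (λ _ s → s , d)

  rewind : Fin K → Program {A} {g} K
  rewind i = move i left ⨾ while i nonblank (move i left) ⨾ move i right

  reach : ∀ {p : Program {A} {g} K} {σ τ τ′ s t} → (∀ k → τ k ≡ τ′ k) → s ≤ t →
          p ⊢ σ ⇒ τ′ within s → p ⊢ σ ⇒ τ within t
  reach = adjust (λ _ → refl)

  weaken : ∀ {p : Program {A} {g} K} {σ τ s t} → s ≤ t → p ⊢ σ ⇒ τ within s → p ⊢ σ ⇒ τ within t
  weaken = reach (λ _ → refl)

  from : ∀ {p : Program {A} {g} K} {σ σ′ τ t} → (∀ k → σ k ≡ σ′ k) →
         p ⊢ σ′ ⇒ τ within t → p ⊢ σ ⇒ τ within t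
  from e = adjust e (λ _ → refl) ≤-refl

  do-update : ∀ {j i f} {σ : Store {A} {g} K} {t} → updateTape (σ j) (f (Tape.head (σ i)) (Tape.head (σ j))) ≡ t →
              op j i f ⊢ σ ⇒ σ [ j ↦ t ] within 1
  do-update {j} {σ = σ} {t} e = do-op (trans (updated σ j t) (sym e)) (unchanged σ j t)

  do-move : ∀ {i d} {σ : Store {A} {g} K} {t u} → σ i ≡ t → updateTape t (Tape.head t , d) ≡ u →
            move i d ⊢ σ ⇒ σ [ i ↦ u ] within 1
  do-move refl e = do-update e

  returned : ∀ i ls rs σ → σ i ≡ returning ls rs →
             while i nonblank (move i left) ⊢ σ ⇒ σ [ i ↦ returning [] (ls ʳ++ rs) ] within (length ls * 2 + 1)
  returned i []       rs σ e =
    reach (restored σ i e) ≤-refl (stop (cong (nonblank ∘ Tape.head) e))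
  returned i (x ∷ ls) rs σ e =
    reach twice-updated ≤-refl
      (again (cong (nonblank ∘ Tape.head) e) (do-move e (returning-left x ls rs))
             (returned i ls (x ∷ rs) _ (updated σ i _)))
    where
    twice-updated : ∀ k → (σ [ i ↦ returning [] (ls ʳ++ x ∷ rs) ]) k ≡
      (σ [ i ↦ returning ls (x ∷ rs) ] [ i ↦ returning [] (ls ʳ++ x ∷ rs) ]) k
    twice-updated k with k Fin.≟ i
    ... | yes _ = refl
    ... | no k≢i = sym (unchanged σ i _ k k≢i)

  rewound : ∀ i e ls σ → σ i ≡ zipper e ls [] →
            rewind i ⊢ σ ⇒ σ [ i ↦ home (reverse ls) ] within rewindTime (length ls)
  rewound i e ls σ eq = reach thrice-updated ≤-refl
    (do-move eq (zipper-left e ls) then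
     (returned i ls [] _ (updated σ i _) then
      do-move (updated _ i _) (returning-home (reverse ls))))
    where
    thrice-updated : ∀ k → (σ [ i ↦ home (reverse ls) ]) k ≡
      (σ [ i ↦ returning ls [] ] [ i ↦ returning [] (reverse ls) ] [ i ↦ home (reverse ls) ]) k
    thrice-updated k with k Fin.≟ i
    ... | yes _ = refl
    ... | no k≢i = sym (trans (unchanged _ i _ k k≢i) (unchanged σ i _ k k≢i))

  -- The loop invariant `Φ` fixes the whole store by what lies left and right of the head on the
  -- loop tape. The body moves that head itself. Every round costs one test besides the body, and
  -- one more test ends the loop.
  for-each : ∀ {i e body b} (Φ : List A → List A → Store {A} {g} K) →
             (∀ ls rs → Φ ls rs i ≡ zipper e ls rs) →
             (∀ ls x rs → body ⊢ Φ ls (x ∷ rs) ⇒ Φ (x ∷ ls) rs within b) →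
             ∀ ls rs → while i nonblank body ⊢ Φ ls rs ⇒ Φ (rs ʳ++ ls) [] within (length rs * suc b + 1)
  for-each Φ at body ls []       = stop (cong (nonblank ∘ Tape.head) (at ls []))
  for-each {b = b} Φ at body ls (x ∷ rs) =
    weaken (≤-reflexive (cong suc (sym (+-assoc b (length rs * suc b) 1))))
      (again (cong (nonblank ∘ Tape.head) (at ls (x ∷ rs))) (body ls x rs) (for-each Φ at body (x ∷ ls) rs))

replicate-ʳ++ : ∀ {A : Set} n (x : A) ys → replicate n x ʳ++ ys ≡ replicate n x ++ ys
replicate-ʳ++ zero    x ys = refl
replicate-ʳ++ (suc n) x ys = trans (replicate-ʳ++ n x (x ∷ ys)) (shift n)
  where
  shift : ∀ n → replicate n x ++ x ∷ ys ≡ x ∷ replicate n x ++ ys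
  shift zero    = refl
  shift (suc n) = cong (x ∷_) (shift n)

replicate-+ : ∀ {A : Set} m n (x : A) → replicate (m + n) x ≡ replicate m x ++ replicate n x
replicate-+ zero    n x = refl
replicate-+ (suc m) n x = cong (x ∷_) (replicate-+ m n x)

reverse-replicate : ∀ {A : Set} n (x : A) → reverse (replicate n x) ≡ replicate n x
reverse-replicate n x = trans (replicate-ʳ++ n x []) (List.++-identityʳ _)

-- The printing machine

data Instruction : Set where
  token : Token → Instruction
  zeros letters : Instruction

-- Tape 0 holds the input, the last tape the output; the c loop tapes between
-- them each hold a unary copy of the length of the input.
module Printer {I : Set} (c : ℕ) (spelling : I → List Token) (width : ℕ)
               (spelling≤ : ∀ x → length (spelling x) ≤ width) where

  K = suc (suc c)

  A : Set
  A = I ⊎ Token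

  inp out : Fin K
  inp = Fin.zero
  out = Fin.suc (Fin.fromℕ c)

  loop : Fin c → Fin K
  loop k = Fin.suc (Fin.inject₁ k)

  loop≢out : ∀ k → loop k ≢ out
  loop≢out k e = Fin.fromℕ≢inject₁ (sym (Fin.suc-injective e))

  loop-injective : ∀ {j k} → loop j ≡ loop k → j ≡ k
  loop-injective = Fin.inject₁-injective ∘ Fin.suc-injective

  Prog : Set
  Prog = Program {A} {0} K

  -- The list runs from the latest token back to the first, like the cells left of a head. Hence the
  -- reversing appends `_ʳ++_` below.
  printed : List Token → Tape A 0
  printed o = tape (map (input ∘ inj₂) o) blank []

  print : Token → Prog
  print t = op out out (λ _ _ → input (inj₂ t) , right)

  do-print : ∀ t {σ o} → σ out ≡ printed o → print t ⊢ σ ⇒ σ [ out ↦ printed (t ∷ o) ] within 1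
  do-print t e = do-update (trans (cong (λ z → updateTape z (input (inj₂ t) , right)) e) (right-at-end _))

  tokensOf : Symbol A 0 → List Token
  tokensOf (input (inj₁ x)) = spelling x
  tokensOf _                = []

  dropFirst : List Token → List Token
  dropFirst []       = []
  dropFirst (_ ∷ ts) = ts

  spellOp : List Token → Symbol A 0 → Symbol A 0 × Move
  spellOp []      s = s , stay
  spellOp (t ∷ _) s = input (inj₂ t) , right

  -- The letter is scanned anew for each token, and what remains of its spelling sits in the
  -- function `h` rather than in the control points. Spellings shorter than `l` are padded by idle
  -- steps.
  spell : ℕ → (Symbol A 0 → List Token) → Prog
  spell zero    h = move out stay
  spell (suc l) h = op out inp (spellOp ∘ h) ⨾ spell l (dropFirst ∘ h)

  do-spell : ∀ l h σ o → length (h (Tape.head (σ inp))) ≤ l → σ out ≡ printed o →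
             spell l h ⊢ σ ⇒ σ [ out ↦ printed (h (Tape.head (σ inp)) ʳ++ o) ] within suc l
  do-spell zero h σ o l≤ e with h (Tape.head (σ inp)) | l≤
  ... | [] | z≤n = do-move e (stay-put (printed o))
  do-spell (suc l) h σ o l≤ e =
    reach final ≤-refl
      (do-update first then do-spell l (dropFirst ∘ h) σ₁ o₁ (shorter ts l≤) (updated σ out _))
    where
    ts = h (Tape.head (σ inp))
    write : List Token → List Token
    write []      = o
    write (t ∷ _) = t ∷ o
    o₁ = write ts
    σ₁ = σ [ out ↦ printed o₁ ]
    spelled : ∀ us → updateTape (printed o) (spellOp us blank) ≡ printed (write us)
    spelled []      = stay-put (printed o)
    spelled (_ ∷ _) = right-at-end (map (input ∘ inj₂) o)
    first : updateTape (σ out) (spellOp ts (Tape.head (σ out))) ≡ printed o₁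
    first = trans (cong (λ z → updateTape z (spellOp ts (Tape.head z))) e) (spelled ts)
    shorter : ∀ us → length us ≤ suc l → length (dropFirst us) ≤ l
    shorter []       _         = z≤n
    shorter (_ ∷ us) (s≤s us≤) = us≤
    rest : ∀ us → us ʳ++ o ≡ dropFirst us ʳ++ write us
    rest []       = refl
    rest (_ ∷ us) = refl
    final : ∀ k → (σ [ out ↦ printed (ts ʳ++ o) ]) k ≡ (σ₁ [ out ↦ printed (dropFirst ts ʳ++ o₁) ]) k
    final k with k Fin.≟ out
    ... | yes _    = cong printed (rest ts)
    ... | no k≢out = sym (unchanged σ out _ k k≢out)

  unary : ℕ → List A
  unary n = replicate n (inj₂ mark)

  -- Each level multiplies the number of zeros by n, so that a power is printed without arithmetic
  -- on the machine. The head of its own tape is the counter of a level, and it is rewound because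
  -- the level above starts the loop again.
  nest : ∀ j → j ≤ c → Prog
  nest zero    _   = print bit0
  nest (suc j) j<c = while i nonblank (nest j (<⇒≤ j<c) ⨾ move i right) ⨾ rewind i
    where i = loop (Fin.fromℕ< j<c)

  nestTime : ℕ → ℕ → ℕ
  nestTime n zero    = 1
  nestTime n (suc j) = (n * suc (nestTime n j + 1) + 1) + rewindTime n

  do-nest : ∀ n j j≤c σ o → (∀ k → toℕ k < j → σ (loop k) ≡ home (unary n)) → σ out ≡ printed o →
            nest j j≤c ⊢ σ ⇒ σ [ out ↦ printed (replicate (n ^ j) bit0 ++ o) ] within nestTime n j
  do-nest n zero    _   σ o homes e = do-print bit0 e
  do-nest n (suc j) j<c σ o homes e =
    adjust before-loop after-loop bound
      (for-each Φ Φ-loop body [] (unary n) then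
       rewound i [ blank ] (unary n ʳ++ []) (Φ (unary n ʳ++ []) []) (Φ-loop _ []))
    where
    κ = Fin.fromℕ< j<c
    i = loop κ
    zs : ℕ → List Token
    zs l = replicate (l * n ^ j) bit0 ++ o
    Φ : List A → List A → Store {A} {0} K
    Φ ls rs = σ [ i ↦ zipper [ blank ] ls rs ] [ out ↦ printed (zs (length ls)) ]
    Φ-loop : ∀ ls rs → Φ ls rs i ≡ zipper [ blank ] ls rs
    Φ-loop ls rs = trans (unchanged _ out _ i (loop≢out κ)) (updated σ i _)
    i-home : σ i ≡ home (unary n)
    i-home = homes κ (s≤s (≤-reflexive (Fin.toℕ-fromℕ< j<c)))
    before-loop : ∀ k → σ k ≡ Φ [] (unary n) k
    before-loop k = sym (trans (restored _ out (trans (unchanged σ i _ out (≢-sym (loop≢out κ))) e) k)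
                               (restored σ i i-home k))
    others : ∀ ls rs k → toℕ k < j → Φ ls rs (loop k) ≡ home (unary n)
    others ls rs k k<j = trans (unchanged _ out _ (loop k) (loop≢out k))
      (trans (unchanged σ i _ (loop k) λ eq → <-irrefl (trans (cong toℕ (loop-injective eq)) (Fin.toℕ-fromℕ< j<c)) k<j)
             (homes k (m≤n⇒m≤1+n k<j)))
    grow : ∀ l → replicate (n ^ j) bit0 ++ zs l ≡ zs (suc l)
    grow l = trans (sym (List.++-assoc (replicate (n ^ j) bit0) _ o))
                   (cong (_++ o) (sym (replicate-+ (n ^ j) _ bit0)))
    body : ∀ ls x rs → (nest j (<⇒≤ j<c) ⨾ move i right) ⊢ Φ ls (x ∷ rs) ⇒ Φ (x ∷ ls) rs within (nestTime n j + 1)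
    body ls x rs = reach same ≤-refl
      (do-nest n j (<⇒≤ j<c) (Φ ls (x ∷ rs)) (zs (length ls)) (others ls (x ∷ rs)) (updated _ out _) then
       do-move (trans (unchanged _ out _ i (loop≢out κ)) (Φ-loop ls (x ∷ rs))) (zipper-right seen ls x rs))
      where
      same : ∀ k → Φ (x ∷ ls) rs k ≡
        (Φ ls (x ∷ rs) [ out ↦ printed (replicate (n ^ j) bit0 ++ zs (length ls)) ]
                       [ i ↦ zipper [ blank ] (x ∷ ls) rs ]) k
      same k with k Fin.≟ i
      ... | yes refl = Φ-loop (x ∷ ls) rs
      ... | no k≢i with k Fin.≟ out
      ...   | yes refl = cong printed (sym (grow (length ls)))
      ...   | no k≢out = trans (unchanged σ i _ k k≢i)
                           (sym (trans (unchanged _ out _ k k≢out) (unchanged σ i _ k k≢i)))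
    length-n : length (unary n ʳ++ []) ≡ n
    length-n = trans (cong length (reverse-replicate n (inj₂ mark))) (List.length-replicate n)
    bound : length (unary n) * suc (nestTime n j + 1) + 1 + rewindTime (length (unary n ʳ++ [])) ≤
            nestTime n (suc j)
    bound = ≤-reflexive (cong₂ (λ a b → a * suc (nestTime n j + 1) + 1 + rewindTime b)
                               (List.length-replicate n) length-n)
    after-loop : ∀ k → (σ [ out ↦ printed (replicate (n ^ suc j) bit0 ++ o) ]) k ≡
                       (Φ (unary n ʳ++ []) [] [ i ↦ home (reverse (unary n ʳ++ [])) ]) k
    after-loop k with k Fin.≟ i
    ... | yes refl = trans (unchanged σ out _ i (loop≢out κ))
                           (trans i-home (cong home (sym (List.reverse-involutive (unary n)))))
    ... | no k≢i with k Fin.≟ out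
    ...   | yes refl = cong (λ l → printed (zs l)) (sym length-n)
    ...   | no k≢out = sym (unchanged σ i _ k k≢i)

  -- Stepping left and back records a blank before the input, the passage to the right end one
  -- behind it. This brings the tape into the form `home` that all later loops expect and restore.
  prologue : Prog
  prologue = move inp left ⨾ move inp right ⨾ while inp nonblank (move inp right) ⨾ rewind inp

  prologueTime : ℕ → ℕ
  prologueTime n = 1 + (1 + ((n * 2 + 1) + rewindTime n))

  do-prologue : ∀ w σ → σ inp ≡ loadTape w →
                prologue ⊢ σ ⇒ σ [ inp ↦ home w ] within prologueTime (length w)
  do-prologue w σ e =
    reach final bound
      (do-move {u = before w} e (first w) then
       (do-move (updated σ inp _) (second w) then
        (from ready (for-each Φ (λ ls rs → updated σ inp _) body [] w) then
         rewound inp [] (reverse w) (Φ (reverse w) []) (updated σ inp _))))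
    where
    before : List A → Tape A 0
    before []       = tape [] blank [ blank ]
    before (x ∷ xs) = tape [] blank (input x ∷ map input xs)
    first : ∀ w → updateTape (loadTape w) (Tape.head (loadTape w) , left) ≡ before w
    first []       = refl
    first (x ∷ xs) = refl
    second : ∀ w → updateTape (before w) (Tape.head (before w) , right) ≡ zipper [] [] w
    second []       = refl
    second (x ∷ xs) = cong (tape _ _) (sym (List.++-identityʳ _))
    Φ : List A → List A → Store {A} {0} K
    Φ ls rs = σ [ inp ↦ zipper [] ls rs ]
    ready : ∀ k → (σ [ inp ↦ before w ] [ inp ↦ zipper [] [] w ]) k ≡ Φ [] w k
    ready Fin.zero    = refl
    ready (Fin.suc k) = refl
    body : ∀ ls x rs → move inp right ⊢ Φ ls (x ∷ rs) ⇒ Φ (x ∷ ls) rs within 1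
    body ls x rs = reach same ≤-refl (do-move (updated σ inp _) (zipper-right fresh ls x rs))
      where
      same : ∀ k → Φ (x ∷ ls) rs k ≡ (Φ ls (x ∷ rs) [ inp ↦ zipper [] (x ∷ ls) rs ]) k
      same Fin.zero    = refl
      same (Fin.suc k) = refl
    final : ∀ k → (σ [ inp ↦ home w ]) k ≡ (Φ (reverse w) [] [ inp ↦ home (reverse (reverse w)) ]) k
    final Fin.zero    = cong home (sym (List.reverse-involutive w))
    final (Fin.suc k) = refl
    bound : 1 + (1 + ((length w * 2 + 1) + rewindTime (length (reverse w)))) ≤ prologueTime (length w)
    bound = ≤-reflexive (cong (λ l → 1 + (1 + ((length w * 2 + 1) + rewindTime l))) (List.length-reverse w))

  fill : Fin K → Prog
  fill i = move i left ⨾ move i right ⨾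
           while inp nonblank (op i i (λ _ _ → input (inj₂ mark) , right) ⨾ move inp right) ⨾
           rewind inp ⨾ rewind i

  fillTime : ℕ → ℕ
  fillTime n = 1 + (1 + ((n * 3 + 1) + (rewindTime n + rewindTime n)))

  do-fill : ∀ w i σ → i ≢ inp → σ inp ≡ home w → σ i ≡ loadTape [] →
            fill i ⊢ σ ⇒ σ [ i ↦ home (unary (length w)) ] within fillTime (length w)
  do-fill w i σ i≢inp e₀ e₁ =
    reach final bound
      (do-move e₁ refl then
       (do-move (updated σ i _) refl then
        (from ready (for-each Φ Φ-inp body [] w) then
         (rewound inp [ blank ] (reverse w) (Φ (reverse w) []) (Φ-inp (reverse w) []) then
          rewound i [] (unary (length (reverse w))) _
            (trans (unchanged _ inp _ i i≢inp) (trans (unchanged _ inp _ i i≢inp) (updated σ i _)))))))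
    where
    Φ : List A → List A → Store {A} {0} K
    Φ ls rs = σ [ i ↦ zipper [] (unary (length ls)) [] ] [ inp ↦ zipper [ blank ] ls rs ]
    Φ-inp : ∀ ls rs → Φ ls rs inp ≡ zipper [ blank ] ls rs
    Φ-inp ls rs = updated (σ [ i ↦ zipper [] (unary (length ls)) [] ]) inp _
    ready : ∀ k → (σ [ i ↦ tape [] blank [ blank ] ] [ i ↦ tape [ blank ] blank [] ]) k ≡ Φ [] w k
    ready k with k Fin.≟ inp
    ... | yes refl = trans (unchanged _ i _ inp (≢-sym i≢inp)) (trans (unchanged σ i _ inp (≢-sym i≢inp)) e₀)
    ... | no _ with k Fin.≟ i
    ...   | yes _ = refl
    ...   | no k≢i = unchanged σ i _ k k≢i
    body : ∀ ls x rs → (op i i (λ _ _ → input (inj₂ mark) , right) ⨾ move inp right) ⊢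
           Φ ls (x ∷ rs) ⇒ Φ (x ∷ ls) rs within 2
    body ls x rs = reach same ≤-refl
      (do-update {t = zipper [] (unary (length (x ∷ ls))) []}
         (trans (cong (λ z → updateTape z (input (inj₂ mark) , right)) at-i) (zipper-write (unary (length ls)) _)) then
       do-move (trans (unchanged _ i _ inp (≢-sym i≢inp)) (Φ-inp ls (x ∷ rs))) (zipper-right seen ls x rs))
      where
      at-i : Φ ls (x ∷ rs) i ≡ zipper [] (unary (length ls)) []
      at-i = trans (unchanged _ inp _ i i≢inp) (updated σ i _)
      same : ∀ k → Φ (x ∷ ls) rs k ≡ (Φ ls (x ∷ rs) [ i ↦ zipper [] (unary (length (x ∷ ls))) [] ]
                                                   [ inp ↦ zipper [ blank ] (x ∷ ls) rs ]) k
      same k with k Fin.≟ inp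
      ... | yes _ = refl
      ... | no k≢inp with k Fin.≟ i
      ...   | yes _ = refl
      ...   | no k≢i = sym (trans (unchanged _ inp _ k k≢inp) (unchanged σ i _ k k≢i))
    final : ∀ k → (σ [ i ↦ home (unary (length w)) ]) k ≡
      (Φ (reverse w) [] [ inp ↦ home (reverse (reverse w)) ] [ i ↦ home (reverse (unary (length (reverse w)))) ]) k
    final k with k Fin.≟ i
    ... | yes refl = cong home (sym (trans (reverse-replicate _ _) (cong unary (List.length-reverse w))))
    ... | no k≢i with k Fin.≟ inp
    ...   | yes refl = trans e₀ (cong home (sym (List.reverse-involutive w)))
    ...   | no k≢inp = sym (trans (unchanged _ inp _ k k≢inp) (unchanged σ i _ k k≢i))
    bound : 1 + (1 + ((length w * 3 + 1) + (rewindTime (length (reverse w)) +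
            rewindTime (length (unary (length (reverse w))))))) ≤ fillTime (length w)
    bound = ≤-reflexive (cong₂ (λ a b → 1 + (1 + ((length w * 3 + 1) + (rewindTime a + rewindTime b))))
              (List.length-reverse w) (trans (List.length-replicate _) (List.length-reverse w)))

  fills : ∀ j → j ≤ c → Prog
  fills zero    _   = move out stay
  fills (suc j) j<c = fills j (<⇒≤ j<c) ⨾ fill (loop (Fin.fromℕ< j<c))

  fillsTime : ℕ → ℕ → ℕ
  fillsTime n zero    = 1
  fillsTime n (suc j) = fillsTime n j + fillTime n

  do-fills : ∀ w j j≤c σ → σ inp ≡ home w → (∀ k → σ (loop k) ≡ loadTape []) → ∃[ τ ]
             (fills j j≤c ⊢ σ ⇒ τ within fillsTime (length w) j) × τ inp ≡ home w × τ out ≡ σ out ×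
             (∀ k → toℕ k < j → τ (loop k) ≡ home (unary (length w))) ×
             (∀ k → j ≤ toℕ k → τ (loop k) ≡ loadTape [])
  do-fills w zero    _   σ e₀ e₁ =
    _ , do-move refl (stay-put (σ out)) , e₀ , updated σ out _ ,
    (λ _ ()) , λ k _ → trans (unchanged σ out _ (loop k) (loop≢out k)) (e₁ k)
  do-fills w (suc j) j<c σ e₀ e₁
    with τ , x , inp-home , out-same , done , todo ← do-fills w j (<⇒≤ j<c) σ e₀ e₁
    = _ , x then do-fill w i τ (λ ()) inp-home (todo κ (≤-reflexive (sym κ≡j))) ,
      inp-home ,
      trans (unchanged τ i _ out (≢-sym (loop≢out κ))) out-same ,
      done′ ,
      λ k j<k → trans (unchanged τ i _ (loop k)
                        λ eq → <-irrefl (trans (sym κ≡j) (cong toℕ (sym (loop-injective eq)))) j<k)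
                      (todo k (<⇒≤ j<k))
    where
    κ = Fin.fromℕ< j<c
    i = loop κ
    κ≡j : toℕ κ ≡ j
    κ≡j = Fin.toℕ-fromℕ< j<c
    done′ : ∀ k → toℕ k < suc j → (τ [ i ↦ home (unary (length w)) ]) (loop k) ≡ home (unary (length w))
    done′ k k<1+j with loop k Fin.≟ i
    ... | yes _  = refl
    ... | no k≢i = done k (≤∧≢⇒< (s≤s⁻¹ k<1+j)
                     λ k≡j → k≢i (cong loop (Fin.toℕ-injective (trans k≡j (sym κ≡j)))))

  text : A → List Token
  text x = tokensOf (input x)

  text≤ : ∀ x → length (text x) ≤ width
  text≤ (inj₁ x) = spelling≤ x
  text≤ (inj₂ _) = z≤n

  spellLetters : Prog
  spellLetters = while inp nonblank (spell width tokensOf ⨾ move inp right) ⨾ rewind inp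

  spellLettersTime : ℕ → ℕ
  spellLettersTime n = (n * suc (suc width + 1) + 1) + rewindTime n

  Ready : List A → Store {A} {0} K → Set
  Ready w σ = σ inp ≡ home w × ∀ k → σ (loop k) ≡ home (unary (length w))

  do-spellLetters : ∀ w σ o → Ready w σ → σ out ≡ printed o →
    spellLetters ⊢ σ ⇒ σ [ out ↦ printed (concatMap text w ʳ++ o) ] within spellLettersTime (length w)
  do-spellLetters w σ o (inp-home , _) e =
    reach final bound
      (from ready (for-each Φ Φ-inp body [] w) then
       rewound inp [ blank ] (reverse w) (Φ (reverse w) []) (Φ-inp (reverse w) []))
    where
    written : List A → List Token
    written []       = o
    written (x ∷ ls) = text x ʳ++ written ls
    written-ʳ++ : ∀ rs ls → written (rs ʳ++ ls) ≡ concatMap text rs ʳ++ written ls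
    written-ʳ++ []       ls = refl
    written-ʳ++ (x ∷ rs) ls = trans (written-ʳ++ rs (x ∷ ls)) (sym (List.++-ʳ++ (text x)))
    Φ : List A → List A → Store {A} {0} K
    Φ ls rs = σ [ inp ↦ zipper [ blank ] ls rs ] [ out ↦ printed (written ls) ]
    Φ-inp : ∀ ls rs → Φ ls rs inp ≡ zipper [ blank ] ls rs
    Φ-inp ls rs = refl
    ready : ∀ k → σ k ≡ Φ [] w k
    ready k = sym (trans (restored (σ [ inp ↦ home w ]) out e k) (restored σ inp inp-home k))
    body : ∀ ls x rs → (spell width tokensOf ⨾ move inp right) ⊢ Φ ls (x ∷ rs) ⇒ Φ (x ∷ ls) rs within (suc width + 1)
    body ls x rs = reach same ≤-refl
      (do-spell width tokensOf (Φ ls (x ∷ rs)) (written ls) (text≤ x) (updated (σ [ inp ↦ zipper [ blank ] ls (x ∷ rs) ]) out _) then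
       do-move refl (zipper-right seen ls x rs))
      where
      same : ∀ k → Φ (x ∷ ls) rs k ≡ (Φ ls (x ∷ rs) [ out ↦ printed (text x ʳ++ written ls) ]
                                                   [ inp ↦ zipper [ blank ] (x ∷ ls) rs ]) k
      same Fin.zero = refl
      same (Fin.suc k) with Fin.suc k Fin.≟ out
      ... | yes _    = refl
      ... | no k≢out = sym (unchanged (σ [ inp ↦ zipper [ blank ] ls (x ∷ rs) ]) out _ (Fin.suc k) k≢out)
    final : ∀ k → (σ [ out ↦ printed (concatMap text w ʳ++ o) ]) k ≡
                  (Φ (reverse w) [] [ inp ↦ home (reverse (reverse w)) ]) k
    final Fin.zero = trans inp-home (cong home (sym (List.reverse-involutive w)))
    final (Fin.suc k) with Fin.suc k Fin.≟ out
    ... | yes _ = cong printed (sym (written-ʳ++ w []))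
    ... | no _  = refl
    bound : length w * suc (suc width + 1) + 1 + rewindTime (length (reverse w)) ≤ spellLettersTime (length w)
    bound = ≤-reflexive (cong (λ l → length w * suc (suc width + 1) + 1 + rewindTime l) (List.length-reverse w))

  emit : Instruction → Prog
  emit (token t) = print t
  emit zeros     = nest c ≤-refl
  emit letters   = spellLetters

  emitTime : ℕ → Instruction → ℕ
  emitTime n (token t) = 1
  emitTime n zeros     = nestTime n c
  emitTime n letters   = spellLettersTime n

  emitted : List A → Instruction → List Token
  emitted w (token t) = [ t ]
  emitted w zeros     = replicate (length w ^ c) bit0
  emitted w letters   = concatMap text w

  do-emit : ∀ i w σ o → Ready w σ → σ out ≡ printed o →
            emit i ⊢ σ ⇒ σ [ out ↦ printed (emitted w i ʳ++ o) ] within emitTime (length w) i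
  do-emit (token t) w σ o _ e = do-print t e
  do-emit zeros     w σ o (_ , loops) e =
    reach (λ k → cong (λ us → (σ [ out ↦ printed us ]) k) (replicate-ʳ++ (length w ^ c) bit0 o)) ≤-refl
          (do-nest (length w) c ≤-refl σ o (λ k _ → loops k) e)
  do-emit letters   w σ o ready e = do-spellLetters w σ o ready e

  emits : List Instruction → Prog
  emits []       = move out stay
  emits (i ∷ is) = emit i ⨾ emits is

  emitsTime : ℕ → List Instruction → ℕ
  emitsTime n []       = 1
  emitsTime n (i ∷ is) = emitTime n i + emitsTime n is

  do-emits : ∀ is w σ o → Ready w σ → σ out ≡ printed o →
             emits is ⊢ σ ⇒ σ [ out ↦ printed (concatMap (emitted w) is ʳ++ o) ] within emitsTime (length w) is
  do-emits []       w σ o _ e = do-move e (stay-put (printed o))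
  do-emits (i ∷ is) w σ o (inp-home , loops) e = reach final ≤-refl
    (do-emit i w σ o (inp-home , loops) e then
     do-emits is w (σ [ out ↦ printed (emitted w i ʳ++ o) ]) (emitted w i ʳ++ o)
       (inp-home ,
        λ k → trans (unchanged σ out _ (loop k) (loop≢out k)) (loops k))
       (updated σ out _))
    where
    final : ∀ k → (σ [ out ↦ printed (concatMap (emitted w) (i ∷ is) ʳ++ o) ]) k ≡
      (σ [ out ↦ printed (emitted w i ʳ++ o) ] [ out ↦ printed (concatMap (emitted w) is ʳ++ (emitted w i ʳ++ o)) ]) k
    final k with k Fin.≟ out
    ... | yes _    = cong printed (List.++-ʳ++ (emitted w i))
    ... | no k≢out = sym (unchanged σ out _ k k≢out)

  program : List Instruction → Prog
  program is = prologue ⨾ fills c ≤-refl ⨾ emits is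

  programTime : ℕ → List Instruction → ℕ
  programTime n is = prologueTime n + (fillsTime n c + emitsTime n is)

  do-program : ∀ is w → ∃[ τ ]
    (program is ⊢ initialStore (program is) w ⇒ τ within programTime (length w) is) ×
    τ out ≡ printed (concatMap (emitted w) is ʳ++ [])
  do-program is w
    with τ , x , inp-home , out-same , loops , _ ←
           do-fills w c ≤-refl (initialStore (program is) w [ inp ↦ home w ]) refl (λ _ → refl)
    = _ , do-prologue w _ refl then (x then
          do-emits is w τ [] (inp-home , λ k → loops k (Fin.toℕ<n k)) (trans out-same refl)) ,
      updated τ out _

-- Polynomial bounds on the running time

Polynomial : (ℕ → ℕ) → Set
Polynomial f = ∃[ a ] ∀ n → f n ≤ (2 + n) ^ a

n<2^n : ∀ n → n < 2 ^ n
n<2^n zero    = s≤s z≤n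
n<2^n (suc n) = ≤-trans (+-mono-≤ (m^n>0 2 n) (n<2^n n))
                        (≤-reflexive (cong (2 ^ n +_) (sym (+-identityʳ (2 ^ n)))))

module _ where
  open ≤-Reasoning

  const-polynomial : ∀ k → Polynomial (λ _ → k)
  const-polynomial k = k , λ n → ≤-trans (<⇒≤ (n<2^n k)) (^-monoˡ-≤ k (m≤m+n 2 n))

  id-polynomial : Polynomial id
  id-polynomial = 1 , λ n → ≤-trans (m≤n+m n 2) (≤-reflexive (sym (*-identityʳ (2 + n))))

  *-polynomial : ∀ {f g} → Polynomial f → Polynomial g → Polynomial (λ n → f n * g n)
  *-polynomial (a , f≤) (b , g≤) =
    a + b , λ n → ≤-trans (*-mono-≤ (f≤ n) (g≤ n)) (≤-reflexive (sym (^-distribˡ-+-* (2 + n) a b)))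

  -- The base `2 + n` is at least 2 for every n, so one more factor absorbs the doubling that a sum
  -- causes.
  +-polynomial : ∀ {f g} → Polynomial f → Polynomial g → Polynomial (λ n → f n + g n)
  +-polynomial {f} {g} (a , f≤) (b , g≤) = suc (a + b) , λ n → begin
    f n + g n
      ≤⟨ +-mono-≤ (≤-trans (f≤ n) (^-monoʳ-≤ (2 + n) (m≤m+n a b))) (≤-trans (g≤ n) (^-monoʳ-≤ (2 + n) (m≤n+m b a))) ⟩
    (2 + n) ^ (a + b) + (2 + n) ^ (a + b)
      ≡⟨ cong ((2 + n) ^ (a + b) +_) (sym (+-identityʳ _)) ⟩
    2 * (2 + n) ^ (a + b)
      ≤⟨ *-monoˡ-≤ ((2 + n) ^ (a + b)) (m≤m+n 2 n) ⟩
    (2 + n) ^ suc (a + b) ∎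

  polynomial⇒poly : ∀ {f} → Polynomial f → ∃[ c ] ∀ n → f n ≤ poly c n
  polynomial⇒poly {f} (a , f≤) = c , λ n → ≤-trans (f≤ n) (bound n)
    where
    -- From n = 2 on, `2 + n ≤ n ^ 2` and the exponent `2 * a` suffices. For n = 0 and n = 1 powers
    -- of n do not grow, and the summand `3 ^ a` takes over.
    c = 2 * a + 3 ^ a
    bound : ∀ n → (2 + n) ^ a ≤ poly c n
    bound 0 = begin
      2 ^ a      ≤⟨ ^-monoˡ-≤ a (n≤1+n 2) ⟩
      3 ^ a      ≤⟨ m≤n+m (3 ^ a) (2 * a) ⟩
      c          ≤⟨ m≤n+m c (0 ^ c) ⟩
      poly c 0   ∎
    bound 1 = begin
      3 ^ a      ≤⟨ m≤n+m (3 ^ a) (2 * a) ⟩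
      c          ≤⟨ m≤n+m c (1 ^ c) ⟩
      poly c 1   ∎
    bound n@(suc (suc l)) = begin
      (2 + n) ^ a       ≤⟨ ^-monoˡ-≤ a 2+n≤n² ⟩
      (n ^ 2) ^ a       ≡⟨ ^-*-assoc n 2 a ⟩
      n ^ (2 * a)       ≤⟨ ^-monoʳ-≤ n (m≤m+n (2 * a) (3 ^ a)) ⟩
      n ^ c             ≤⟨ m≤m+n (n ^ c) c ⟩
      poly c n          ∎
      where
      square : ∀ l → (2 + l) * ((2 + l) * 1) ≡ 2 + (2 + l) + (3 * l + l * l)
      square = solve-∀
      2+n≤n² : 2 + n ≤ n ^ 2
      2+n≤n² = ≤-trans (m≤m+n (2 + n) (3 * l + l * l)) (≤-reflexive (sym (square l)))

last-lookup : ∀ {A : Set} {n} (xs : Vec A (suc n)) → Vec.last xs ≡ Vec.lookup xs (Fin.fromℕ n)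
last-lookup (x Vec.∷ Vec.[])       = refl
last-lookup (x Vec.∷ y Vec.∷ xs)   = last-lookup (y Vec.∷ xs)

module _ {I : Set} (c : ℕ) (spelling : I → List Token) (width : ℕ)
         (spelling≤ : ∀ x → length (spelling x) ≤ width) where
  open Printer c spelling width spelling≤

  output : List Instruction → List I → List Token
  output is w = concatMap (emitted (map inj₁ w)) is

  rewindTime-polynomial : Polynomial rewindTime
  rewindTime-polynomial = +-polynomial (const-polynomial 1)
    (+-polynomial (+-polynomial (*-polynomial id-polynomial (const-polynomial 2)) (const-polynomial 1)) (const-polynomial 1))

  nestTime-polynomial : ∀ j → Polynomial (λ n → nestTime n j)
  nestTime-polynomial zero    = const-polynomial 1
  nestTime-polynomial (suc j) = +-polynomial
    (+-polynomial (*-polynomial id-polynomial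
      (+-polynomial (const-polynomial 1) (+-polynomial (nestTime-polynomial j) (const-polynomial 1)))) (const-polynomial 1))
    rewindTime-polynomial

  fillTime-polynomial : Polynomial fillTime
  fillTime-polynomial = +-polynomial (const-polynomial 2)
    (+-polynomial (+-polynomial (*-polynomial id-polynomial (const-polynomial 3)) (const-polynomial 1))
                  (+-polynomial rewindTime-polynomial rewindTime-polynomial))

  fillsTime-polynomial : ∀ j → Polynomial (λ n → fillsTime n j)
  fillsTime-polynomial zero    = const-polynomial 1
  fillsTime-polynomial (suc j) = +-polynomial (fillsTime-polynomial j) fillTime-polynomial

  emitTime-polynomial : ∀ i → Polynomial (λ n → emitTime n i)
  emitTime-polynomial (token t) = const-polynomial 1
  emitTime-polynomial zeros     = nestTime-polynomial c
  emitTime-polynomial letters   = +-polynomial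
    (+-polynomial (*-polynomial id-polynomial (const-polynomial (suc (suc width + 1)))) (const-polynomial 1))
    rewindTime-polynomial

  emitsTime-polynomial : ∀ is → Polynomial (λ n → emitsTime n is)
  emitsTime-polynomial []       = const-polynomial 1
  emitsTime-polynomial (i ∷ is) = +-polynomial (emitTime-polynomial i) (emitsTime-polynomial is)

  programTime-polynomial : ∀ is → Polynomial (λ n → programTime n is)
  programTime-polynomial is = +-polynomial
    (+-polynomial (const-polynomial 2)
      (+-polynomial (+-polynomial (*-polynomial id-polynomial (const-polynomial 2)) (const-polynomial 1)) rewindTime-polynomial))
    (+-polynomial (fillsTime-polynomial c) (emitsTime-polynomial is))

  printed-cells : ∀ ts → cells (printed (reverse ts)) ≡ map input (map inj₂ ts) ++ [ blank ]
  printed-cells ts = cong (_++ [ blank ]) (trans (sym (List.reverse-map (input ∘ inj₂) (reverse ts)))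
    (trans (cong (map (input ∘ inj₂)) (List.reverse-involutive ts)) (List.map-∘ ts)))

  module _ (is : List Instruction) where
    open Run (compile (program is))

    Halts : List A → List Token → ℕ → Set
    Halts w ts t = t ≤ programTime (length w) is × Halted (run t (init w)) ×
                   Shows (Vec.last (Config.tapes (run t (init w)))) (map inj₂ ts)

    halts : ∀ w → ∃[ t ] Halts w (concatMap (emitted w) is) t
    halts w = after-run (do-program is w)
      where
      ts = concatMap (emitted w) is
      result : ∀ {τ : Store {A} {0} K} → τ out ≡ printed (reverse ts) →
               (∃[ t ] t ≤ programTime (length w) is × Halted (run t (init w)) ×
                 (∀ i → Vec.lookup (Config.tapes (run t (init w))) i ≡ τ i)) → ∃[ t ] Halts w ts t
      result τ-out (t , t≤ , halted , final) = t , t≤ , halted ,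
        subst (λ u → Shows u (map inj₂ ts))
              (sym (trans (last-lookup (Config.tapes (run t (init w)))) (trans (final out) τ-out)))
              (0 , 1 , printed-cells ts)
      after-run : (Σ (Store {A} {0} K) λ τ → (program is ⊢ initialStore (program is) w ⇒ τ within programTime (length w) is) ×
                     τ out ≡ printed (reverse ts)) → ∃[ t ] Halts w ts t
      after-run (τ , x , τ-out) = result {τ} τ-out (compile-correct (program is) x)

  output-polyTime : ∀ is → PolyTime (output is)
  output-polyTime is = suc c , compile (program is) , proj₁ bound , timed
    where
    open Run (compile (program is))
    bound = polynomial⇒poly (programTime-polynomial is)
    timed : ∀ w → ∃[ t ] t ≤ poly (proj₁ bound) (length w) × Halted (run t (init (map inj₁ w))) ×
            Shows (Vec.last (Config.tapes (run t (init (map inj₁ w))))) (map inj₂ (output is w))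
    timed w = in-time (halts is (map inj₁ w))
      where
      in-time : ∃ (Halts is (map inj₁ w) (output is w)) →
        ∃[ t ] t ≤ poly (proj₁ bound) (length w) × Halted (run t (init (map inj₁ w))) ×
        Shows (Vec.last (Config.tapes (run t (init (map inj₁ w))))) (map inj₂ (output is w))
      in-time (t , t≤ , rest) = t ,
        ≤-trans t≤ (≤-trans (proj₂ bound (length (map inj₁ w))) (≤-reflexive (cong (poly (proj₁ bound)) (List.length-map inj₁ w)))) ,
        rest

-- Formulas with large time constants

bits-double : ∀ n → bits (suc n + suc n) ≡ false ∷ bits (suc n)
bits-double zero    = refl
bits-double (suc n) =
  trans (cong (increment ∘ increment ∘ bits) (+-suc n (suc n)))
        (cong (increment ∘ increment) (bits-double n))

-- With the least significant bit first, an exponential constant is a row of zeros as long as its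
-- exponent and a final one. Polynomially many steps print it.
bits-power : ∀ n → bits (2 ^ n) ≡ replicate n false ++ [ true ]
bits-power zero    = refl
bits-power (suc n) with 2 ^ n | bits-power n | m^n>0 2 n
... | suc l | e | _ = trans (cong (λ z → bits (suc l + z)) (+-identityʳ (suc l)))
                            (trans (bits-double l) (cong (false ∷_) e))

data Window : Set where
  now next-event later row shift beyond : Window

-- The distance between the images of one cell in consecutive configurations.
span : ℕ → ℕ
span N = 2 ^ suc N

-- Events are to be 16 to 17 apart and images span to span + 1 away. With an error
-- of 2 in every distance, two gaps remain longer than the greatest distance
-- between the images of neighbours.
window : ℕ → Window → Interval
window N now        = bounded closed 0 16 open′ (s≤s z≤n)
window N next-event = bounded closed 16 17 closed ≤-refl
window N later      = unbounded closed 0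
window N row        = bounded closed 0 (span N) open′ (m^n>0 2 (suc N))
window N shift      = bounded closed (span N) (suc (span N)) closed ≤-refl
window N beyond     = unbounded open′ (span N)

-- The constants of the formula depend on the input, the printing program must not. Windows
-- therefore stay symbolic: `instantiate` puts in the constants, while `code` turns a template into
-- instructions once and for all inputs.
data Template (m : ℕ) : Set where
  atom : Fin m → Template m
  _or_ : Template m → Template m → Template m
  neg  : Template m → Template m
  F    : Window → Template m → Template m

infixr 6 _and_

_and_ : ∀ {m} → Template m → Template m → Template m
φ and ψ = neg (neg φ or neg ψ)

instantiate : ∀ {m} → ℕ → Template m → Formula (Fin m)
instantiate N (atom a) = atom a
instantiate N (φ or ψ) = instantiate N φ or instantiate N ψ
instantiate N (neg φ)  = neg (instantiate N φ)
instantiate N (F I φ)  = F (window N I) (instantiate N φ)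

instantiate-pastFree : ∀ {m} N (φ : Template m) → PastFree (instantiate N φ)
instantiate-pastFree N (atom a) = tt
instantiate-pastFree N (φ or ψ) = instantiate-pastFree N φ , instantiate-pastFree N ψ
instantiate-pastFree N (neg φ)  = instantiate-pastFree N φ
instantiate-pastFree N (F I φ)  = instantiate-pastFree N φ

follow : ∀ {m} {I : Set} → (I → Fin m) → Template m → List I → Template m
follow a φ []       = φ
follow a φ (x ∷ xs) = F next-event (atom (a x) and follow a φ xs)

andPrefix : List Token
andPrefix = neg-tok ∷ or-tok ∷ neg-tok ∷ []

-- In Polish notation the chain `follow` falls into one block per letter, since nothing has to be
-- closed behind it. The last `neg-tok` belongs to the second conjunct, which the next block begins.
spell-letter : ∀ {m} {I : Set} → (I → Fin m) → I → List Token
spell-letter {m} a x =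
  F-tok ∷ encodeInterval (window 0 next-event) ++ andPrefix ++ encodeFormula {m} (atom (a x)) ++ [ neg-tok ]

bounded-on-Fin : ∀ {m} (f : Fin m → ℕ) → ∃[ b ] ∀ x → f x ≤ b
bounded-on-Fin {zero}  f = 0 , λ ()
bounded-on-Fin {suc m} f with b , f≤ ← bounded-on-Fin (f ∘ Fin.suc) =
  f Fin.zero + b , λ { Fin.zero → m≤m+n _ b ; (Fin.suc x) → ≤-trans (f≤ x) (m≤n+m b _) }

module Reduction {m : ℕ} {I : Set} (c p : ℕ) (spelling : I → List Token) (width : ℕ)
                 (spelling≤ : ∀ x → length (spelling x) ≤ width) where
  open Printer c spelling width spelling≤ using (emitted)

  tokens : List Token → List Instruction
  tokens = map token

  -- All but the lowest digit of the binary representations of span N and of suc (span N).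
  high-digits : List Instruction
  high-digits = zeros ∷ tokens (replicate p bit0 ++ [ bit1 ])

  windowCode : Window → List Instruction
  windowCode now        = tokens (encodeInterval (window 0 now))
  windowCode next-event = tokens (encodeInterval (window 0 next-event))
  windowCode later      = tokens (encodeInterval (window 0 later))
  windowCode row        = tokens ([-tok ∷ sep ∷ bit0 ∷ []) ++ high-digits ++ tokens [ ⟩-tok ]
  windowCode shift      = tokens ([-tok ∷ bit0 ∷ []) ++ high-digits ++
                          tokens (sep ∷ bit1 ∷ []) ++ high-digits ++ tokens [ ]-tok ]
  windowCode beyond     = tokens (⟨-tok ∷ bit0 ∷ []) ++ high-digits ++ tokens (sep ∷ inf ∷ [ ⟩-tok ])

  code : Template m → List Instruction
  code (atom a) = tokens (encodeFormula {m} (atom a))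
  code (φ or ψ) = token or-tok ∷ code φ ++ code ψ
  code (neg φ)  = token neg-tok ∷ code φ
  code (F J φ)  = token F-tok ∷ windowCode J ++ code φ

  module _ (w : List I) where
    N : ℕ
    N = length w ^ c + p

    emittedAll : List Instruction → List Token
    emittedAll = concatMap (emitted (map inj₁ w))

    emitted-++ : ∀ is js → emittedAll (is ++ js) ≡ emittedAll is ++ emittedAll js
    emitted-++ = List.concatMap-++ (emitted (map inj₁ w))

    emitted-tokens : ∀ ts → emittedAll (tokens ts) ≡ ts
    emitted-tokens []       = refl
    emitted-tokens (t ∷ ts) = cong (t ∷_) (emitted-tokens ts)

    emitted-tokens-++ : ∀ ts is → emittedAll (tokens ts ++ is) ≡ ts ++ emittedAll is
    emitted-tokens-++ ts is = trans (emitted-++ (tokens ts) is) (cong (_++ emittedAll is) (emitted-tokens ts))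

    high : List Token
    high = replicate N bit0 ++ [ bit1 ]

    emitted-high : ∀ is → emittedAll (high-digits ++ is) ≡ high ++ emittedAll is
    emitted-high is = trans (emitted-++ high-digits is) (cong (_++ emittedAll is) digits)
      where
      digits : emittedAll high-digits ≡ high
      digits = begin
        replicate (length (map inj₁ w) ^ c) bit0 ++ emittedAll (tokens (replicate p bit0 ++ [ bit1 ]))
          ≡⟨ cong₂ (λ l ts → replicate (l ^ c) bit0 ++ ts) (List.length-map inj₁ w) (emitted-tokens _) ⟩
        replicate (length w ^ c) bit0 ++ replicate p bit0 ++ [ bit1 ]
          ≡⟨ sym (List.++-assoc (replicate (length w ^ c) bit0) _ _) ⟩
        (replicate (length w ^ c) bit0 ++ replicate p bit0) ++ [ bit1 ]
          ≡⟨ cong (_++ [ bit1 ]) (sym (replicate-+ (length w ^ c) p bit0)) ⟩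
        high ∎
        where open ≡-Reasoning

    high-bits : map bit (replicate N false ++ [ true ]) ≡ high
    high-bits = trans (List.map-++ bit (replicate N false) [ true ])
                      (cong (_++ [ bit1 ]) (List.map-replicate bit N false))

    binary-span : binary (span N) ≡ bit0 ∷ high
    binary-span = trans (cong (map bit) (bits-power (suc N))) (cong (bit0 ∷_) high-bits)

    binary-suc-span : binary (suc (span N)) ≡ bit1 ∷ high
    binary-suc-span = trans (cong (map bit ∘ increment) (bits-power (suc N))) (cong (bit1 ∷_) high-bits)

    emitted-window : ∀ J → emittedAll (windowCode J) ≡ encodeInterval (window N J)
    emitted-window now        = emitted-tokens (encodeInterval (window 0 now))
    emitted-window next-event = emitted-tokens (encodeInterval (window 0 next-event))
    emitted-window later      = emitted-tokens (encodeInterval (window 0 later))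
    emitted-window row        = trans (cong (λ z → [-tok ∷ sep ∷ bit0 ∷ z) (emitted-high (tokens [ ⟩-tok ])))
      (cong (λ z → [-tok ∷ sep ∷ z ++ [ ⟩-tok ]) (sym binary-span))
    emitted-window shift      = trans
      (cong (λ z → [-tok ∷ bit0 ∷ z)
        (trans (emitted-high (tokens (sep ∷ bit1 ∷ []) ++ high-digits ++ tokens [ ]-tok ]))
               (cong (λ z → high ++ sep ∷ bit1 ∷ z) (emitted-high (tokens [ ]-tok ])))))
      (cong₂ (λ x y → [-tok ∷ x ++ sep ∷ y ++ [ ]-tok ]) (sym binary-span) (sym binary-suc-span))
    emitted-window beyond     = trans
      (cong (λ z → ⟨-tok ∷ bit0 ∷ z) (emitted-high (tokens (sep ∷ inf ∷ [ ⟩-tok ]))))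
      (cong (λ z → ⟨-tok ∷ z ++ sep ∷ inf ∷ [ ⟩-tok ]) (sym binary-span))

    emitted-code : ∀ φ → emittedAll (code φ) ≡ encodeFormula (instantiate N φ)
    emitted-code (atom a) = emitted-tokens (encodeFormula {m} (atom a))
    emitted-code (φ or ψ) = cong (or-tok ∷_)
      (trans (emitted-++ (code φ) (code ψ)) (cong₂ _++_ (emitted-code φ) (emitted-code ψ)))
    emitted-code (neg φ)  = cong (neg-tok ∷_) (emitted-code φ)
    emitted-code (F J φ)  = cong (F-tok ∷_)
      (trans (emitted-++ (windowCode J) (code φ)) (cong₂ _++_ (emitted-window J) (emitted-code φ)))

encode-follow : ∀ {m} {I : Set} (a : I → Fin m) N φ w →
  encodeFormula (instantiate N (follow a φ w)) ≡ concatMap (spell-letter a) w ++ encodeFormula (instantiate N φ)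
encode-follow a N φ []       = refl
encode-follow a N φ (x ∷ xs) =
  trans (cong (λ z → prefix (atom-x ++ neg-tok ∷ z)) (encode-follow a N φ xs))
        (trans (cong prefix (sym (List.++-assoc atom-x [ neg-tok ] _)))
               (sym (List.++-assoc (spell-letter a x) (concatMap (spell-letter a) xs) _)))
  where
  atom-x = encodeFormula (atom (a x))
  prefix : List Token → List Token
  prefix z = F-tok ∷ encodeInterval (window N next-event) ++ andPrefix ++ z

module _ {m n : ℕ} (a : Fin n → Fin m) (c p : ℕ) where

  formula : Template m → Fin m → Template m → List (Fin n) → Template m
  formula global first end w = global and (atom first and follow a end w)

  width = proj₁ (bounded-on-Fin (length ∘ spell-letter a))
  width≥ = proj₂ (bounded-on-Fin (length ∘ spell-letter a))

  open Reduction {m} c p (spell-letter a) width width≥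

  instructions : Template m → Fin m → Template m → List Instruction
  instructions global first end =
    tokens (replicate m mark) ++ tokens (sep ∷ andPrefix) ++ code global ++
    tokens (neg-tok ∷ andPrefix ++ encodeFormula (atom first) ++ [ neg-tok ]) ++ letters ∷ code end

  reduction : Template m → Fin m → Template m → List (Fin n) → List Token
  reduction global first end = output c (spell-letter a) width width≥ (instructions global first end)

  reduction-polyTime : ∀ global first end → PolyTime (reduction global first end)
  reduction-polyTime global first end =
    output-polyTime c (spell-letter a) width width≥ (instructions global first end)

  reduction-encodes : ∀ global first end w →
    encode (instantiate (N w) (formula global first end w)) ≡ reduction global first end w
  reduction-encodes global first end w = sym (begin
    emittedAll w (instructions global first end)
      ≡⟨ emitted-tokens-++ w (replicate m mark) _ ⟩
    marks ++ emittedAll w (tokens (sep ∷ andPrefix) ++ code global ++ rest)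
      ≡⟨ cong (marks ++_) (emitted-tokens-++ w (sep ∷ andPrefix) (code global ++ rest)) ⟩
    marks ++ (sep ∷ andPrefix) ++ emittedAll w (code global ++ rest)
      ≡⟨ cong inside (emitted-++ w (code global) rest) ⟩
    marks ++ (sep ∷ andPrefix) ++ emittedAll w (code global) ++ emittedAll w rest
      ≡⟨ cong inside (cong₂ _++_ (emitted-code w global) (emitted-tokens-++ w start _)) ⟩
    marks ++ (sep ∷ andPrefix) ++ G ++ start ++ emittedAll w (letters ∷ code end)
      ≡⟨ cong (λ z → inside (G ++ start ++ z))
           (cong₂ _++_ (List.concatMap-map _ inj₁ w) (emitted-code w end)) ⟩
    marks ++ (sep ∷ andPrefix) ++ G ++ start ++ concatMap (spell-letter a) w ++ E
      ≡⟨ cong (λ z → inside (G ++ start ++ z)) (sym (encode-follow a (N w) end w)) ⟩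
    marks ++ (sep ∷ andPrefix) ++ G ++ start ++ encodeFormula (instantiate (N w) (follow a end w))
      ≡⟨ cong (λ z → inside (G ++ neg-tok ∷ andPrefix ++ z)) (List.++-assoc (encodeFormula (atom first)) [ neg-tok ] _) ⟩
    encode (instantiate (N w) (formula global first end w)) ∎)
    where
    open ≡-Reasoning
    marks = replicate m mark
    start = neg-tok ∷ andPrefix ++ encodeFormula (atom first) ++ [ neg-tok ]
    rest = tokens start ++ letters ∷ code end
    G = encodeFormula (instantiate (N w) global)
    E = encodeFormula (instantiate (N w) end)
    inside : List Token → List Token
    inside z = marks ++ (sep ∷ andPrefix) ++ z

-- Difference constraints for real time stamps

nat : ℕ → ℚ
nat n = ℤ.+ n ℚ./ 1

toℚᵘ-nat : ∀ n → ℚ.toℚᵘ (nat n) ℚᵘ.≃ ℚᵘ.mkℚᵘ (ℤ.+ n) 0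
toℚᵘ-nat n = ℚ.toℚᵘ-fromℚᵘ (ℚᵘ.mkℚᵘ (ℤ.+ n) 0)

nat-+ : ∀ m n → nat (m + n) ≡ nat m ℚ.+ nat n
nat-+ m n = ℚ.toℚᵘ-injective (begin
  ℚ.toℚᵘ (nat (m + n))                                ≈⟨ toℚᵘ-nat (m + n) ⟩
  ℚᵘ.mkℚᵘ (ℤ.+ (m + n)) 0                             ≈⟨ ℚᵘ.*≡* (sum (ℤ.+ m) (ℤ.+ n)) ⟩
  ℚᵘ.mkℚᵘ (ℤ.+ m) 0 ℚᵘ.+ ℚᵘ.mkℚᵘ (ℤ.+ n) 0            ≈⟨ ℚᵘ.≃-sym (ℚᵘ.+-cong (toℚᵘ-nat m) (toℚᵘ-nat n)) ⟩
  ℚ.toℚᵘ (nat m) ℚᵘ.+ ℚ.toℚᵘ (nat n)                  ≈⟨ ℚᵘ.≃-sym (ℚ.toℚᵘ-homo-+ (nat m) (nat n)) ⟩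
  ℚ.toℚᵘ (nat m ℚ.+ nat n)                            ∎)
  where
  open import Relation.Binary.Reasoning.Setoid ℚᵘ.≃-setoid
  sum : ∀ a b → (a ℤ.+ b) ℤ.* ℤ.+ 1 ≡ (a ℤ.* ℤ.+ 1 ℤ.+ b ℤ.* ℤ.+ 1) ℤ.* ℤ.+ 1
  sum = ℤ-Solver.solve-∀

nat-mono-≤ : ∀ {m n} → m ≤ n → nat m ℚ.≤ nat n
nat-mono-≤ {m} {n} m≤n = ℚ.toℚᵘ-cancel-≤
  (ℚᵘ.≤-respˡ-≃ (ℚᵘ.≃-sym (toℚᵘ-nat m)) (ℚᵘ.≤-respʳ-≃ (ℚᵘ.≃-sym (toℚᵘ-nat n))
    (ℚᵘ.*≤* (ℤ.*-monoʳ-≤-nonNeg (ℤ.+ 1) (ℤ.+≤+ m≤n)))))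

nat-cancel-≤ : ∀ {m n} → nat m ℚ.≤ nat n → m ≤ n
nat-cancel-≤ {m} {n} m≤n = ℤ.drop‿+≤+ (subst₂ ℤ._≤_ (ℤ.*-identityʳ (ℤ.+ m)) (ℤ.*-identityʳ (ℤ.+ n))
  (ℚᵘ.drop-*≤* (ℚᵘ.≤-respˡ-≃ (toℚᵘ-nat m) (ℚᵘ.≤-respʳ-≃ (toℚᵘ-nat n) (ℚ.toℚᵘ-mono-≤ m≤n)))))

ℚ-<⇒≱ : ∀ {p q} → p ℚ.< q → ¬ q ℚ.≤ p
ℚ-<⇒≱ p<q q≤p = ℚ.<-irrefl refl (ℚ.<-≤-trans p<q q≤p)

nat-mono-< : ∀ {m n} → m < n → nat m ℚ.< nat n
nat-mono-< m<n = ℚ.≰⇒> λ n≤m → <⇒≱ m<n (nat-cancel-≤ n≤m)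

nat-cancel-< : ∀ {m n} → nat m ℚ.< nat n → m < n
nat-cancel-< m<n = ≰⇒> λ n≤m → ℚ-<⇒≱ m<n (nat-mono-≤ n≤m)

module _ where
  open +-*-Solver

  private
    split : ∀ a c → c ≡ a ℚ.+ (c ℚ.- a)
    split = solve 2 (λ a c → c := a :+ (c :- a)) refl
    join : ∀ a b c → b ℚ.+ (c ℚ.- a) ≡ (b ℚ.- a) ℚ.+ c
    join = solve 3 (λ a b c → b :+ (c :- a) := (b :- a) :+ c) refl
    cancel : ∀ c d → (d ℚ.- c) ℚ.+ c ≡ d
    cancel = solve 2 (λ c d → (d :- c) :+ c := d) refl
    rejoin : ∀ {a b c d} → b ℚ.- a ≡ d ℚ.- c → b ℚ.+ (c ℚ.- a) ≡ d
    rejoin {a} {b} {c} {d} e = trans (join a b c) (trans (cong (ℚ._+ c) e) (cancel c d))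

  -- Inequalities with the same difference of sides are equivalent, so that an
  -- inequality follows from a sum of others once the ring solver has compared differences.
  transfer-≤ : ∀ {a b c d} → a ℚ.≤ b → b ℚ.- a ≡ d ℚ.- c → c ℚ.≤ d
  transfer-≤ {a} {b} {c} {d} a≤b e =
    subst₂ ℚ._≤_ (sym (split a c)) (rejoin {a} {b} e) (ℚ.+-monoˡ-≤ (c ℚ.- a) a≤b)

  transfer-< : ∀ {a b c d} → a ℚ.< b → b ℚ.- a ≡ d ℚ.- c → c ℚ.< d
  transfer-< {a} {b} {c} {d} a<b e =
    subst₂ ℚ._<_ (sym (split a c)) (rejoin {a} {b} e) (ℚ.+-monoˡ-< (c ℚ.- a) a<b)

p≤∣p∣ : ∀ p → p ℚ.≤ ℚ.∣ p ∣
p≤∣p∣ p@(ℚ.mkℚ (ℤ.+ _) _ _)     = ℚ.≤-refl {p}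
p≤∣p∣ (ℚ.mkℚ ℤ.-[1+ _ ] _ _) = ℚ.*≤* ℤ.-≤+

regular-≤ : ∀ x m n → seq x m ℚ.- seq x n ℚ.≤ ε m ℚ.+ ε n
regular-≤ x m n = ℚ.≤-trans (p≤∣p∣ _) (regular x m n)

-- Regularity carries both sequences from index m to `t = twice n`. The margin `2 ε m` of the
-- hypothesis pays for one half of the cost, and the other half is `2 ε t = ε n`, less than the
-- margin `2 ε n` of the supposed opposite. In sum `ε n < 0`.
0≤x-y : ∀ {x y} → y <ℝ x → fromℕ 0 ≤ℝ x -ℝ y
0≤x-y {x} {y} (m , y<x) (n , x-y<0) = ℚ-<⇒≱ impossible (0≤ε n)
  where
  t = twice n
  open +-*-Solver
  combine : ∀ xm ym xt yt em et en →
    (((xm ℚ.+ (em ℚ.+ et)) ℚ.+ (et ℚ.+ em)) ℚ.+ (nat 0)) ℚ.-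
      (((ym ℚ.+ (em ℚ.+ em)) ℚ.+ (xm ℚ.- xt)) ℚ.+ (yt ℚ.- ym) ℚ.+ ((xt ℚ.- yt) ℚ.+ (en ℚ.+ en)))
    ≡ (et ℚ.+ et) ℚ.- (en ℚ.+ en)
  combine = solve 7 (λ xm ym xt yt em et en →
    (((xm :+ (em :+ et)) :+ (et :+ em)) :+ con (nat 0)) :-
      (((ym :+ (em :+ em)) :+ (xm :- xt)) :+ (yt :- ym) :+ ((xt :- yt) :+ (en :+ en)))
    := (et :+ et) :- (en :+ en)) refl
  double : ∀ e → e ℚ.- (e ℚ.+ e) ≡ nat 0 ℚ.- e
  double = solve 1 (λ e → e :- (e :+ e) := con (nat 0) :- e) refl
  impossible : ε n ℚ.< nat 0
  impossible = transfer-<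
    (ℚ.+-mono-< (ℚ.+-mono-<-≤ (ℚ.+-mono-<-≤ y<x (regular-≤ x m t)) (regular-≤ y t m)) x-y<0)
    (trans (combine (seq x m) (seq y m) (seq x t) (seq y t) (ε m) (ε t) (ε n))
           (trans (cong (ℚ._- (ε n ℚ.+ ε n)) (ε-half n)) (double (ε n))))

module Timing {A : Set} (ρ : TimedWord A) where
  open TimedWord ρ

  -- The index 1 is `twice 0`: the initial term of `time j -ℝ time i` is `approx j - approx i` by
  -- definition.
  approx : Position → ℚ
  approx i = seq (time i) 1

  -- The time stamps satisfy difference constraints up to an error of 2, the
  -- precision of the initial term of a difference of regular sequences.
  infix 4 _⊕_≼_⊕_

  record _⊕_≼_⊕_ (i : Position) (a : ℕ) (j : Position) (b : ℕ) : Set where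
    constructor constraint
    field holds : approx i ℚ.+ nat a ℚ.≤ approx j ℚ.+ nat b
  open _⊕_≼_⊕_

  -- Rational inequalities are decidable, so a constraint, unlike a comparison of reals, can be
  -- brought out of a double negation.
  ≼-stable : ∀ {i a j b} → ¬ ¬ (i ⊕ a ≼ j ⊕ b) → i ⊕ a ≼ j ⊕ b
  ≼-stable {i} {a} {j} {b} ¬¬≼ = constraint
    (decidable-stable ((approx i ℚ.+ nat a) ℚ.≤? (approx j ℚ.+ nat b)) λ ¬≤ → ¬¬≼ (¬≤ ∘ holds))

  ≼-refl : ∀ {i a b} → a ≤ b → i ⊕ a ≼ i ⊕ b
  ≼-refl {i} a≤b = constraint (ℚ.+-monoʳ-≤ (approx i) (nat-mono-≤ a≤b))

  ≼-cancel : ∀ {i a b} → i ⊕ a ≼ i ⊕ b → a ≤ b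
  ≼-cancel {i} {a} {b} (constraint i≼i) = nat-cancel-≤ (transfer-≤ i≼i (same (approx i) (nat a) (nat b)))
    where
    open +-*-Solver
    same : ∀ p a b → (p ℚ.+ b) ℚ.- (p ℚ.+ a) ≡ b ℚ.- a
    same = solve 3 (λ p a b → (p :+ b) :- (p :+ a) := b :- a) refl

  ≼-trans : ∀ {i a j b c k d} → i ⊕ a ≼ j ⊕ b → j ⊕ c ≼ k ⊕ d → i ⊕ (a + c) ≼ k ⊕ (b + d)
  ≼-trans {i} {a} {j} {b} {c} {k} {d} (constraint i≼j) (constraint j≼k) = constraint
    (subst₂ (λ x y → approx i ℚ.+ x ℚ.≤ approx k ℚ.+ y) (sym (nat-+ a c)) (sym (nat-+ b d))
      (transfer-≤ (ℚ.+-mono-≤ i≼j j≼k) (eq (approx i) (approx j) (approx k) (nat a) (nat b) (nat c) (nat d))))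
    where
    open +-*-Solver
    eq : ∀ i j k a b c d → ((j ℚ.+ b) ℚ.+ (k ℚ.+ d)) ℚ.- ((i ℚ.+ a) ℚ.+ (j ℚ.+ c)) ≡
                           (k ℚ.+ (b ℚ.+ d)) ℚ.- (i ℚ.+ (a ℚ.+ c))
    eq = solve 7 (λ i j k a b c d → ((j :+ b) :+ (k :+ d)) :- ((i :+ a) :+ (j :+ c)) :=
                                    (k :+ (b :+ d)) :- (i :+ (a :+ c))) refl

  private
    2ℚ : ℚ
    2ℚ = ε 0 ℚ.+ ε 0

    lower : ∀ p q r s → (p ℚ.+ s) ℚ.- (q ℚ.+ r) ≡ (p ℚ.- q ℚ.+ s) ℚ.- r
    lower = solve 4 (λ p q r s → (p :+ s) :- (q :+ r) := (p :- q :+ s) :- r) refl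
      where open +-*-Solver

    upper : ∀ p q r s → (r ℚ.+ s) ℚ.- (p ℚ.- q) ≡ (q ℚ.+ (r ℚ.+ s)) ℚ.- (p ℚ.+ nat 0)
    upper = solve 4 (λ p q r s → (r :+ s) :- (p :- q) := (q :+ (r :+ s)) :- (p :+ con (nat 0))) refl
      where open +-*-Solver

  above-≼ : ∀ i j l → fromℕ l ≤ℝ time j -ℝ time i → i ⊕ l ≼ j ⊕ 2
  above-≼ i j l l≤ = constraint (transfer-≤ (ℚ.≮⇒≥ λ < → l≤ (0 , <))
    (sym (lower (approx j) (approx i) (nat l) 2ℚ)))

  below-≼ : ∀ i j u → time j -ℝ time i ≤ℝ fromℕ u → j ⊕ 0 ≼ i ⊕ (u + 2)
  below-≼ i j u ≤u = constraint (subst (λ z → approx j ℚ.+ nat 0 ℚ.≤ approx i ℚ.+ z) (sym (nat-+ u 2))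
    (transfer-≤ (ℚ.≮⇒≥ λ < → ≤u (0 , <)) (upper (approx j) (approx i) (nat u) 2ℚ)))

  -- A rational distance that exceeds l by more than the error 2 proves the real inequality by its
  -- initial term.
  ≼-above : ∀ i j l → ¬ (j ⊕ 0 ≼ i ⊕ (l + 2)) → fromℕ l <ℝ time j -ℝ time i
  ≼-above i j l ¬≼ = 0 , ℚ.≰⇒> λ ≤l → ¬≼ (constraint (subst (λ z → approx j ℚ.+ nat 0 ℚ.≤ approx i ℚ.+ z) (sym (nat-+ l 2))
    (transfer-≤ ≤l (upper (approx j) (approx i) (nat l) 2ℚ))))

  ≼-below : ∀ i j u → ¬ (i ⊕ u ≼ j ⊕ 2) → time j -ℝ time i <ℝ fromℕ u
  ≼-below i j u ¬≼ = 0 , ℚ.≰⇒> λ u≤ → ¬≼ (constraint (transfer-≤ u≤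
    (sym (lower (approx j) (approx i) (nat u) 2ℚ))))

  module _ (N : ℕ) {i j : Position} where

    within : Window → Set
    within J = time j -ℝ time i ∈ᴵ window N J

    now-apart : i Fin.< j → ¬ within now → i ⊕ 16 ≼ j ⊕ 2
    now-apart i<j ¬now = ≼-stable λ ¬≼ → ¬now (0≤x-y {time j} {time i} (strict i<j) , ≼-below i j 16 ¬≼)

    row-apart : i Fin.< j → ¬ within row → i ⊕ span N ≼ j ⊕ 2
    row-apart i<j ¬row = ≼-stable λ ¬≼ → ¬row (0≤x-y {time j} {time i} (strict i<j) , ≼-below i j (span N) ¬≼)

    next-event-≼ : within next-event → i ⊕ 16 ≼ j ⊕ 2 × j ⊕ 0 ≼ i ⊕ 19
    next-event-≼ (16≤ , ≤17) = above-≼ i j 16 16≤ , below-≼ i j 17 ≤17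

    shift-≼ : within shift → i ⊕ span N ≼ j ⊕ 2 × j ⊕ 0 ≼ i ⊕ (suc (span N) + 2)
    shift-≼ (l , u) = above-≼ i j (span N) l , below-≼ i j (suc (span N)) u

    later-within : i Fin.< j → within later
    later-within i<j = 0≤x-y {time j} {time i} (strict i<j)

    beyond-within : ¬ (j ⊕ 0 ≼ i ⊕ (span N + 2)) → within beyond
    beyond-within = ≼-above i j (span N)

module _ (x : ℝ) {k : ℕ} (x≡k : ∀ n → seq x n ≡ nat k) where

  p≤p+2ε : ∀ p n → p ℚ.≤ p ℚ.+ (ε n ℚ.+ ε n)
  p≤p+2ε p n = subst (ℚ._≤ p ℚ.+ (ε n ℚ.+ ε n)) (ℚ.+-identityʳ p)
    (ℚ.+-monoʳ-≤ p (ℚ.+-mono-≤ (0≤ε n) (0≤ε n)))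

  constant-< : ∀ {u} → x <ℝ fromℕ u → k < u
  constant-< {u} (n , x<u) rewrite x≡k n = nat-cancel-< (ℚ.≤-<-trans (p≤p+2ε (nat k) n) x<u)

  <-constant : ∀ {l} → fromℕ l <ℝ x → l < k
  <-constant {l} (n , l<x) rewrite x≡k n = nat-cancel-< (ℚ.≤-<-trans (p≤p+2ε (nat l) n) l<x)

  constant-≤ : ∀ {u} → k ≤ u → x ≤ℝ fromℕ u
  constant-≤ k≤u u<x = <⇒≱ (<-constant u<x) k≤u

  ≤-constant : ∀ {l} → l ≤ k → fromℕ l ≤ℝ x
  ≤-constant l≤k x<l = <⇒≱ (constant-< x<l) l≤k

  constant-≤⁻¹ : ∀ {u} → x ≤ℝ fromℕ u → k ≤ u + 2
  constant-≤⁻¹ {u} x≤u = ≮⇒≥ λ u+2<k → x≤u (0 , subst₂ ℚ._<_ (nat-+ u 2) (sym (x≡k 0)) (nat-mono-< u+2<k))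

fromℕ-difference : ∀ {a b} k → b ≡ a + k → ∀ n → seq (fromℕ b -ℝ fromℕ a) n ≡ nat k
fromℕ-difference {a} k refl _ = trans (cong (ℚ._- nat a) (nat-+ a k)) (cancel (nat a) (nat k))
  where
  open +-*-Solver
  cancel : ∀ a k → (a ℚ.+ k) ℚ.- a ≡ k
  cancel = solve 2 (λ a k → (a :+ k) :- a := k) refl

fromℕ-mono : ∀ {a b} → a + 2 < b → fromℕ a <ℝ fromℕ b
fromℕ-mono {a} {b} a+2<b = 0 , subst (ℚ._< nat b) (nat-+ a 2) (nat-mono-< a+2<b)

-- Space-time diagrams of one-tape machines

moved : Move → ℕ → ℕ
moved left  p = pred p
moved stay  p = p
moved right p = suc p

cellIn : ∀ {A g} → List (Symbol A g) → ℕ → Symbol A g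
cellIn []       _       = blank
cellIn (s ∷ _)  zero    = s
cellIn (_ ∷ ss) (suc n) = cellIn ss n

_at_≔_ : ∀ {X : Set} → (ℕ → X) → ℕ → X → ℕ → X
(f at p ≔ s) r = if r ≡ᵇ p then s else f r

≡ᵇ-refl : ∀ n → (n ≡ᵇ n) ≡ true
≡ᵇ-refl zero    = refl
≡ᵇ-refl (suc n) = ≡ᵇ-refl n

≡ᵇ-left : ∀ k j → (k ≡ᵇ suc (k + j)) ≡ false
≡ᵇ-left zero    j = refl
≡ᵇ-left (suc k) j = ≡ᵇ-left k j

≡ᵇ-right : ∀ p j → (suc (p + j) ≡ᵇ p) ≡ false
≡ᵇ-right zero    j = refl
≡ᵇ-right (suc p) j = ≡ᵇ-right p j

-- Cells get absolute numbers from a left margin, with the head at p. In `left-cells`, j counts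
-- leftwards from the head; the form `suc (k + j) ≡ p` avoids subtraction.
record Represents {A g} (t : Tape A g) (p : ℕ) (f : ℕ → Symbol A g) : Set where
  constructor represents
  field
    scanned-cell : f p ≡ Tape.head t
    right-cells  : ∀ j → f (suc (p + j)) ≡ cellIn (Tape.after t) j
    left-cells   : ∀ k j → suc (k + j) ≡ p → f k ≡ cellIn (Tape.before t) j

-- The starting cell stays among the recorded ones, since these only grow. A bound on their number
-- thus bounds the distance of the head from the origin.
record Visits {A g} (t : Tape A g) (p origin : ℕ) : Set where
  constructor visits
  field
    from-left  : p ≤ origin + length (Tape.before t)
    from-right : origin ≤ p + length (Tape.after t)

module _ {A : Set} {g : ℕ} where

  represents-update : ∀ {t p f} s d → (d ≡ left → 0 < p) → Represents {A} {g} t p f →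
                      Represents (updateTape t (s , d)) (moved d p) (f at p ≔ s)
  represents-update {t} {suc p} {f} s left _ (represents _ rc lc) = go t rc lc
    where

    other : ∀ {k l} → (k ≡ᵇ suc p) ≡ false → f k ≡ l → (f at suc p ≔ s) k ≡ l
    other e e′ rewrite e = e′
    here : (f at suc p ≔ s) (suc p) ≡ s
    here rewrite ≡ᵇ-refl p = refl
    p-false : (p ≡ᵇ suc p) ≡ false
    p-false = trans (cong (p ≡ᵇ_) (cong suc (sym (+-identityʳ p)))) (≡ᵇ-left p 0)
    rights : ∀ {R R′ : ℕ → Symbol A g} → (∀ j → f (suc (suc p + j)) ≡ R j) → s ≡ R′ 0 → (∀ j → R j ≡ R′ (suc j)) →
             ∀ j → (f at suc p ≔ s) (suc (p + j)) ≡ R′ j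
    rights rc hd tl zero    = trans (trans (cong (f at suc p ≔ s) (cong suc (+-identityʳ p))) here) hd
    rights rc hd tl (suc j) =
      trans (cong (f at suc p ≔ s) (cong suc (+-suc p j))) (trans (other (≡ᵇ-right p j) (rc j)) (tl j))
    k-false : ∀ k j → suc (k + j) ≡ p → (k ≡ᵇ suc p) ≡ false
    k-false k j refl = trans (cong (λ z → k ≡ᵇ suc z) (sym (+-suc k j))) (≡ᵇ-left k (suc j))
    lefts : ∀ {L L′ : ℕ → Symbol A g} → (∀ k j → suc (k + j) ≡ suc p → f k ≡ L j) → (∀ j → L (suc j) ≡ L′ j) →
            ∀ k j → suc (k + j) ≡ p → (f at suc p ≔ s) k ≡ L′ j
    lefts lc tl k j e = other (k-false k j e) (trans (lc k (suc j) (cong suc (trans (+-suc k j) e))) (tl j))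
    go : ∀ t → (∀ j → f (suc (suc p + j)) ≡ cellIn (Tape.after t) j) →
         (∀ k j → suc (k + j) ≡ suc p → f k ≡ cellIn (Tape.before t) j) →
         Represents (updateTape t (s , left)) p (f at suc p ≔ s)
    go (tape [] h rs) rc lc = represents (other p-false (lc p 0 (cong suc (+-identityʳ p))))
      (rights rc refl λ _ → refl) (lefts lc λ _ → refl)
    go (tape (l ∷ ls) h rs) rc lc = represents (other p-false (lc p 0 (cong suc (+-identityʳ p))))
      (rights rc refl λ _ → refl) (lefts lc λ _ → refl)
  represents-update {p = zero} s left pos _ with () ← pos refl
  represents-update {t} {p} {f} s right _ (represents _ rc lc) = go t rc lc
    where
    other : ∀ {k l} → (k ≡ᵇ p) ≡ false → f k ≡ l → (f at p ≔ s) k ≡ l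
    other e e′ rewrite e = e′
    here : (f at p ≔ s) p ≡ s
    here rewrite ≡ᵇ-refl p = refl
    scanned′ : ∀ {R : ℕ → Symbol A g} → (∀ j → f (suc (p + j)) ≡ R j) → (f at p ≔ s) (suc p) ≡ R 0
    scanned′ rc = trans (cong (f at p ≔ s) (cong suc (sym (+-identityʳ p)))) (other (≡ᵇ-right p 0) (rc 0))
    rights : ∀ {R R′ : ℕ → Symbol A g} → (∀ j → f (suc (p + j)) ≡ R j) → (∀ j → R (suc j) ≡ R′ j) →
             ∀ j → (f at p ≔ s) (suc (suc p + j)) ≡ R′ j
    rights rc tl j = trans (cong (f at p ≔ s) (cong suc (sym (+-suc p j))))
      (other (≡ᵇ-right p (suc j)) (trans (rc (suc j)) (tl j)))
    lefts : ∀ {L L′ : ℕ → Symbol A g} → (∀ k j → suc (k + j) ≡ p → f k ≡ L j) → s ≡ L′ 0 → (∀ j → L j ≡ L′ (suc j)) →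
            ∀ k j → suc (k + j) ≡ suc p → (f at p ≔ s) k ≡ L′ j
    lefts lc hd tl k zero    e =
      trans (trans (cong (f at p ≔ s) (trans (sym (+-identityʳ k)) (suc-injective e))) here) hd
    lefts lc hd tl k (suc j) e with refl ← trans (sym (+-suc k j)) (suc-injective e) =
      trans (other (≡ᵇ-left k j) (lc k j refl)) (tl j)
    go : ∀ t → (∀ j → f (suc (p + j)) ≡ cellIn (Tape.after t) j) →
         (∀ k j → suc (k + j) ≡ p → f k ≡ cellIn (Tape.before t) j) →
         Represents (updateTape t (s , right)) (suc p) (f at p ≔ s)
    go (tape [] h [])             rc lc = represents (scanned′ rc) (rights rc λ _ → refl) (lefts lc refl λ _ → refl)
    go (tape [] h (r ∷ rs))       rc lc = represents (scanned′ rc) (rights rc λ _ → refl) (lefts lc refl λ _ → refl)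
    go (tape (l ∷ ls) h [])       rc lc = represents (scanned′ rc) (rights rc λ _ → refl) (lefts lc refl λ _ → refl)
    go (tape (l ∷ ls) h (r ∷ rs)) rc lc = represents (scanned′ rc) (rights rc λ _ → refl) (lefts lc refl λ _ → refl)
  represents-update {t} {p} {f} s stay _ (represents _ rc lc) = go t rc lc
    where
    other : ∀ {k l} → (k ≡ᵇ p) ≡ false → f k ≡ l → (f at p ≔ s) k ≡ l
    other e e′ rewrite e = e′
    here : (f at p ≔ s) p ≡ s
    here rewrite ≡ᵇ-refl p = refl
    rights : ∀ {R : ℕ → Symbol A g} → (∀ j → f (suc (p + j)) ≡ R j) → ∀ j → (f at p ≔ s) (suc (p + j)) ≡ R j
    rights rc j = other (≡ᵇ-right p j) (rc j)
    lefts : ∀ {L : ℕ → Symbol A g} → (∀ k j → suc (k + j) ≡ p → f k ≡ L j) →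
            ∀ k j → suc (k + j) ≡ p → (f at p ≔ s) k ≡ L j
    lefts lc k j refl = other (≡ᵇ-left k j) (lc k j refl)
    go : ∀ t → (∀ j → f (suc (p + j)) ≡ cellIn (Tape.after t) j) →
         (∀ k j → suc (k + j) ≡ p → f k ≡ cellIn (Tape.before t) j) →
         Represents (updateTape t (s , stay)) p (f at p ≔ s)
    go (tape [] h [])             rc lc = represents here (rights rc) (lefts lc)
    go (tape [] h (r ∷ rs))       rc lc = represents here (rights rc) (lefts lc)
    go (tape (l ∷ ls) h [])       rc lc = represents here (rights rc) (lefts lc)
    go (tape (l ∷ ls) h (r ∷ rs)) rc lc = represents here (rights rc) (lefts lc)

  visits-update : ∀ {t p o} s d → (d ≡ left → 0 < p) → Visits {A} {g} t p o → Visits (updateTape t (s , d)) (moved d p) o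
  visits-update {tape [] h rs} {suc p} {o} s left _ (visits a b) =
    visits (≤-trans (n≤1+n p) a) (≤-trans b (≤-reflexive (sym (+-suc p (length rs)))))
  visits-update {tape (l ∷ ls) h rs} {suc p} {o} s left _ (visits a b) =
    visits (s≤s⁻¹ (≤-trans a (≤-reflexive (+-suc o (length ls))))) (≤-trans b (≤-reflexive (sym (+-suc p (length rs)))))
  visits-update {p = zero} s left pos _ with () ← pos refl
  visits-update {tape [] h []} {p} {o} s right _ (visits a b) =
    visits (≤-trans (s≤s a) (≤-reflexive (sym (+-suc o 0)))) (m≤n⇒m≤1+n b)
  visits-update {tape (l ∷ ls) h []} {p} {o} s right _ (visits a b) =
    visits (≤-trans (s≤s a) (≤-reflexive (sym (+-suc o _)))) (m≤n⇒m≤1+n b)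
  visits-update {tape [] h (r ∷ rs)} {p} {o} s right _ (visits a b) =
    visits (≤-trans (s≤s a) (≤-reflexive (sym (+-suc o 0)))) (≤-trans b (≤-reflexive (+-suc p (length rs))))
  visits-update {tape (l ∷ ls) h (r ∷ rs)} {p} {o} s right _ (visits a b) =
    visits (≤-trans (s≤s a) (≤-reflexive (sym (+-suc o _)))) (≤-trans b (≤-reflexive (+-suc p (length rs))))
  visits-update {tape [] h []} s stay _ (visits a b) = visits a b
  visits-update {tape [] h (r ∷ rs)} s stay _ (visits a b) = visits a b
  visits-update {tape (l ∷ ls) h []} s stay _ (visits a b) = visits a b
  visits-update {tape (l ∷ ls) h (r ∷ rs)} s stay _ (visits a b) = visits a b

data Head (n : ℕ) : Set where
  none : Head n
  -- A preliminary phase left of the input, so that no input letter is special.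
  pre  : Head n
  in-state : Fin n → Head n

module Simulation {m : ℕ} (M : TM 1 (Fin m)) where
  open TM M public
  open Run M public

  Sym : Set
  Sym = Symbol (Fin m) works

  Phase : Set
  Phase = Head states

  Cell : Set
  Cell = Sym × Phase

  -- A halted machine stands still, as `run` does, and so the diagram has infinitely many rows.
  respond : Sym → Fin states → Maybe (Fin states × Vec (Sym × Move) 1) → Sym × Phase × Move
  respond s q nothing                           = s , in-state q , stay
  respond s q (just (q′ , (s′ , d) Vec.∷ Vec.[])) = s′ , in-state q′ , d

  outcome : Cell → Sym × Phase × Move
  outcome (s , none)       = s , none , stay
  outcome (s , pre)        = s , in-state start , right
  outcome (s , in-state q) = respond s q (δ q (s Vec.∷ Vec.[]))

  arriving : Move → Phase × Move → Phase
  arriving left  (h , left)  = h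
  arriving stay  (h , stay)  = h
  arriving right (h , right) = h
  arriving _     _           = none

  infixr 5 _∣_
  _∣_ : Phase → Phase → Phase
  none       ∣ h = h
  pre        ∣ _ = pre
  in-state q ∣ _ = in-state q

  ∣-none : ∀ h → h ∣ none ≡ h
  ∣-none none         = refl
  ∣-none pre          = refl
  ∣-none (in-state q) = refl

  -- The new symbol depends on the middle cell alone. A neighbour matters only through a head that
  -- arrives from it, so a neighbour without head may be replaced by any other.
  rule : Cell → Cell → Cell → Cell
  rule a b c = proj₁ (outcome b) ,
    (arriving right (proj₂ (outcome a)) ∣ arriving stay (proj₂ (outcome b)) ∣ arriving left (proj₂ (outcome c)))

  record Snapshot : Set where
    constructor snapshot
    field
      contents : ℕ → Sym
      position : ℕ
      phase    : Phase
  open Snapshot public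

  view : Snapshot → ℕ → Cell
  view (snapshot f p h) r = f r , (if r ≡ᵇ p then h else none)

  advance : Snapshot → Snapshot
  advance (snapshot f p h) = let s , h′ , d = outcome (f p , h) in snapshot (f at p ≔ s) (moved d p) h′

  outcome-view : ∀ f p h r → outcome (view (snapshot f p h) r) ≡
                 (if r ≡ᵇ p then outcome (f p , h) else (f r , none , stay))
  outcome-view f p h r with r ≡ᵇ p in eq
  ... | false = refl
  ... | true with refl ← ≡ᵇ⇒≡ r p (subst T (sym eq) tt) = refl

  arriving-if : ∀ d b (o : Sym × Phase × Move) s →
                arriving d (proj₂ (if b then o else (s , none , stay))) ≡ (if b then arriving d (proj₂ o) else none)
  arriving-if d     true  o s = refl
  arriving-if left  false o s = refl
  arriving-if stay  false o s = refl
  arriving-if right false o s = refl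

  proj₁-if : ∀ b (o : Sym × Phase × Move) s → proj₁ (if b then o else (s , none , stay)) ≡ (if b then proj₁ o else s)
  proj₁-if true  o s = refl
  proj₁-if false o s = refl

  if-none : ∀ b → (if b then none else none) ≡ none {states}
  if-none true  = refl
  if-none false = refl

  -- The phase is found where the head has moved to: at position suc r if it
  -- comes from r by a right move, from suc r by staying, from 2 + r by a left move.
  phase-moves : ∀ d p h r → (d ≡ left → 0 < p) →
    ((if r ≡ᵇ p then arriving right (h , d) else none) ∣
     (if suc r ≡ᵇ p then arriving stay (h , d) else none) ∣
     (if 2 + r ≡ᵇ p then arriving left (h , d) else none)) ≡ (if suc r ≡ᵇ moved d p then h else none)
  phase-moves left  (suc p) h r _ rewrite if-none (r ≡ᵇ suc p) | if-none (r ≡ᵇ p) = refl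
  phase-moves left  zero    h r pos with () ← pos refl
  phase-moves stay  p h r _ rewrite if-none (r ≡ᵇ p) | if-none (2 + r ≡ᵇ p) = ∣-none _
  phase-moves right p h r _ rewrite if-none (suc r ≡ᵇ p) | if-none (2 + r ≡ᵇ p) = ∣-none _

  phase-moves-0 : ∀ d p h → 0 < p →
    ((if 0 ≡ᵇ p then arriving stay (h , d) else none) ∣
     (if 1 ≡ᵇ p then arriving left (h , d) else none)) ≡ (if 0 ≡ᵇ moved d p then h else none)
  phase-moves-0 left  (suc p) h _ = refl
  phase-moves-0 stay  (suc p) h _ rewrite if-none (0 ≡ᵇ p) = refl
  phase-moves-0 right (suc p) h _ rewrite if-none (0 ≡ᵇ p) = refl

  advance-rule : ∀ S r → 0 < position S →
                 view (advance S) (suc r) ≡ rule (view S r) (view S (suc r)) (view S (2 + r))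
  advance-rule (snapshot f p h) r 0<p
    rewrite outcome-view f p h r | outcome-view f p h (suc r) | outcome-view f p h (2 + r) =
    sym (cong₂ _,_ (proj₁-if (suc r ≡ᵇ p) o _) (trans
      (cong₂ _∣_ (arriving-if right (r ≡ᵇ p) o _)
        (cong₂ _∣_ (arriving-if stay (suc r ≡ᵇ p) o _) (arriving-if left (2 + r ≡ᵇ p) o _)))
      (phase-moves (proj₂ (proj₂ o)) p (proj₁ (proj₂ o)) r λ _ → 0<p)))
    where o = outcome (f p , h)

  -- On the helix, the left neighbour of cell 0 is the last cell of another row. Any cell without
  -- head can stand for it.
  advance-rule-0 : ∀ S a → 0 < position S → proj₂ a ≡ none →
                   view (advance S) 0 ≡ rule a (view S 0) (view S 1)
  advance-rule-0 (snapshot f p h) (_ , .none) 0<p refl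
    rewrite outcome-view f p h 0 | outcome-view f p h 1 =
    sym (cong₂ _,_ (proj₁-if (0 ≡ᵇ p) o _) (trans
      (cong₂ _∣_ (arriving-if stay (0 ≡ᵇ p) o _) (arriving-if left (1 ≡ᵇ p) o _))
      (phase-moves-0 (proj₂ (proj₂ o)) p (proj₁ (proj₂ o)) 0<p)))
    where o = outcome (f p , h)

  rule-headless : ∀ a b c c′ → proj₂ c ≡ none → proj₂ c′ ≡ none → rule a b c ≡ rule a b c′
  rule-headless a b (_ , .none) (_ , .none) refl refl = refl

  continue : Config → Maybe Config → Config
  continue c nothing   = c
  continue c (just c′) = c′

  -- `run` unfolds at its first step, whereas the diagram grows at its last row.
  run-suc : ∀ t c → run (suc t) c ≡ continue (run t c) (step (run t c))
  run-suc zero    c with step c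
  ... | nothing = refl
  ... | just _  = refl
  run-suc (suc t) c with step c in eq
  ... | just c′ = run-suc t c′
  ... | nothing rewrite eq = refl

  halted-stays : ∀ t n c → Halted (run t c) → run (t + n) c ≡ run t c
  halted-stays zero    zero    c h = refl
  halted-stays zero    (suc n) c h with step c | h
  ... | nothing | _ = refl
  halted-stays (suc t) n c h with step c
  ... | nothing = refl
  ... | just c′ = halted-stays t n c′ h

  halted-unique : ∀ s t c → Halted (run s c) → Halted (run t c) → run s c ≡ run t c
  halted-unique s t c hs ht = trans (sym (halted-stays s t c hs))
    (trans (cong (λ n → run n c) (+-comm s t)) (halted-stays t s c ht))

  record Tracks (origin : ℕ) (c : Config) (S : Snapshot) : Set where
    constructor tracks
    field
      the-tape  : Tape (Fin m) works
      is-tape   : Config.tapes c ≡ the-tape Vec.∷ Vec.[]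
      in-phase  : phase S ≡ in-state (Config.state c)
      shows     : Represents the-tape (position S) (contents S)
      visited   : Visits the-tape (position S) origin

  step-tape : ∀ q t → step (config q (t Vec.∷ Vec.[])) ≡
    (case δ q (Tape.head t Vec.∷ Vec.[]) of λ
      { nothing → nothing
      ; (just (q′ , a)) → just (config q′ (Vec.zipWith updateTape (t Vec.∷ Vec.[]) a)) })
  step-tape q t with δ q (Tape.head t Vec.∷ Vec.[])
  ... | nothing       = refl
  ... | just (q′ , a) = refl

  -- For a halted machine, `advance` writes the scanned symbol back.
  at-same : ∀ {A g} {t : Tape A g} {p f} → Represents t p f → Represents t p (f at p ≔ Tape.head t)
  at-same {t = t} {p} {f} (represents sc rc lc) = represents (same p sc) (λ j → same-other _ (rc j)) (λ k j e → same-other k (lc k j e))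
    where
    same : ∀ r → f r ≡ Tape.head t → (f at p ≔ Tape.head t) r ≡ Tape.head t
    same r e with r ≡ᵇ p
    ... | true  = refl
    ... | false = e
    same-other : ∀ r {l} → f r ≡ l → (f at p ≔ Tape.head t) r ≡ l
    same-other r e with r ≡ᵇ p in eq
    ... | false = e
    ... | true with refl ← ≡ᵇ⇒≡ r p (subst T (sym eq) tt) = trans (sym sc) e

  tracks-step : ∀ {o} c S → 0 < position S → Tracks o c S → Tracks o (continue c (step c)) (advance S)
  tracks-step (config q .(t Vec.∷ Vec.[])) (snapshot f p .(in-state q)) 0<p
              (tracks t refl refl rep vis)
    rewrite step-tape q t | Represents.scanned-cell rep
    with δ q (Tape.head t Vec.∷ Vec.[])
  ... | nothing = tracks t refl refl (at-same rep) vis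
  ... | just (q′ , (s , d) Vec.∷ Vec.[]) =
    tracks (updateTape t (s , d)) refl refl (represents-update s d (λ _ → 0<p) rep) (visits-update s d (λ _ → 0<p) vis)

  halts? : ∀ {X : Set} → Maybe X → Bool
  halts? nothing  = true
  halts? (just _) = false

  accepts : Cell → Bool
  accepts (s , in-state q) = halts? (δ q (s Vec.∷ Vec.[])) ∧ accepting q
  accepts _                = false

  tracks-accepts : ∀ {o} c S → Tracks o c S →
                   accepts (contents S (position S) , phase S) ≡ true ⇔ (Halted c × Accepting c)
  tracks-accepts (config q .(t Vec.∷ Vec.[])) (snapshot f p .(in-state q)) (tracks t refl refl rep vis)
    rewrite step-tape q t | Represents.scanned-cell rep
    with δ q (Tape.head t Vec.∷ Vec.[])
  ... | nothing       = mk⇔ (refl ,_) proj₂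
  ... | just (q′ , a) = mk⇔ (λ ()) (λ { (() , _) })

-- The rows of a run in bounded space, wound on a helix

cellIn-skip : ∀ {A g} n (ss : List (Symbol A g)) j → cellIn (replicate n blank ++ ss) (n + j) ≡ cellIn ss j
cellIn-skip zero    ss j = refl
cellIn-skip (suc n) ss j = cellIn-skip n ss j

cellIn-blank : ∀ {A g} n (ss : List (Symbol A g)) {j} → j < n → cellIn (replicate n blank ++ ss) j ≡ blank
cellIn-blank (suc n) ss {zero}  _         = refl
cellIn-blank (suc n) ss {suc j} (s≤s j<n) = cellIn-blank n ss j<n

cellIn-beyond : ∀ {A g} (ss : List (Symbol A g)) {j} → length ss ≤ j → cellIn ss j ≡ blank
cellIn-beyond []       _         = refl
cellIn-beyond (s ∷ ss) (s≤s l≤j) = cellIn-beyond ss l≤j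

div-row : ∀ W .{{_ : NonZero W}} i {r} → r < W → (r + i * W) / W ≡ i
div-row W i {r} r<W = trans (+-distrib-/-∣ʳ r (divides i refl))
  (trans (cong (_+ i * W / W) (m<n⇒m/n≡0 r<W)) (m*n/n≡m i W))

mod-row : ∀ W .{{_ : NonZero W}} i {r} → r < W → (r + i * W) % W ≡ r
mod-row W i {r} r<W = trans ([m+kn]%n≡m%n r i W) (m<n⇒m%n≡m r<W)

<⇒≢ᵇ : ∀ {m n} → m < n → (m ≡ᵇ n) ≡ false
<⇒≢ᵇ {zero}  {suc n} _         = refl
<⇒≢ᵇ {suc m} {suc n} (s≤s m<n) = <⇒≢ᵇ m<n

>⇒≢ᵇ : ∀ {m n} → n < m → (m ≡ᵇ n) ≡ false
>⇒≢ᵇ {suc m} {zero}  _         = refl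
>⇒≢ᵇ {suc m} {suc n} (s≤s n<m) = >⇒≢ᵇ n<m

module Unrolling {m : ℕ} (M : TM 1 (Fin m)) (w : List (Fin m)) (S W : ℕ) .{{_ : NonZero W}}
                 (space≤ : ∀ t → Run.space M (Run.run M t (Run.init M w)) ≤ S)
                 (wide : 2 + (S + S) ≤ W) where
  open Simulation M

  -- Cells 0 to S - 1 leave room for moves to the left, cell S carries the preliminary head, and the
  -- input starts at the origin `suc S`.
  initialContents : ℕ → Sym
  initialContents = cellIn (replicate (suc S) blank ++ map input w)

  snapshots : ℕ → Snapshot
  snapshots zero    = snapshot initialContents S pre
  snapshots (suc i) = advance (snapshots i)

  tape-length : ∀ {c} (t : Tape (Fin m) works) → Config.tapes c ≡ t Vec.∷ Vec.[] → space c ≤ S →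
                length (Tape.before t) + suc (length (Tape.after t)) ≤ S
  tape-length {config q .(tape ls h rs Vec.∷ Vec.[])} (tape ls h rs) refl sp = ≤-trans (≤-reflexive (sym (begin
    length (reverse ls ++ h ∷ rs) + 0          ≡⟨ +-identityʳ _ ⟩
    length (reverse ls ++ h ∷ rs)              ≡⟨ List.length-++ (reverse ls) ⟩
    length (reverse ls) + suc (length rs)      ≡⟨ cong (_+ suc (length rs)) (List.length-reverse ls) ⟩
    length ls + suc (length rs)                ∎))) sp
    where open ≡-Reasoning

  0<S : 0 < S
  0<S = ≤-trans (m≤n⇒m≤o+n (length (Tape.before (loadTape {g = works} w))) (s≤s z≤n)) (tape-length {init w} (loadTape w) refl (space≤ 0))

  length-w : length w ≤ S
  length-w = ≤-trans (fits w) (tape-length {init w} (loadTape w) refl (space≤ 0))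
    where
    fits : ∀ (w : List (Fin m)) → length w ≤ length (Tape.before (loadTape {g = works} w)) + suc (length (Tape.after (loadTape {g = works} w)))
    fits []       = z≤n
    fits (x ∷ xs) = s≤s (≤-reflexive (sym (List.length-map input xs)))

  S<W : S < W
  S<W = ≤-trans (s≤s (≤-trans (m≤m+n S S) (n≤1+n (S + S)))) wide

  load-head : ∀ (v : List (Fin m)) → cellIn (map input v) 0 ≡ Tape.head (loadTape {g = works} v)
  load-head []      = refl
  load-head (x ∷ v) = refl

  load-after : ∀ (v : List (Fin m)) j → cellIn (map input v) (suc j) ≡ cellIn (Tape.after (loadTape {g = works} v)) j
  load-after []      j = refl
  load-after (x ∷ v) j = refl

  load-before : ∀ (v : List (Fin m)) → Tape.before (loadTape {g = works} v) ≡ []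
  load-before []      = refl
  load-before (x ∷ v) = refl

  unwritten : ∀ r → (initialContents at S ≔ initialContents S) r ≡ initialContents r
  unwritten r with r ≡ᵇ S in eq
  ... | false = refl
  ... | true  = cong initialContents (sym (≡ᵇ⇒≡ r S (subst T (sym eq) tt)))

  initial-blank : ∀ {r} → r ≤ S → initialContents r ≡ blank
  initial-blank r≤S = cellIn-blank (suc S) (map input w) (s≤s r≤S)

  initial-input : ∀ j → initialContents (suc (S + j)) ≡ cellIn (map input w) j
  initial-input = cellIn-skip (suc S) (map input w)

  -- Mutual with `bounds`: a row is advanced faithfully if its head is not on cell 0, and this
  -- follows from the space bound for the configuration which that row represents.
  tracked : ∀ t → Tracks (suc S) (run t (init w)) (snapshots (suc t))
  bounds : ∀ i → 0 < position (snapshots i) × position (snapshots i) ≤ S + S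

  tracked zero = tracks (loadTape w) refl refl
    (represents (trans (cong initial′ (cong suc (sym (+-identityʳ S)))) (trans (at-input 0) (load-head w)))
                (λ j → trans (cong initial′ (cong suc (sym (+-suc S j)))) (trans (at-input (suc j)) (load-after w j)))
                (λ k j e → trans (unwritten k) (trans (initial-blank (≤-trans (m≤m+n k j) (≤-reflexive (suc-injective e))))
                                                      (cong (λ ls → cellIn ls j) (sym (load-before w))))))
    (visits (m≤m+n (suc S) _) (m≤m+n (suc S) _))
    where
    initial′ = initialContents at S ≔ initialContents S
    at-input : ∀ j → initial′ (suc (S + j)) ≡ cellIn (map input w) j
    at-input j = trans (unwritten (suc (S + j))) (initial-input j)
  tracked (suc t) = subst (λ c → Tracks (suc S) c (snapshots (2 + t))) (sym (run-suc t (init w)))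
    (tracks-step (run t (init w)) (snapshots (suc t)) (proj₁ (bounds (suc t))) (tracked t))

  bounds zero    = 0<S , m≤m+n S S
  bounds (suc t) with tracked t
  ... | tracks tp is _ _ (visits a b) = above , below
    where
    p = position (snapshots (suc t))
    lb = length (Tape.before tp)
    la = length (Tape.after tp)
    fits : lb + suc la ≤ S
    fits = tape-length {run t (init w)} tp is (space≤ t)
    above : 0 < p
    above = +-cancelʳ-≤ la 1 p (≤-trans (m≤n⇒m≤o+n lb ≤-refl) (≤-trans fits (≤-trans (n≤1+n S) b)))
    below : p ≤ S + S
    below = ≤-trans a (≤-trans (≤-reflexive (sym (+-suc S lb)))
      (+-monoʳ-≤ S (≤-trans (≤-trans (s≤s (m≤m+n lb la)) (≤-reflexive (sym (+-suc lb la)))) fits)))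

  inside : ∀ i → 1 + position (snapshots i) < W
  inside i = ≤-trans (s≤s (s≤s (proj₂ (bounds i)))) wide

  headless : ∀ i {r} → r < position (snapshots i) ⊎ position (snapshots i) < r →
             proj₂ (view (snapshots i) r) ≡ none
  headless i (inj₁ r<p) rewrite <⇒≢ᵇ r<p = refl
  headless i (inj₂ p<r) rewrite >⇒≢ᵇ p<r = refl

  -- Row i of the unrolled space-time diagram occupies W consecutive places,
  -- so that the rows form a helix; the head stays away from the seam.
  helix : ℕ → Cell
  helix k = view (snapshots (k / W)) (k % W)

  helix-row : ∀ i {r} → r < W → helix (r + i * W) ≡ view (snapshots i) r
  helix-row i r<W = cong₂ (λ a b → view (snapshots a) b) (div-row W i r<W) (mod-row W i r<W)

  helix-rule : ∀ k → helix (suc k + W) ≡ rule (helix k) (helix (suc k)) (helix (2 + k))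
  helix-rule k = go ((suc k) % W) (suc k / W) (m%n<n (suc k) W) (m≡m%n+[m/n]*n (suc k) W)
    where
    next-row : ∀ r i → suc k ≡ r + i * W → suc k + W ≡ r + suc i * W
    next-row r i e = trans (cong (_+ W) e) (trans (+-assoc r (i * W) W) (cong (r +_) (+-comm (i * W) W)))
    go : ∀ r i → r < W → suc k ≡ r + i * W → helix (suc k + W) ≡ rule (helix k) (helix (suc k)) (helix (2 + k))
    go zero zero _ ()
    go zero (suc i) 0<W e = begin
      helix (suc k + W)                 ≡⟨ trans (cong helix (next-row 0 (suc i) e)) (helix-row (2 + i) 0<W) ⟩
      view (snapshots (2 + i)) 0        ≡⟨ advance-rule-0 (snapshots (suc i)) (helix k) (proj₁ (bounds (suc i))) seam ⟩
      rule (helix k) (view (snapshots (suc i)) 0) (view (snapshots (suc i)) 1)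
        ≡⟨ cong₂ (rule (helix k)) (sym (trans (cong helix e) (helix-row (suc i) 0<W)))
                 (sym (trans (cong (helix ∘ suc) e) (helix-row (suc i) 1<W))) ⟩
      rule (helix k) (helix (suc k)) (helix (2 + k)) ∎
      where
      open ≡-Reasoning
      1<W : 1 < W
      1<W = ≤-trans (s≤s (s≤s z≤n)) (inside i)
      last : pred W < W
      last = ≤-reflexive (suc-pred W)
      previous : k ≡ pred W + i * W
      previous = suc-injective (trans e (cong (_+ i * W) (sym (suc-pred W))))
      -- Here k is the last place of its row, which the head never reaches.
      seam : proj₂ (helix k) ≡ none
      seam = trans (cong (proj₂ ∘ helix) previous) (trans (cong proj₂ (helix-row i last))
        (headless i (inj₂ (s≤s⁻¹ (≤-trans (inside i) (≤-reflexive (sym (suc-pred W))))))))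
    go (suc r) i r<W e = begin
      helix (suc k + W)                 ≡⟨ trans (cong helix (next-row (suc r) i e)) (helix-row (suc i) r<W) ⟩
      view (snapshots (suc i)) (suc r)  ≡⟨ advance-rule (snapshots i) r (proj₁ (bounds i)) ⟩
      rule (view (snapshots i) r) (view (snapshots i) (suc r)) (view (snapshots i) (2 + r))
        ≡⟨ cong₂ (λ a b → rule a b (view (snapshots i) (2 + r)))
             (sym (trans (cong helix (suc-injective e)) (helix-row i (≤-trans (n≤1+n _) r<W))))
             (sym (trans (cong helix e) (helix-row i r<W))) ⟩
      rule (helix k) (helix (suc k)) (view (snapshots i) (2 + r)) ≡⟨ right-neighbour (m≤n⇒m<n∨m≡n r<W) ⟩
      rule (helix k) (helix (suc k)) (helix (2 + k)) ∎
      where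
      open ≡-Reasoning
      -- At the end of a row the diagram has the cell W of the same row, the helix the cell 0 of the
      -- next row. Neither carries the head, and `rule` cannot tell them apart.
      right-neighbour : 2 + r < W ⊎ 2 + r ≡ W →
        rule (helix k) (helix (suc k)) (view (snapshots i) (2 + r)) ≡ rule (helix k) (helix (suc k)) (helix (2 + k))
      right-neighbour (inj₁ 2+r<W) = cong (rule (helix k) (helix (suc k))) (sym (trans (cong (helix ∘ suc) e) (helix-row i 2+r<W)))
      right-neighbour (inj₂ 2+r≡W) = rule-headless (helix k) (helix (suc k)) _ _
        (headless i (inj₂ (≤-trans (<⇒≤ (inside i)) (≤-reflexive (sym 2+r≡W)))))
        (trans (cong proj₂ (trans (cong helix seam) (helix-row (suc i) (≤-trans z<s r<W))))
               (headless (suc i) (inj₁ (proj₁ (bounds (suc i))))))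
        where
        seam : 2 + k ≡ 0 + suc i * W
        seam = trans (cong suc e) (cong (_+ i * W) 2+r≡W)

  -- The left margin of row 0 is skipped: the first event is the preliminary head, and the input
  -- follows at once. The formula then need not spell out exponentially many blanks.
  expected : ℕ → Cell
  expected k = helix (k + S)

  expected-rule : ∀ k → expected (suc k + W) ≡ rule (expected k) (expected (suc k)) (expected (2 + k))
  expected-rule k = trans (cong helix (shuffle k W S)) (helix-rule (k + S))
    where
    shuffle : ∀ k W S → suc k + W + S ≡ suc (k + S) + W
    shuffle = solve-∀

  expected-0 : expected 0 ≡ (blank , pre)
  expected-0 = trans (trans (cong helix (sym (+-identityʳ S))) (helix-row 0 S<W))
    (cong₂ (λ s b → s , (if b then pre else none)) (initial-blank ≤-refl) (≡ᵇ-refl S))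

  expected-W : expected W ≡ (blank , none)
  expected-W = trans (cong helix (trans (+-comm W S) (cong (S +_) (sym (+-identityʳ W))))) (trans (helix-row 1 S<W)
    (cong₂ _,_ (trans (unwritten S) (initial-blank ≤-refl)) (headless 1 (inj₁ ≤-refl))))

  expected-input : ∀ j → suc j < W → expected (suc j) ≡ (cellIn (map input w) j , none)
  expected-input j 1+j<W with suc j + S <? W
  ... | yes <W = trans (trans (cong helix (sym (+-identityʳ (suc j + S)))) (helix-row 0 <W))
    (cong₂ _,_ (trans (cong (initialContents ∘ suc) (+-comm j S)) (initial-input j)) (headless 0 (inj₂ (s≤s (m≤n+m S j)))))
  -- The last S of the first W places belong to the left margin of row 1. They are blank, as are the
  -- cells behind the input, because `length w ≤ S ≤ j`.
  ... | no ≮W = trans (trans (cong helix wrap) (helix-row 1 (≤-trans r<S (<⇒≤ S<W))))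
    (cong₂ _,_ (trans (unwritten r) (trans (initial-blank (<⇒≤ r<S))
                        (sym (cellIn-beyond (map input w) (≤-trans (≤-reflexive (List.length-map input w)) (≤-trans length-w S≤j))))))
               (headless 1 (inj₁ (≤-trans r<S (n≤1+n S)))))
    where
    r = suc j + S ∸ W
    r+W : r + W ≡ suc j + S
    r+W = m∸n+n≡m (≮⇒≥ ≮W)
    wrap : suc j + S ≡ r + 1 * W
    wrap = trans (sym r+W) (cong (r +_) (sym (+-identityʳ W)))
    r<S : r < S
    r<S = +-cancelʳ-≤ W (suc r) S (≤-trans (≤-reflexive (cong suc r+W)) (≤-trans (+-monoˡ-≤ S 1+j<W) (≤-reflexive (+-comm W S))))
    S≤j : S ≤ j
    S≤j = +-cancelʳ-≤ S S j (≤-trans (n≤1+n (S + S)) (s≤s⁻¹ (≤-trans wide (≮⇒≥ ≮W))))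

  view-accepts : ∀ i r → accepts (view (snapshots i) r) ≡ true →
                 ∃[ t ] Halted (run t (init w)) × Accepting (run t (init w))
  view-accepts i r e with r ≡ᵇ position (snapshots i) in eq
  view-accepts zero    r () | true
  view-accepts zero    r () | false
  view-accepts (suc t) r () | false
  view-accepts (suc t) r e  | true with refl ← ≡ᵇ⇒≡ r _ (subst T (sym eq) tt) =
    t , Equivalence.to (tracks-accepts (run t (init w)) (snapshots (suc t)) (tracked t)) e

  expected-accepts : ∀ k → accepts (expected k) ≡ true → ∃[ t ] Halted (run t (init w)) × Accepting (run t (init w))
  expected-accepts k = view-accepts ((k + S) / W) ((k + S) % W)

  accepted-expected : ∀ t → Halted (run t (init w)) → Accepting (run t (init w)) → ∃[ k ] accepts (expected k) ≡ true
  accepted-expected t h a = k , trans (cong (accepts ∘ helix) place) (trans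
    (cong accepts (trans (helix-row (suc t) (≤-trans (n≤1+n _) (inside (suc t)))) at-head))
    (Equivalence.from (tracks-accepts (run t (init w)) S₁ (tracked t)) (h , a)))
    where
    S₁ = snapshots (suc t)
    k = position S₁ + suc t * W ∸ S
    -- Row `suc t` starts at W or later, hence behind S, and the truncated subtraction in `k` is
    -- exact.
    place : k + S ≡ position S₁ + suc t * W
    place = m∸n+n≡m (≤-trans (<⇒≤ S<W) (≤-trans (m≤m+n W (t * W)) (m≤n+m (suc t * W) (position S₁))))
    at-head : view S₁ (position S₁) ≡ (contents S₁ (position S₁) , phase S₁)
    at-head = cong (λ b → contents S₁ (position S₁) , (if b then phase S₁ else none)) (≡ᵇ-refl (position S₁))

-- Letters and the formula

module Letters {m : ℕ} (M : TM 1 (Fin m)) where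
  open Simulation M public

  symbols phases : ℕ
  symbols = suc (m + works)
  phases  = 2 + states

  symbolIndex : Sym → Fin symbols
  symbolIndex blank     = Fin.zero
  symbolIndex (input x) = Fin.suc (x Fin.↑ˡ works)
  symbolIndex (work g)  = Fin.suc (m Fin.↑ʳ g)

  toSymbol : Fin symbols → Sym
  toSymbol Fin.zero    = blank
  toSymbol (Fin.suc i) with Fin.splitAt m i
  ... | inj₁ x = input x
  ... | inj₂ g = work g

  toSymbol-index : ∀ s → toSymbol (symbolIndex s) ≡ s
  toSymbol-index blank     = refl
  toSymbol-index (input x) rewrite Fin.splitAt-↑ˡ m x works = refl
  toSymbol-index (work g)  rewrite Fin.splitAt-↑ʳ m works g = refl

  phaseIndex : Phase → Fin phases
  phaseIndex none         = Fin.zero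
  phaseIndex pre          = Fin.suc Fin.zero
  phaseIndex (in-state q) = Fin.suc (Fin.suc q)

  toPhase : Fin phases → Phase
  toPhase Fin.zero              = none
  toPhase (Fin.suc Fin.zero)    = pre
  toPhase (Fin.suc (Fin.suc q)) = in-state q

  toPhase-index : ∀ h → toPhase (phaseIndex h) ≡ h
  toPhase-index none         = refl
  toPhase-index pre          = refl
  toPhase-index (in-state q) = refl

  flagIndex : Bool → Fin 2
  flagIndex false = Fin.zero
  flagIndex true  = Fin.suc Fin.zero

  toFlag : Fin 2 → Bool
  toFlag Fin.zero    = false
  toFlag (Fin.suc _) = true

  toFlag-index : ∀ b → toFlag (flagIndex b) ≡ b
  toFlag-index false = refl
  toFlag-index true  = refl

  abstract
    letterCount : ℕ
    letterCount = 2 * (symbols * phases)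

    -- The flag marks the letters of the first row.
    letterOf : Bool → Cell → Fin letterCount
    letterOf b (s , h) = Fin.combine (flagIndex b) (Fin.combine (symbolIndex s) (phaseIndex h))

    flag : Fin letterCount → Bool
    flag a = toFlag (proj₁ (Fin.remQuot {2} (symbols * phases) a))

    cell : Fin letterCount → Cell
    cell a = let i , j = Fin.remQuot {symbols} phases (proj₂ (Fin.remQuot {2} (symbols * phases) a))
             in toSymbol i , toPhase j

    flag-letterOf : ∀ b c → flag (letterOf b c) ≡ b
    flag-letterOf b (s , h) = trans
      (cong (toFlag ∘ proj₁) (Fin.remQuot-combine (flagIndex b) (Fin.combine (symbolIndex s) (phaseIndex h))))
      (toFlag-index b)

    cell-letterOf : ∀ b c → cell (letterOf b c) ≡ c
    cell-letterOf b (s , h) = trans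
      (cong (λ p → let i , j = Fin.remQuot {symbols} phases (proj₂ p) in toSymbol i , toPhase j)
            (Fin.remQuot-combine (flagIndex b) (Fin.combine (symbolIndex s) (phaseIndex h))))
      (trans (cong (λ p → toSymbol (proj₁ p) , toPhase (proj₂ p)) (Fin.remQuot-combine (symbolIndex s) (phaseIndex h)))
             (cong₂ _,_ (toSymbol-index s) (toPhase-index h)))

  empty : Cell
  empty = blank , none

  empty? : Cell → Bool
  empty? (blank , none) = true
  empty? _              = false

  empty?-sound : ∀ {c} → empty? c ≡ true → c ≡ empty
  empty?-sound {blank , none} _ = refl

  Formulae : Set
  Formulae = Template letterCount

  truth : Formulae
  truth = atom (letterOf false empty) or neg (atom (letterOf false empty))

  some : ∀ {n} → (Fin n → Formulae) → Formulae
  some {zero}  f = neg truth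
  some {suc n} f = f Fin.zero or some (f ∘ Fin.suc)

  guarded : (Fin letterCount → Bool) → Fin letterCount → Formulae
  guarded p a = if p a then atom a else neg truth

  having : (Fin letterCount → Bool) → Formulae
  having p = some (guarded p)

  unflagged stray accepted : Fin letterCount → Bool
  unflagged a = if flag a then false else true
  stray a     = flag a ∧ (if empty? (cell a) then false else true)
  accepted a  = accepts (cell a)

  -- The last two conjuncts are evaluated at the middle event. `F beyond truth` exempts the events
  -- near the end of the word, where no image can be demanded.
  miscopied : Fin letterCount → Fin letterCount → Fin letterCount → Formulae
  miscopied a b c = atom a and F next-event (atom b and (F next-event (atom c) and
    (F beyond truth and neg (F shift (atom (letterOf false (rule (cell a) (cell b) (cell c))))))))

  fault : Formulae
  fault = F now truth or
          ((F later truth and neg (F next-event truth)) or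
           some (λ a → some λ b → some λ c → miscopied a b c))

  -- As `F` is strict, the first event is treated separately in `no-fault`. It also has no left
  -- neighbour, so no triple determines its image: `second-row-empty` prescribes this letter and, by
  -- providing the image, fixes W. `acceptance` asks for one more event because the last letter of
  -- the word is not known to be a copy.
  no-fault first-row-flagged second-row-empty acceptance global : Formulae
  no-fault          = neg (fault or F later fault)
  first-row-flagged = neg (F row (having unflagged))
  second-row-empty  = F shift (atom (letterOf false empty))
  acceptance        = F later (having accepted and F later truth)
  global            = no-fault and (first-row-flagged and (second-row-empty and acceptance))

  first : Fin letterCount
  first = letterOf true (blank , pre)

  inputLetter : Fin m → Fin letterCount
  inputLetter x = letterOf true (input x , none)

  -- Together with `first-row-flagged` this makes the rest of the first row blank without mentioning
  -- its length. Later rows are unaffected, since copies carry no flag.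
  end : Formulae
  end = neg (F later (having stray))

  module Semantics (N : ℕ) (ρ : TimedWord (Fin letterCount)) where
    open TimedWord ρ public

    infix 4 _⊨_
    _⊨_ : Position → Formulae → Set
    i ⊨ φ = Models ρ i (instantiate N φ)

    ⊨-truth : ∀ i → i ⊨ truth
    ⊨-truth i with letter i Fin.≟ letterOf false empty
    ... | yes e = inj₁ e
    ... | no ¬e = inj₂ ¬e

    ⊨-and : ∀ {i} φ ψ → i ⊨ φ → i ⊨ ψ → i ⊨ φ and ψ
    ⊨-and φ ψ x y (inj₁ ¬x) = ¬x x
    ⊨-and φ ψ x y (inj₂ ¬y) = ¬y y

    ⊨-and⁻¹ : ∀ {i} φ ψ → i ⊨ φ and ψ → ¬ ¬ (i ⊨ φ × i ⊨ ψ)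
    ⊨-and⁻¹ φ ψ ¬⊎ ¬× = ¬⊎ (inj₁ λ x → ¬⊎ (inj₂ λ y → ¬× (x , y)))

    ⊨-some : ∀ {n i} (f : Fin n → Formulae) a → i ⊨ f a → i ⊨ some f
    ⊨-some f Fin.zero    x = inj₁ x
    ⊨-some f (Fin.suc a) x = inj₂ (⊨-some (f ∘ Fin.suc) a x)

    ⊨-some⁻¹ : ∀ {n i} (f : Fin n → Formulae) → i ⊨ some f → ∃[ a ] i ⊨ f a
    ⊨-some⁻¹ {zero}  {i} f ¬truth   = ⊥-elim (¬truth (⊨-truth i))
    ⊨-some⁻¹ {suc n} f (inj₁ x) = Fin.zero , x
    ⊨-some⁻¹ {suc n} f (inj₂ y) with a , x ← ⊨-some⁻¹ (f ∘ Fin.suc) y = Fin.suc a , x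

    ⊨-having : ∀ {i} p → p (letter i) ≡ true → i ⊨ having p
    ⊨-having {i} p e = ⊨-some (guarded p) (letter i) (subst (λ b → i ⊨ (if b then atom (letter i) else neg truth)) (sym e) refl)

    ⊨-having⁻¹ : ∀ {i} p → i ⊨ having p → p (letter i) ≡ true
    ⊨-having⁻¹ {i} p x with a , y ← ⊨-some⁻¹ (guarded p) x with p a in e
    ... | true with refl ← y = e
    ... | false = ⊥-elim (y (⊨-truth i))

-- From satisfiability to acceptance

-- Well-founded induction: beyond W a value is determined by three values that lie earlier because
-- `2 ≤ W`. The place W itself has no triple and needs its own hypothesis, and the last place is
-- left out because `copy` requires a later one.
agreement : ∀ {Place X : Set} (index : Place → ℕ) (at : Place → X) (E : ℕ → X) (rule : X → X → X → X) {size W} → 2 ≤ W →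
  (∀ {k} → k ≤ size → ∃[ i ] index i ≡ k) →
  (∀ k → E (suc k + W) ≡ rule (E k) (E (suc k)) (E (2 + k))) →
  (∀ i → index i ≡ W → at i ≡ E W) → (∀ i → index i < W → at i ≡ E (index i)) →
  (∀ k {h i j i′} → index h ≡ k → index i ≡ suc k → index j ≡ 2 + k → index i′ ≡ suc k + W →
     2 + (k + W) ≤ size → at i′ ≡ rule (at h) (at i) (at j)) →
  ∀ k → suc k ≤ size → ∀ i → index i ≡ k → at i ≡ E k
agreement index at E rule {size} {W} 2≤W position-at E-rule at-W initial copy = <-rec Matches go
  where
  Matches : ℕ → Set
  Matches k = suc k ≤ size → ∀ i → index i ≡ k → at i ≡ E k
  beyond-first : ∀ k → (∀ {k′} → k′ < k + W → Matches k′) → Matches (k + W)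
  beyond-first zero    _  _     i i≡ = at-W i i≡
  beyond-first (suc k) ih <size i i≡
    with h , h≡ ← position-at {k} (≤-trans (m≤m+n k W) (≤-trans (n≤1+n _) (≤-trans (n≤1+n _) <size)))
    with a , a≡ ← position-at {1 + k} (≤-trans (s≤s (m≤m+n k W)) (≤-trans (n≤1+n _) <size))
    with b , b≡ ← position-at {2 + k} (≤-trans (s≤s (s≤s (m≤m+n k W))) <size)
    = begin
      at i                                ≡⟨ copy k h≡ a≡ b≡ i≡ <size ⟩
      rule (at h) (at a) (at b)
        ≡⟨ cong₂ (λ x y → rule x y (at b)) (earlier h 0 z≤n h≡) (earlier a 1 (s≤s z≤n) a≡) ⟩
      rule (E k) (E (1 + k)) (at b)       ≡⟨ cong (rule (E k) (E (1 + k))) (earlier b 2 ≤-refl b≡) ⟩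
      rule (E k) (E (1 + k)) (E (2 + k))  ≡⟨ sym (E-rule k) ⟩
      E (suc k + W)                       ∎
    where
    open ≡-Reasoning
    earlier : ∀ p o → o ≤ 2 → index p ≡ o + k → at p ≡ E (o + k)
    earlier p o o≤2 p≡ = ih <k (≤-trans <k (≤-trans (n≤1+n _) <size)) p p≡
      where
      <k : o + k < suc k + W
      <k = s≤s (≤-trans (+-monoˡ-≤ k (≤-trans o≤2 2≤W)) (≤-reflexive (+-comm W k)))
  go : ∀ k → (∀ {k′} → k′ < k → Matches k′) → Matches k
  go k ih <size i i≡ with k <? W
  ... | yes k<W = trans (initial i (≤-trans (s≤s (≤-reflexive i≡)) k<W)) (cong E i≡)
  ... | no k≮W = subst Matches k≡ (beyond-first (k ∸ W) (λ k′< → ih (≤-trans k′< (≤-reflexive k≡)))) <size i i≡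
    where
    k≡ : k ∸ W + W ≡ k
    k≡ = m∸n+n≡m (≮⇒≥ k≮W)

module Soundness {m : ℕ} (M : TM 1 (Fin m)) (w : List (Fin m)) (S N : ℕ)
                 (space≤ : ∀ t → Run.space M (Run.run M t (Run.init M w)) ≤ S) (0<S : 0 < S) (S≤ : 64 * S ≤ span N)
                 (ρ : TimedWord (Fin (Letters.letterCount M))) where
  open Letters M
  open Semantics N ρ
  open Timing ρ

  C : ℕ
  C = span N

  cellAt : Position → Cell
  cellAt i = cell (letter i)

  position-at : ∀ {k} → k ≤ size-1 → ∃[ i ] toℕ {suc size-1} i ≡ k
  position-at k≤ = Fin.fromℕ< (s≤s k≤) , Fin.toℕ-fromℕ< (s≤s k≤)

  toℕ≤ : ∀ (i : Position) → toℕ i ≤ size-1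
  toℕ≤ i = s≤s⁻¹ (Fin.toℕ<n i)

  -- Contradictory difference constraints add up to a cycle from i to i. Splitting off the variable
  -- part D, usually the span, leaves two numerals to be compared by computation.
  cycle : ∀ {i a b} D x y → i ⊕ a ≼ i ⊕ b → a ≡ D + x → b ≡ D + y → T (suc y ≤ᵇ x) → ⊥
  cycle D x y i≼i refl refl y<x = <⇒≱ (≤ᵇ⇒≤ (suc y) x y<x) (+-cancelˡ-≤ D x y (≼-cancel i≼i))

  infixr 5 _≼≼_
  _≼≼_ : ∀ {i a j b c k d} → i ⊕ a ≼ j ⊕ b → j ⊕ c ≼ k ⊕ d → i ⊕ (a + c) ≼ k ⊕ (b + d)
  _≼≼_ = ≼-trans

  consecutive : ∀ {i j : Position} → toℕ j ≡ suc (toℕ i) → i Fin.< j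
  consecutive e = ≤-reflexive (sym e)

  Copy : Position → Position → Position → Position → Set
  Copy i j k j′ = letter j′ ≡ letterOf false (rule (cellAt i) (cellAt j) (cellAt k))

  module Faultless (faultless : ∀ i → ¬ (i ⊨ fault)) where

    gap : ∀ {i j} → i Fin.< j → i ⊕ 16 ≼ j ⊕ 2
    gap {i} {j} i<j = now-apart N i<j λ soon → faultless i (inj₁ (j , i<j , soon , ⊨-truth j))

    successor : ∀ {i j} → i Fin.< j → ¬ ¬ (∃[ j′ ] i Fin.< j′ × within N {i} {j′} next-event)
    successor {i} {j} i<j none′ = faultless i (inj₂ (inj₁ (⊨-and (F later truth) (neg (F next-event truth))
      (j , i<j , later-within N i<j , ⊨-truth j)
      λ { (j′ , i<j′ , near , _) → none′ (j′ , i<j′ , near) })))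

    copy : ∀ {i j k l} → i Fin.< j → within N {i} {j} next-event → j Fin.< k → within N {j} {k} next-event →
           j Fin.< l → ¬ (l ⊕ 0 ≼ j ⊕ (C + 2)) →
           ¬ ¬ (∃[ j′ ] j Fin.< j′ × within N {j} {j′} shift × Copy i j k j′)
    copy {i} {j} {k} {l} i<j near₁ j<k near₂ j<l far none′ =
      faultless i (inj₂ (inj₂
        (⊨-some (λ a → some λ b → some λ c → miscopied a b c) (letter i)
          (⊨-some (λ b → some λ c → miscopied (letter i) b c) (letter j)
            (⊨-some (λ c → miscopied (letter i) (letter j) c) (letter k)
              (⊨-and (atom (letter i)) (F next-event φ₁) refl
                (j , i<j , near₁ , ⊨-and (atom (letter j)) φ₂ refl
                  (⊨-and (F next-event (atom (letter k))) φ₃ (k , j<k , near₂ , refl)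
                    (⊨-and (F beyond truth) φ₄ (l , j<l , beyond-within N far , ⊨-truth l) none′)))))))))
      where
      φ₄ φ₃ φ₂ φ₁ : Formulae
      φ₄ = neg (F shift (atom (letterOf false (rule (cellAt i) (cellAt j) (cellAt k)))))
      φ₃ = F beyond truth and φ₄
      φ₂ = F next-event (atom (letter k)) and φ₃
      φ₁ = atom (letter j) and φ₂

  -- Near and Shifted stand for membership of a distance in the windows
  -- next-event and shift.
  module Timeline
    (Near Shifted : Position → Position → Set)
    (near-≼ : ∀ {i j} → Near i j → i ⊕ 16 ≼ j ⊕ 2 × j ⊕ 0 ≼ i ⊕ 19)
    (shifted-≼ : ∀ {i j} → Shifted i j → i ⊕ C ≼ j ⊕ 2 × j ⊕ 0 ≼ i ⊕ (suc C + 2))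
    (apart : ∀ {i j : Position} → i Fin.< j → i ⊕ 16 ≼ j ⊕ 2)
    (has-successor : ∀ {i j : Position} → i Fin.< j → ¬ ¬ (∃[ j′ ] i Fin.< j′ × Near i j′))
    (copied-over : ∀ {i j k l} → i Fin.< j → Near i j → j Fin.< k → Near j k →
                   j Fin.< l → ¬ (l ⊕ 0 ≼ j ⊕ (C + 2)) →
                   ¬ ¬ (∃[ j′ ] j Fin.< j′ × Shifted j j′ × Copy i j k j′)) where

    -- The length of a gap is given away by adding `i ⊕ 2 ≼ i ⊕ 16`, so that both offsets become 18
    -- and the case of equality has the same form.
    monotone : ∀ {i j : Position} → toℕ i ≤ toℕ j → i ⊕ 18 ≼ j ⊕ 18
    monotone {i} {j} i≤j with m≤n⇒m<n∨m≡n i≤j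
    ... | inj₁ i<j = ≼-refl {a = 2} {16} (m≤m+n 2 14) ≼≼ apart i<j
    ... | inj₂ i≡j with refl ← Fin.toℕ-injective i≡j = ≼-refl ≤-refl

    next-unique : ∀ {i j} → i Fin.< j → Near i j → toℕ j ≡ suc (toℕ i)
    next-unique {i} {j} i<j near with m≤n⇒m<n∨m≡n i<j
    ... | inj₂ e = sym e
    ... | inj₁ i+1<j with k , e ← position-at (≤-trans (<⇒≤ i+1<j) (toℕ≤ j)) =
      -- With an event in between, the distance would be at least 14 + 14, but `Near` allows at most
      -- 17 + 2.
      ⊥-elim (cycle 0 32 23
        (apart {i} {k} (consecutive e) ≼≼ apart (≤-trans (s≤s (≤-reflexive e)) i+1<j) ≼≼ proj₂ (near-≼ near))
        refl refl tt)

    next-near : ∀ {i j} → toℕ j ≡ suc (toℕ i) → ¬ ¬ Near i j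
    next-near {i} {j} e ¬near = has-successor (consecutive e) λ { (j′ , i<j′ , near) →
      ¬near (subst (λ k → Near i k)
                   (Fin.toℕ-injective (trans (next-unique i<j′ near) (sym e))) near) }

    next-bound : ∀ {i j} → toℕ j ≡ suc (toℕ i) → j ⊕ 0 ≼ i ⊕ 19
    next-bound {i} {j} e = ≼-stable λ ¬≼ → next-near {i} {j} e λ near → ¬≼ (proj₂ (near-≼ near))

    copied : ∀ {i j k l} → toℕ j ≡ suc (toℕ i) → toℕ k ≡ suc (toℕ j) →
             j Fin.< l → ¬ (l ⊕ 0 ≼ j ⊕ (C + 2)) →
             ¬ ¬ (∃[ j′ ] j Fin.< j′ × Shifted j j′ × Copy i j k j′)
    copied {i} {j} {k} {l} e₁ e₂ j<l far none′ =
      next-near {i} {j} e₁ λ near₁ → next-near {j} {k} e₂ λ near₂ →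
      copied-over (consecutive e₁) near₁ (consecutive e₂) near₂ j<l far none′

    module Rows (j₀ : Position) (j₀-shifted : Shifted Fin.zero j₀) (0<j₀ : 0 < toℕ j₀) where

      W : ℕ
      W = toℕ j₀

      instance
        W≢0 : NonZero W
        W≢0 = >-nonZero 0<j₀

      travel : ∀ k i → toℕ i ≡ k → i ⊕ 0 ≼ Fin.zero ⊕ (k * 19)
      travel zero    Fin.zero e = ≼-refl z≤n
      travel (suc k) i e with h , h≡k ← position-at (≤-trans (n≤1+n k) (≤-trans (≤-reflexive (sym e)) (toℕ≤ i))) =
        next-bound {h} {i} (trans e (cong suc (sym h≡k))) ≼≼ travel k h h≡k

      -- Gaps measure at most 19, so W of them cover C - 2 only if `C ≤ 19 W + 2`. For `W ≤ 2 S + 1`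
      -- the right side is at most `38 S + 21 ≤ 59 S`, and 64 is the next power of two.
      wide : 2 + (S + S) ≤ W
      wide = ≮⇒≥ λ W<2+2S → <⇒≱ (too-small (s≤s⁻¹ W<2+2S)) (≤-trans S≤ C≤)
        where
        C≤ : C ≤ W * 19 + 2
        C≤ = ≤-trans (≤-reflexive (sym (+-identityʳ C))) (≤-trans
          (≼-cancel (proj₁ (shifted-≼ j₀-shifted) ≼≼ travel W j₀ refl)) (≤-reflexive (+-comm 2 (W * 19))))
        open ≤-Reasoning
        expand : ∀ S → (1 + (S + S)) * 19 + 2 ≡ 21 + 38 * S
        expand = solve-∀
        too-small : W ≤ 1 + (S + S) → W * 19 + 2 < 64 * S
        too-small W≤ = s≤s⁻¹ (begin
          2 + (W * 19 + 2)              ≤⟨ s≤s (s≤s (+-monoˡ-≤ 2 (*-monoˡ-≤ 19 W≤))) ⟩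
          2 + ((1 + (S + S)) * 19 + 2)  ≡⟨ cong (2 +_) (expand S) ⟩
          2 + (21 + 38 * S)             ≤⟨ s≤s (+-monoʳ-≤ 1 (+-monoˡ-≤ (38 * S) (*-monoʳ-≤ 21 0<S))) ⟩
          1 + (1 + (21 * S + 38 * S))   ≤⟨ +-monoʳ-≤ 1 (+-monoˡ-≤ _ 0<S) ⟩
          1 + (S + (21 * S + 38 * S))   ≤⟨ m≤m+n _ (4 * S) ⟩
          1 + (S + (21 * S + 38 * S)) + 4 * S ≡⟨ shuffle S ⟩
          1 + 64 * S                    ∎)
          where
          shuffle : ∀ S → 1 + (S + (21 * S + 38 * S)) + 4 * S ≡ 1 + 64 * S
          shuffle = solve-∀

      open Unrolling M w S W space≤ wide hiding (0<S)

      Aligned : Position → Position → Set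
      Aligned i i′ = i ⊕ C ≼ i′ ⊕ 2 × i′ ⊕ 0 ≼ i ⊕ (suc C + 2)

      -- The image of i lies at the distance of h′ from h up to the length of
      -- two gaps, and this leaves room for one event after h′ only.
      align-step : ∀ {h i k h′ i′ l} → toℕ i ≡ suc (toℕ h) → toℕ k ≡ suc (toℕ i) →
                   toℕ i′ ≡ suc (toℕ h′) → toℕ l ≡ suc (toℕ i′) → i Fin.< l →
                   Aligned h h′ → ¬ ¬ (Aligned i i′ × Copy h i k i′)
      align-step {h} {i} {k} {h′} {i′} {l} hi ik h′i′ i′l i<l (hh′ , h′h) none′ =
        copied {h} {i} {k} {l} hi ik i<l far λ { (j , i<j , win , copy) →
          none′ (subst (λ z → Aligned i z × Copy h i k z) (Fin.toℕ-injective (same j (shifted-≼ win))) (shifted-≼ win , copy)) }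
        where
        -- The event l comes two gaps, at least 28, after h′. This is at least C + 26 after h and C
        -- + 7 after i, hence beyond the window despite the error 2.
        far : ¬ (l ⊕ 0 ≼ i ⊕ (C + 2))
        far li = cycle C 32 27
          (next-bound {h} {i} hi ≼≼ hh′ ≼≼ apart {h′} {i′} (consecutive h′i′) ≼≼ apart {i′} {l} (consecutive i′l) ≼≼ li)
          (lhs C) (rhs C) tt
          where
          lhs : ∀ C → 0 + (C + (16 + (16 + 0))) ≡ C + 32
          lhs = solve-∀
          rhs : ∀ C → 19 + (2 + (2 + (2 + (C + 2)))) ≡ C + 27
          rhs = solve-∀
        -- Counted from h′, the image j lies between 14 - 2 - 3 = 9 and 19 + 3 + 2 = 24. So it comes
        -- after h′ and before l, which is at least 28 away.
        same : ∀ j → Aligned i j → toℕ j ≡ toℕ i′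
        same j (ij , ji) with <-cmp (toℕ j) (toℕ i′)
        ... | tri≈ _ e _ = e
        ... | tri< j<i′ _ _ = ⊥-elim (cycle C 34 25
                (apart {h} {i} (consecutive hi) ≼≼ ij ≼≼ monotone (s≤s⁻¹ (≤-trans j<i′ (≤-reflexive h′i′))) ≼≼ h′h)
                (lhs C) (rhs C) tt)
          where
          lhs : ∀ C → 16 + (C + (18 + 0)) ≡ C + 34
          lhs = solve-∀
          rhs : ∀ C → 2 + (2 + (18 + (suc C + 2))) ≡ C + 25
          rhs = solve-∀
        ... | tri> _ _ i′<j = ⊥-elim (cycle C 50 46
                (next-bound {h} {i} hi ≼≼ hh′ ≼≼ apart {h′} {i′} (consecutive h′i′) ≼≼ apart {i′} {l} (consecutive i′l) ≼≼
                 monotone (≤-trans (≤-reflexive i′l) i′<j) ≼≼ ji)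
                (lhs C) (rhs C) tt)
          where
          lhs : ∀ C → 0 + (C + (16 + (16 + (18 + 0)))) ≡ C + 50
          lhs = solve-∀
          rhs : ∀ C → 19 + (2 + (2 + (2 + (18 + (suc C + 2))))) ≡ C + 46
          rhs = solve-∀

      -- Mutual induction on k: the alignment of the left neighbour yields that of the next event
      -- together with its copied letter. Being a pair of stable constraints, the alignment leaves
      -- the double negation at every step.
      aligned : ∀ k {i i′} → toℕ i ≡ k → toℕ i′ ≡ k + W → suc (k + W) ≤ size-1 → Aligned i i′
      stepped : ∀ k {h i j i′} → toℕ h ≡ k → toℕ i ≡ suc k → toℕ j ≡ 2 + k → toℕ i′ ≡ suc k + W →
                2 + (k + W) ≤ size-1 → ¬ ¬ (Aligned i i′ × Copy h i j i′)

      aligned zero {i} {i′} i≡0 i′≡W _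
        with refl ← Fin.toℕ-injective {i = i} {Fin.zero} i≡0
        with refl ← Fin.toℕ-injective {i = i′} {j₀} i′≡W = shifted-≼ j₀-shifted
      aligned (suc k) {i} {i′} i≡ i′≡ <size
        with h , h≡ ← position-at {k} (≤-trans (m≤m+n k W) (≤-trans (n≤1+n _) (≤-trans (n≤1+n _) <size)))
        with j , j≡ ← position-at {2 + k} (≤-trans (s≤s (s≤s (m≤m+n k W))) <size)
        = (≼-stable λ ¬≼ → stepped′ λ { ((≼ , _) , _) → ¬≼ ≼ }) , (≼-stable λ ¬≼ → stepped′ λ { ((_ , ≼) , _) → ¬≼ ≼ })
        where stepped′ = stepped k {h} {i} {j} {i′} h≡ i≡ j≡ i′≡ <size

      stepped k {h} {i} {j} {i′} h≡ i≡ j≡ i′≡ <size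
        with h′ , h′≡ ← position-at {k + W} (≤-trans (n≤1+n _) (≤-trans (n≤1+n _) <size))
        with l , l≡ ← position-at {2 + (k + W)} <size
        = align-step {h} {i} {j} {h′} {i′} {l}
            (trans i≡ (cong suc (sym h≡))) (trans j≡ (cong suc (sym i≡)))
            (trans i′≡ (cong suc (sym h′≡))) (trans l≡ (cong suc (sym i′≡)))
            (≤-trans (s≤s (≤-reflexive i≡)) (≤-trans (s≤s (s≤s (m≤m+n k W))) (≤-reflexive (sym l≡))))
            (aligned k {h} {h′} h≡ h′≡ (≤-trans (n≤1+n _) <size))

      copy-at : ∀ k {h i j i′} → toℕ h ≡ k → toℕ i ≡ suc k → toℕ j ≡ 2 + k → toℕ i′ ≡ suc k + W →
                2 + (k + W) ≤ size-1 → cellAt i′ ≡ rule (cellAt h) (cellAt i) (cellAt j)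
      copy-at k {h} {i} {j} {i′} h≡ i≡ j≡ i′≡ <size = trans (cong cell exact) (cell-letterOf false _)
        where
        exact : Copy h i j i′
        exact = decidable-stable (letter i′ Fin.≟ _) λ ¬copy →
          stepped k {h} {i} {j} {i′} h≡ i≡ j≡ i′≡ <size λ { (_ , copy) → ¬copy copy }

      at-row-end : letter j₀ ≡ letterOf false empty → ∀ i → toℕ i ≡ W → cellAt i ≡ expected W
      at-row-end j₀-empty i i≡ = trans (cong cellAt (Fin.toℕ-injective i≡))
        (trans (cong cell j₀-empty) (trans (cell-letterOf false empty) (sym expected-W)))

      matches : letter j₀ ≡ letterOf false empty → (∀ i → toℕ i < W → cellAt i ≡ expected (toℕ i)) →
                ∀ k → suc k ≤ size-1 → ∀ i → toℕ i ≡ k → cellAt i ≡ expected k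
      matches j₀-empty initial = agreement toℕ cellAt expected rule (≤-trans (m≤m+n 2 (S + S)) wide) position-at
        expected-rule (at-row-end j₀-empty) initial (λ k {h} {i} {j} {i′} → copy-at k {h} {i} {j} {i′})

      module Initial (first-letter : letter Fin.zero ≡ first)
                     (input-cells : ∀ j p → toℕ p ≡ suc j → j < length w → cellAt p ≡ (cellIn (map input w) j , none))
                     (after-input : ∀ i → length w < toℕ i → stray (letter i) ≡ false)
                     (row-flagged : ∀ i → 0 < toℕ i → ¬ (Fin.zero ⊕ C ≼ i ⊕ 2) → unflagged (letter i) ≡ false) where

        in-first-row : ∀ i → 0 < toℕ i → toℕ i < W → unflagged (letter i) ≡ false
        -- An event at C - 2 or later puts j₀, at least one gap behind it, at C + 12 or later,
        -- whereas the window `shift` ends at C + 3 with the error included.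
        in-first-row i 0<i i<W = row-flagged i 0<i λ far → cycle C 16 7
          (far ≼≼ apart {i} {j₀} i<W ≼≼ proj₂ (shifted-≼ j₀-shifted)) (lhs C) (rhs C) tt
          where
          lhs : ∀ C → C + (16 + 0) ≡ C + 16
          lhs = solve-∀
          rhs : ∀ C → 2 + (2 + (suc C + 2)) ≡ C + 7
          rhs = solve-∀

        is-empty : ∀ a → unflagged a ≡ false → stray a ≡ false → cell a ≡ empty
        is-empty a _ _ with flag a | empty? (cell a) in eq
        is-empty a _ () | true  | false
        is-empty a () _ | false | _
        is-empty a _ _  | true  | true = empty?-sound eq

        blank-cell : ∀ i {j} → toℕ i ≡ suc j → toℕ i < W → length w ≤ j → cellAt i ≡ (cellIn (map input w) j , none)
        blank-cell i {j} i≡ i<W n≤j = trans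
          (is-empty (letter i) (in-first-row i (≤-trans (s≤s z≤n) (≤-reflexive (sym i≡))) i<W)
                               (after-input i (≤-trans (s≤s n≤j) (≤-reflexive (sym i≡)))))
          (cong (_, none) (sym (cellIn-beyond (map input w) (≤-trans (≤-reflexive (List.length-map input w)) n≤j))))

        row-cell : ∀ i {j} → toℕ i ≡ suc j → toℕ i < W → j < length w ⊎ length w ≤ j →
                   cellAt i ≡ (cellIn (map input w) j , none)
        row-cell i {j} i≡ i<W (inj₁ j<n) = input-cells j i i≡ j<n
        row-cell i {j} i≡ i<W (inj₂ n≤j) = blank-cell i i≡ i<W n≤j

        initial : ∀ i → toℕ i < W → cellAt i ≡ expected (toℕ i)
        initial Fin.zero    _   = trans (trans (cong cell first-letter) (cell-letterOf true _)) (sym expected-0)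
        initial (Fin.suc j) i<W =
          trans (row-cell (Fin.suc j) refl i<W (<-≤-connex (toℕ j) (length w))) (sym (expected-input (toℕ j) i<W))

        accepting-run : letter j₀ ≡ letterOf false empty → ∀ p q → p Fin.< q → accepted (letter p) ≡ true →
                        ∃[ t ] Halted (run t (init w)) × Accepting (run t (init w))
        accepting-run j₀-empty p q p<q acc = expected-accepts (toℕ p)
          (trans (cong accepts (sym (matches j₀-empty initial (toℕ p) (≤-trans p<q (toℕ≤ q)) p refl))) acc)

  module Input (next-unique : ∀ {i j : Position} → i Fin.< j → within N {i} {j} next-event → toℕ j ≡ suc (toℕ i)) where

    module _ (x : Fin m) (v : List (Fin m)) {i i₁ : Position} (i₁≡ : toℕ i₁ ≡ suc (toℕ i)) where

      first-letter-cell : letter i₁ ≡ inputLetter x → ∀ p → toℕ p ≡ toℕ i + 1 → cellAt p ≡ (input x , none)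
      first-letter-cell here p p≡ = trans (cong cell (trans (cong letter p≡i₁) here)) (cell-letterOf true _)
        where
        p≡i₁ : p ≡ i₁
        p≡i₁ = Fin.toℕ-injective (trans p≡ (trans (+-comm (toℕ i) 1) (sym i₁≡)))

      input-cells-∷ : letter i₁ ≡ inputLetter x →
        (∀ j p → toℕ p ≡ toℕ i₁ + suc j → j < length v → cellAt p ≡ (cellIn (map input v) j , none)) →
        ∀ j p → toℕ p ≡ toℕ i + suc j → j < length (x ∷ v) → cellAt p ≡ (cellIn (map input (x ∷ v)) j , none)
      input-cells-∷ here there zero    p p≡ _ = first-letter-cell here p p≡
      input-cells-∷ here there (suc j) p p≡ (s≤s j<) =
        there j p (trans p≡ (trans (+-suc (toℕ i) (suc j)) (cong (_+ suc j) (sym i₁≡)))) j<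

    follow⁻¹ : ∀ v {i} → i ⊨ follow inputLetter end v → ¬ ¬
      ((∀ j p → toℕ p ≡ toℕ i + suc j → j < length v → cellAt p ≡ (cellIn (map input v) j , none)) ×
       ∃[ e ] toℕ e ≡ toℕ i + length v × e ⊨ end)
    follow⁻¹ [] {i} ends ¬follows = ¬follows ((λ _ _ _ ()) , i , sym (+-identityʳ (toℕ i)) , ends)
    follow⁻¹ (x ∷ v) {i} (i₁ , i<i₁ , near , holds) ¬follows =
      ⊨-and⁻¹ (atom (inputLetter x)) (follow inputLetter end v) holds λ { (here , rest) →
      follow⁻¹ v rest λ { (there , e , e≡ , ends) →
      ¬follows (input-cells-∷ x v (next-unique i<i₁ near) here there , e ,
                trans e≡ (trans (cong (_+ length v) (next-unique i<i₁ near)) (sym (+-suc (toℕ i) (length v)))) , ends) } }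

  sound : Fin.zero ⊨ global and (atom first and follow inputLetter end w) →
          ¬ ¬ (∃[ t ] Halted (run t (init w)) × Accepting (run t (init w)))
  sound holds rejects =
    ⊨-and⁻¹ {Fin.zero} global (atom first and follow inputLetter end w) holds λ { (globally , starts) →
    ⊨-and⁻¹ {Fin.zero} no-fault (first-row-flagged and (second-row-empty and acceptance)) globally λ { (fault-free , rest) →
    ⊨-and⁻¹ {Fin.zero} first-row-flagged (second-row-empty and acceptance) rest λ { (row-flagged , rest′) →
    ⊨-and⁻¹ {Fin.zero} second-row-empty acceptance rest′ λ { ((j₀ , 0<j₀ , win , j₀-empty) , p , _ , _ , at-p) →
    ⊨-and⁻¹ {p} (having accepted) (F later truth) at-p λ { (acc , q , p<q , _) →
    ⊨-and⁻¹ {Fin.zero} (atom first) (follow inputLetter end w) starts λ { (first-letter , follows) →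
    let open Faultless (everywhere fault-free)
        open Timeline (λ i j → within N {i} {j} next-event) (λ i j → within N {i} {j} shift)
                      (next-event-≼ N) (shift-≼ N) gap successor copy
        open Input next-unique in
    follow⁻¹ w follows λ { (input-cells , e , e≡ , ends) →
    let open Rows j₀ win 0<j₀
        open Initial first-letter input-cells
          (λ i n<i → ¬-not λ is-stray → ends (i , e<i e≡ n<i , later-within N (e<i e≡ n<i) , ⊨-having stray is-stray))
          (λ i 0<i near → ¬-not λ is-unflagged → near (row-apart N {Fin.zero} {i} 0<i λ win → row-flagged (i , 0<i , win , ⊨-having unflagged is-unflagged)))
    in rejects (accepting-run j₀-empty p q p<q (⊨-having⁻¹ accepted acc)) } } } } } } }
    where
    e<i : ∀ {e i : Position} → toℕ e ≡ length w → length w < toℕ i → e Fin.< i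
    e<i e≡ n<i = ≤-trans (s≤s (≤-reflexive e≡)) n<i
    everywhere : Fin.zero ⊨ no-fault → ∀ i → ¬ (i ⊨ fault)
    everywhere fault-free Fin.zero    x = fault-free (inj₁ x)
    everywhere fault-free (Fin.suc i) x = fault-free (inj₂ (Fin.suc i , s≤s z≤n , later-within N {Fin.zero} {Fin.suc i} (s≤s z≤n) , x))

-- From acceptance to satisfiability

module Completeness {m : ℕ} (M : TM 1 (Fin m)) (open-end : ℕ) (W N : ℕ) (16W≡span : 16 * W ≡ span N) (0<W : 0 < W) where
  open Letters M

  C : ℕ
  C = span N

  -- The index of the last event: the word must contain the place W and go on after the accepting
  -- place `open-end`.
  Z : ℕ
  Z = open-end + W + 1

  W≤Z : W ≤ Z
  W≤Z = ≤-trans (m≤n+m W open-end) (m≤m+n (open-end + W) 1)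

  flagged : ∀ a → flag a ≡ true → unflagged a ≡ true → ⊥
  flagged a e u with flag a | e | u
  ... | true | refl | ()

  unmarked : ∀ a → flag a ≡ false → stray a ≡ true → ⊥
  unmarked a e s with flag a | e | s
  ... | false | refl | ()

  clean : ∀ a → cell a ≡ empty → stray a ≡ true → ⊥
  clean a e s with flag a | cell a | e | s
  ... | true  | _ | refl | ()
  ... | false | _ | refl | ()

  module Word (E : ℕ → Cell) where

    ρ : TimedWord (Fin letterCount)
    ρ = record
      { size-1 = Z
      ; letter = λ i → letterOf (toℕ i <ᵇ W) (E (toℕ i))
      -- All gaps are the shortest possible. As `16 * W` is the span, the event W places on lies
      -- exactly on the closed left end of `shift`.
      ; time   = λ i → fromℕ (16 * toℕ i)
      ; starts = ≤-constant (fromℕ 0) {0} (λ _ → refl) {0} z≤n , constant-≤ (fromℕ 0) {0} (λ _ → refl) {0} z≤n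
      ; strict = λ {i} {j} i<j → fromℕ-mono {16 * toℕ i} {16 * toℕ j} (spaced i<j)
      }
      where
      spaced : ∀ {a b} → a < b → 16 * a + 2 < 16 * b
      spaced {a} {b} a<b = begin-strict
        16 * a + 2    <⟨ +-monoʳ-< (16 * a) (s≤s (s≤s (s≤s z≤n))) ⟩
        16 * a + 16   ≡⟨ trans (+-comm (16 * a) 16) (sym (*-suc 16 a)) ⟩
        16 * suc a    ≤⟨ *-monoʳ-≤ 16 a<b ⟩
        16 * b        ∎
        where open ≤-Reasoning

    open Semantics N ρ
    open Timing ρ using (within; later-within)

    place : ∀ k → k ≤ Z → Position
    place k k≤Z = Fin.fromℕ< (s≤s k≤Z)

    toℕ-place : ∀ {k} (k≤Z : k ≤ Z) → toℕ (place k k≤Z) ≡ k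
    toℕ-place k≤Z = Fin.toℕ-fromℕ< (s≤s k≤Z)

    toℕ≤Z : ∀ (i : Position) → toℕ i ≤ Z
    toℕ≤Z i = s≤s⁻¹ (Fin.toℕ<n i)

    duration : Position → Position → ℝ
    duration i j = time j -ℝ time i

    distance : ∀ i j gap → toℕ j ≡ toℕ i + gap → ∀ n → seq (duration i j) n ≡ nat (16 * gap)
    distance i j gap e = fromℕ-difference {16 * toℕ i} {16 * toℕ j} (16 * gap) (trans (cong (16 *_) e) (*-distribˡ-+ 16 (toℕ i) gap))

    never-now : ∀ i j → i Fin.< j → ¬ within N {i} {j} now
    never-now i j i<j (_ , <16) = <⇒≱ (constant-< (duration i j) (distance i j gap j≡) {16} <16)
      (≤-trans (*-monoʳ-≤ 16 {1} {gap} (m<n⇒0<n∸m i<j)) ≤-refl)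
      where
      gap = toℕ j ∸ toℕ i
      j≡ : toℕ j ≡ toℕ i + gap
      j≡ = sym (m+[n∸m]≡n (<⇒≤ i<j))

    is-next : ∀ i j → toℕ j ≡ suc (toℕ i) → within N {i} {j} next-event
    is-next i j e = ≤-constant (duration i j) d≡ {16} (m≤m+n 16 0) , constant-≤ (duration i j) d≡ {17} (m≤m+n 16 1)
      where d≡ = distance i j 1 (trans e (+-comm 1 (toℕ i)))

    next-is : ∀ i j → i Fin.< j → within N {i} {j} next-event → toℕ j ≡ suc (toℕ i)
    next-is i j i<j (_ , ≤17) = ≤-antisym
      -- Two gaps make 32, and a distance in the window is at most 19 by `constant-≤⁻¹`, whose error
      -- 2 does no harm here.
      (s≤s⁻¹ (≰⇒> λ 2+i≤j → <⇒≱ (m≤m+n 20 12)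
        (≤-trans (*-monoʳ-≤ 16 {2} {gap} (m+n≤o⇒m≤o∸n 2 2+i≤j)) (constant-≤⁻¹ (duration i j) (distance i j gap j≡) {17} ≤17)))) i<j
      where
      gap = toℕ j ∸ toℕ i
      j≡ : toℕ j ≡ toℕ i + gap
      j≡ = sym (m+[n∸m]≡n (<⇒≤ i<j))

    is-shift : ∀ i j → toℕ j ≡ toℕ i + W → within N {i} {j} shift
    is-shift i j e = ≤-constant (duration i j) d≡ {C} (≤-reflexive (sym 16W≡span)) ,
                     constant-≤ (duration i j) d≡ {suc C} (≤-trans (≤-reflexive 16W≡span) (n≤1+n C))
      where d≡ = distance i j W e

    beyond-is : ∀ i j → i Fin.< j → within N {i} {j} beyond → toℕ i + W < toℕ j
    beyond-is i j i<j C< = begin-strict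
      toℕ i + W   <⟨ +-monoʳ-< (toℕ i) (*-cancelˡ-< 16 W gap (≤-trans (s≤s (≤-reflexive 16W≡span)) (<-constant (duration i j) (distance i j gap (sym j≡)) {C} C<))) ⟩
      toℕ i + gap   ≡⟨ j≡ ⟩
      toℕ j       ∎
      where
      open ≤-Reasoning
      gap = toℕ j ∸ toℕ i
      j≡ : toℕ i + gap ≡ toℕ j
      j≡ = m+[n∸m]≡n (<⇒≤ i<j)

    row-is : ∀ j → within N {Fin.zero} {j} row → toℕ j < W
    row-is j (_ , <C) = *-cancelˡ-< 16 (toℕ j) W
      (≤-trans (constant-< (duration Fin.zero j) (distance Fin.zero j (toℕ j) refl) {C} <C) (≤-reflexive (sym 16W≡span)))

    first-row : ∀ {k} → k < W → (k <ᵇ W) ≡ true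
    first-row {k} k<W with k <ᵇ W | <⇒<ᵇ k<W
    ... | true | _ = refl

    other-row : ∀ {k} → W ≤ k → (k <ᵇ W) ≡ false
    other-row {k} W≤k with k <ᵇ W in eq
    ... | false = refl
    ... | true  = contradiction (<ᵇ⇒< k W (subst T (sym eq) tt)) (≤⇒≯ W≤k)

    letter-at : ∀ i {k b c} → toℕ i ≡ k → (k <ᵇ W) ≡ b → E k ≡ c → letter i ≡ letterOf b c
    letter-at i refl b≡ c≡ = cong₂ letterOf b≡ c≡

    cell-at : ∀ i → cell (letter i) ≡ E (toℕ i)
    cell-at i = cell-letterOf (toℕ i <ᵇ W) (E (toℕ i))

    flag-at : ∀ i → flag (letter i) ≡ (toℕ i <ᵇ W)
    flag-at i = flag-letterOf (toℕ i <ᵇ W) (E (toℕ i))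

    module Checks
      (E-rule : ∀ k → E (suc k + W) ≡ rule (E k) (E (suc k)) (E (2 + k)))
      (E-0 : E 0 ≡ (blank , pre)) (E-W : E W ≡ empty) where

      copied : ∀ i j k → toℕ j ≡ suc (toℕ i) → toℕ k ≡ suc (toℕ j) → toℕ j + W ≤ Z →
               j ⊨ F shift (atom (letterOf false (rule (cell (letter i)) (cell (letter j)) (cell (letter k)))))
      copied i j k ij jk ≤Z = j′ ,
        ≤-trans (≤-reflexive (+-comm 1 (toℕ j))) (≤-trans (+-monoʳ-≤ (toℕ j) 0<W) (≤-reflexive (sym j′≡))) ,
        is-shift j j′ j′≡ ,
        letter-at j′ (trans j′≡ (cong (_+ W) ij)) (other-row (m≤n+m W (suc (toℕ i)))) (trans (E-rule (toℕ i)) same-rule)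
        where
        j′ = place (toℕ j + W) ≤Z
        j′≡ : toℕ j′ ≡ toℕ j + W
        j′≡ = toℕ-place ≤Z
        same-rule : rule (E (toℕ i)) (E (suc (toℕ i))) (E (2 + toℕ i)) ≡ rule (cell (letter i)) (cell (letter j)) (cell (letter k))
        same-rule = trans
          (cong₂ (λ a b → rule a b (E (2 + toℕ i))) (sym (cell-at i)) (trans (cong E (sym ij)) (sym (cell-at j))))
          (cong (rule (cell (letter i)) (cell (letter j))) (trans (cong E (sym (trans jk (cong suc ij)))) (sym (cell-at k))))

      not-miscopied : ∀ {i} a b c → ¬ (i ⊨ miscopied a b c)
      not-miscopied {i} a b c bad =
        ⊨-and⁻¹ (atom a) (F next-event φ₁) bad λ { (refl , j , i<j , near₁ , bad₁) →
        ⊨-and⁻¹ (atom b) φ₂ bad₁ λ { (refl , bad₂) →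
        ⊨-and⁻¹ (F next-event (atom c)) φ₃ bad₂ λ { ((k , j<k , near₂ , refl) , bad₃) →
        ⊨-and⁻¹ (F beyond truth) φ₄ bad₃ λ { ((l , j<l , far , _) , ¬copied) →
        ¬copied (copied i j k (next-is i j i<j near₁) (next-is j k j<k near₂)
                        (≤-trans (<⇒≤ (beyond-is j l j<l far)) (toℕ≤Z l))) } } } }
        where
        φ₄ φ₃ φ₂ φ₁ : Formulae
        φ₄ = neg (F shift (atom (letterOf false (rule (cell a) (cell b) (cell c)))))
        φ₃ = F beyond truth and φ₄
        φ₂ = F next-event (atom c) and φ₃
        φ₁ = atom b and φ₂

      not-fault : ∀ {i} → ¬ (i ⊨ fault)
      not-fault {i} (inj₁ (j , i<j , soon , _)) = never-now i j i<j soon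
      not-fault {i} (inj₂ (inj₁ bad)) = ⊨-and⁻¹ (F later truth) (neg (F next-event truth)) bad
        λ { ((j , i<j , _) , ¬next) → ¬next (successor j i<j) }
        where
        successor : ∀ j → i Fin.< j → i ⊨ F next-event truth
        successor j i<j = i₁ , ≤-reflexive (sym i₁≡) , is-next i i₁ i₁≡ , ⊨-truth i₁
          where
          i₁ = place (suc (toℕ i)) (≤-trans i<j (toℕ≤Z j))
          i₁≡ : toℕ i₁ ≡ suc (toℕ i)
          i₁≡ = toℕ-place (≤-trans i<j (toℕ≤Z j))
      not-fault {i} (inj₂ (inj₂ bad)) = at-letters (⊨-some⁻¹ (λ a → some λ b → some λ c → miscopied a b c) bad)
        where
        at-letters : ∃[ a ] i ⊨ some (λ b → some λ c → miscopied a b c) → ⊥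
        at-letters (a , bad₁) = at-two (⊨-some⁻¹ (λ b → some λ c → miscopied a b c) bad₁)
          where
          at-two : ∃[ b ] i ⊨ some (λ c → miscopied a b c) → ⊥
          at-two (b , bad₂) = at-three (⊨-some⁻¹ (λ c → miscopied a b c) bad₂)
            where
            at-three : ∃[ c ] i ⊨ miscopied a b c → ⊥
            at-three (c , bad₃) = not-miscopied a b c bad₃

      row-flagged : Fin.zero ⊨ first-row-flagged
      row-flagged (j , _ , win , un) = flagged (letter j)
        (trans (flag-at j) (first-row (row-is j win))) (⊨-having⁻¹ unflagged un)

      row-end : Fin.zero ⊨ second-row-empty
      row-end = j , ≤-trans 0<W (≤-reflexive (sym j≡)) , is-shift Fin.zero j j≡ , letter-at j j≡ (other-row ≤-refl) E-W
        where
        j = place W W≤Z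
        j≡ : toℕ j ≡ W
        j≡ = toℕ-place W≤Z

      starts-first : letter Fin.zero ≡ first
      starts-first = letter-at Fin.zero refl (first-row 0<W) E-0

      later-accepts : ∀ k → accepts (E k) ≡ true → 0 < k
      later-accepts zero    e = contradiction (trans (sym (cong accepts E-0)) e) λ ()
      later-accepts (suc k) _ = s≤s z≤n

      reaches : accepts (E open-end) ≡ true → Fin.zero ⊨ acceptance
      reaches acc = p , 0<p , later-within N {Fin.zero} {p} 0<p ,
        ⊨-and (having accepted) (F later truth)
          (⊨-having accepted (trans (cong accepts (trans (cell-at p) (cong E p≡))) acc))
          (q , p<q , later-within N {p} {q} p<q , ⊨-truth q)
        where
        end≤ : open-end ≤ Z
        end≤ = ≤-trans (m≤m+n open-end W) (m≤m+n (open-end + W) 1)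
        p q : Position
        p = place open-end end≤
        p≡ : toℕ p ≡ open-end
        p≡ = toℕ-place end≤
        q = place Z ≤-refl
        p<q : p Fin.< q
        p<q = ≤-trans (s≤s (≤-trans (≤-reflexive p≡) (m≤m+n open-end W)))
          (≤-trans (≤-reflexive (+-comm 1 (open-end + W))) (≤-reflexive (sym (toℕ-place {Z} ≤-refl))))
        0<p : 0 < toℕ p
        0<p = ≤-trans (later-accepts open-end acc) (≤-reflexive (sym p≡))

      globally : accepts (E open-end) ≡ true → Fin.zero ⊨ global
      globally acc = ⊨-and no-fault (first-row-flagged and (second-row-empty and acceptance)) fault-free
        (⊨-and first-row-flagged (second-row-empty and acceptance) row-flagged
          (⊨-and second-row-empty acceptance row-end (reaches acc)))
        where
        fault-free : Fin.zero ⊨ no-fault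
        fault-free (inj₁ bad)               = not-fault bad
        fault-free (inj₂ (_ , _ , _ , bad)) = not-fault bad

      Spells : ℕ → List (Fin m) → Set
      Spells i v = ∀ j → suc (i + j) < W → E (suc (i + j)) ≡ (cellIn (map input v) j , none)

      ended : ∀ i → Spells (toℕ i) [] → i ⊨ end
      ended i spells (j , i<j , _ , is-stray) = stray-false (<-≤-connex (toℕ j) W) (⊨-having⁻¹ stray is-stray)
        where
        k = toℕ j ∸ suc (toℕ i)
        j≡ : suc (toℕ i + k) ≡ toℕ j
        j≡ = m+[n∸m]≡n i<j
        stray-false : toℕ j < W ⊎ W ≤ toℕ j → stray (letter j) ≡ true → ⊥
        stray-false (inj₁ j<W) = clean (letter j)
          (trans (cell-at j) (trans (cong E (sym j≡)) (spells k (≤-trans (s≤s (≤-reflexive j≡)) j<W))))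
        stray-false (inj₂ W≤j) = unmarked (letter j) (trans (flag-at j) (other-row W≤j))

      follows : ∀ v i → toℕ i + length v < W → Spells (toℕ i) v → i ⊨ follow inputLetter end v
      follows []      i _   spells = ended i spells
      follows (x ∷ v) i i+n spells = i₁ , ≤-reflexive (sym i₁≡) , is-next i i₁ i₁≡ ,
        ⊨-and (atom (inputLetter x)) (follow inputLetter end v)
          (letter-at i₁ i₁≡ (first-row 1+i<W) (trans (cong (E ∘ suc) (sym (+-identityʳ (toℕ i))))
            (spells 0 (≤-trans (s≤s (s≤s (≤-reflexive (+-identityʳ (toℕ i))))) 1+i<W))))
          (follows v i₁ (≤-trans (s≤s (≤-reflexive (trans (cong (_+ length v) i₁≡) (sym (+-suc (toℕ i) (length v)))))) i+n)
            λ j <W → trans (cong E (shifted j)) (spells (suc j) (≤-trans (s≤s (≤-reflexive (sym (shifted j)))) <W)))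
        where
        1+i<W : suc (toℕ i) < W
        1+i<W = ≤-trans (s≤s (≤-trans (s≤s (m≤m+n (toℕ i) (length v))) (≤-reflexive (sym (+-suc (toℕ i) (length v)))))) i+n
        i₁ = place (suc (toℕ i)) (≤-trans (<⇒≤ 1+i<W) W≤Z)
        i₁≡ : toℕ i₁ ≡ suc (toℕ i)
        i₁≡ = toℕ-place (≤-trans (<⇒≤ 1+i<W) W≤Z)
        shifted : ∀ j → suc (toℕ i₁ + j) ≡ suc (toℕ i + suc j)
        shifted j = cong suc (trans (cong (_+ j) i₁≡) (sym (+-suc (toℕ i) j)))

      complete : accepts (E open-end) ≡ true → ∀ w → length w < W →
                 (∀ j → suc j < W → E (suc j) ≡ (cellIn (map input w) j , none)) →
                 Fin.zero ⊨ global and (atom first and follow inputLetter end w)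
      complete acc w n<W spells = ⊨-and global (atom first and follow inputLetter end w) (globally acc)
        (⊨-and (atom first) (follow inputLetter end w) starts-first (follows w Fin.zero n<W spells))

-- The reductions from an arbitrary language in exponential space

module Hardness {m : ℕ} {L : Language (Fin m)} (M : TM 1 (Fin m))
                (decides : ∀ w → ∃[ t ] Run.Halted M (Run.run M t (Run.init M w)) ×
                           (Run.Accepting M (Run.run M t (Run.init M w)) ⇔ L w))
                (c : ℕ) (space≤ : ∀ w t → Run.space M (Run.run M t (Run.init M w)) ≤ 2 ^ poly c (length w)) where
  open Letters M

  -- The exponent of the span is `suc (N w)`, that is 6 more than the exponent of the space bound:
  -- this is the factor 64. The same c is the number of nested loops that print `length w ^ c`
  -- zeros.
  p : ℕ
  p = 5 + c

  N S : List (Fin m) → ℕ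
  N w = length w ^ c + p
  S w = 2 ^ poly c (length w)

  0<S : ∀ w → 0 < S w
  0<S w = m^n>0 2 (poly c (length w))

  64S≡span : ∀ w → 64 * S w ≡ span (N w)
  64S≡span w = trans (sym (^-distribˡ-+-* 2 6 (poly c (length w))))
                     (cong (2 ^_) (shuffle (length w ^ c) c))
    where
    shuffle : ∀ x c → 6 + (x + c) ≡ suc (x + (5 + c))
    shuffle = solve-∀

  formulaOf : List (Fin m) → Formulae
  formulaOf w = global and (atom first and follow inputLetter end w)

  f : List (Fin m) → List Token
  f = reduction inputLetter c p global first end

  f-encodes : ∀ w → encode (instantiate (N w) (formulaOf w)) ≡ f w
  f-encodes = reduction-encodes inputLetter c p global first end

  satisfiable : ∀ w → L w → Satisfiable (instantiate (N w) (formulaOf w))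
  satisfiable w w∈L = from-run (decides w)
    where
    W : ℕ
    W = 4 * S w
    16W≡span : 16 * W ≡ span (N w)
    16W≡span = trans (sym (*-assoc 16 4 (S w))) (64S≡span w)
    0<W : 0 < W
    0<W = *-mono-≤ {1} {4} (s≤s z≤n) (0<S w)
    instance
      W≢0 : NonZero W
      W≢0 = >-nonZero 0<W
    wide : 2 + (S w + S w) ≤ W
    wide = ≤-trans (+-monoˡ-≤ (S w + S w) (*-monoʳ-≤ 2 (0<S w))) (≤-reflexive (quadruple (S w)))
      where
      quadruple : ∀ s → 2 * s + (s + s) ≡ 4 * s
      quadruple = solve-∀
    open Unrolling M w (S w) W (space≤ w) wide hiding (0<S)
    from-place : ∃[ k ] accepts (expected k) ≡ true → Satisfiable (instantiate (N w) (formulaOf w))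
    from-place (k , acc) = ρ , complete expected-rule expected-0 expected-W acc w
                                 (≤-trans (s≤s length-w) S<W) expected-input
      where
      open Completeness M k W (N w) 16W≡span 0<W
      open Word expected using (ρ; module Checks)
      open Checks
    from-run : ∃[ t ] Halted (run t (init w)) × (Accepting (run t (init w)) ⇔ L w) →
               Satisfiable (instantiate (N w) (formulaOf w))
    from-run (t , halted , iff) = from-place (accepted-expected t halted (Equivalence.from iff w∈L))

  unsatisfiable : ∀ w → Satisfiable (instantiate (N w) (formulaOf w)) → L w
  unsatisfiable w (ρ , models) = from-run (decides w)
    where
    from-run : ∃[ t ] Halted (run t (init w)) × (Accepting (run t (init w)) ⇔ L w) → L w
    -- The run found in the model may end at another time t′, but all halted configurations of a
    -- deterministic run coincide. Acceptance is a Boolean equation and hence stable.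
    from-run (t , halted , iff) = Equivalence.to iff (decidable-stable (accepting (Config.state (run t (init w))) Bool.≟ true)
      λ rejects → Soundness.sound M w (S w) (N w) (space≤ w) (0<S w) (≤-reflexive (64S≡span w)) ρ models
        λ { (t′ , halted′ , accepts′) → rejects (subst Accepting (halted-unique t′ t (init w) halted′ halted) accepts′) })

  decode : ∀ w {n} (φ : Formula (Fin n)) → encode φ ≡ f w → Satisfiable φ → L w
  decode w φ e sat = unsatisfiable w (subst (Satisfiable ∘ proj₂)
    (encode-injective φ (instantiate (N w) (formulaOf w)) (trans e (sym (f-encodes w)))) sat)

  f-polyTime : PolyTime f
  f-polyTime = reduction-polyTime inputLetter c p global first end

  to-SAT[F] : ∀ w → L w → SAT-MITL[F] (f w)
  to-SAT[F] w w∈L = letterCount , instantiate (N w) (formulaOf w) ,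
    instantiate-pastFree (N w) (formulaOf w) , f-encodes w , satisfiable w w∈L

  from-SAT[F] : ∀ w → SAT-MITL[F] (f w) → L w
  from-SAT[F] w (_ , φ , _ , e , sat) = decode w φ e sat

  to-SAT[F,P] : ∀ w → L w → SAT-MITL[F,P] (f w)
  to-SAT[F,P] w w∈L = letterCount , instantiate (N w) (formulaOf w) , f-encodes w , satisfiable w w∈L

  from-SAT[F,P] : ∀ w → SAT-MITL[F,P] (f w) → L w
  from-SAT[F,P] w (_ , φ , e , sat) = decode w φ e sat

  SAT[F]-hard : L ≤ₚ SAT-MITL[F]
  SAT[F]-hard = f , f-polyTime , λ w → mk⇔ (to-SAT[F] w) (from-SAT[F] w)

  SAT[F,P]-hard : L ≤ₚ SAT-MITL[F,P]
  SAT[F,P]-hard = f , f-polyTime , λ w → mk⇔ (to-SAT[F,P] w) (from-SAT[F,P] w)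

theorem5 : EXPSPACE-hard SAT-MITL[F] × EXPSPACE-hard SAT-MITL[F,P]
theorem5 = (λ { m L (M , decides , c , space≤) → Hardness.SAT[F]-hard M decides c space≤ })
         , (λ { m L (M , decides , c , space≤) → Hardness.SAT[F,P]-hard M decides c space≤ })
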